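{- Let $(W,S)$ be a finite Coxeter system and $k\geq 0$ an integer. For any two Coxeter elements $c,c'$ of $W$ (with any chosen reduced words $\mathbf{c},\mathbf{c}'$), the multi-cluster complexes $\Delta^k_c(W)$ and $\Delta^k_{c'}(W)$ are isomorphic simplicial complexes.
   Context: A Coxeter element is the product of all elements of $S$ in some order; $\mathbf{c}$ denotes a reduced word for $c$. $w_\circ$ is the longest element of $W$. The $c$-sorting word $\mathbf{w}_\circ(\mathbf{c})$ is the lexicographically first (as a sequence of positions) subword of the infinite word $\mathbf{c}\mathbf{c}\mathbf{c}\cdots$ which is a reduced expression for $w_\circ$. For a word $Q=(q_1,\dots,q_r)$ in $S$ and $\pi\in W$, the subword complex $\Delta(Q,\pi)$ is the simplicial complex on the positions $\{1,\dots,r\}$ of $Q$ whose faces are the subsets $P$ such that the word obtained from $Q$ by deleting the positions in $P$ contains a subword which is a reduced expression for $\pi$. The multi-cluster complex is $\Delta^k_c(W)=\Delta(\mathbf{c}^k\,\mathbf{w}_\circ(\mathbf{c}),w_\circ)$, where $\mathbf{c}^k\mathbf{w}_\circ(\mathbf{c})$ is the concatenation of $k$ copies of $\mathbf{c}$ followed by $\mathbf{w}_\circ(\mathbf{c})$. -}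

module Defs where

open import Data.Nat using (ℕ; zero; suc; _≤_; _<_)
open import Data.Fin using (Fin; zero; suc; toℕ; _≟_)
open import Data.Fin.Properties using (any?)
open import Data.Bool using (Bool; true; false; if_then_else_; _∧_)
import Data.Bool
open import Data.List using (List; []; _∷_; _++_; length; lookup; map; concat; replicate)
open import Data.List.Relation.Unary.Any using (Any)
open import Data.List.Relation.Unary.Linked using (Linked)
open import Data.Product using (Σ; _×_; _,_; ∃)
open import Relation.Binary.PropositionalEquality using (_≡_; _≢_)
open import Relation.Nullary using (does)

-- Coxeter matrices and the Coxeter group W given by its presentation.
-- S = Fin n.  Entries are natural numbers (m_st = ∞ is excluded; this
-- is harmless for finite Coxeter systems, where every m_st is finite).

record CoxeterMatrix (n : ℕ) : Set where
  field
    m        : Fin n → Fin n → ℕ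
    m-diag   : ∀ s → m s s ≡ 1
    m-sym    : ∀ s t → m s t ≡ m t s
    m-offdiag : ∀ s t → s ≢ t → 2 ≤ m s t

Word : ℕ → Set
Word n = List (Fin n)

module Coxeter {n : ℕ} (M : CoxeterMatrix n) where
  open CoxeterMatrix M

  relator : Fin n → Fin n → Word n
  relator s t = concat (replicate (m s t) (s ∷ t ∷ []))

  -- equality in W: the congruence on words generated by (s t)^{m_st} = e
  data _≈_ : Word n → Word n → Set where
    rel   : ∀ u v s t → (u ++ relator s t ++ v) ≈ (u ++ v)
    ≈refl  : ∀ {u} → u ≈ u
    ≈sym   : ∀ {u v} → u ≈ v → v ≈ u
    ≈trans : ∀ {u v w} → u ≈ v → v ≈ w → u ≈ w

  Finite : Set
  Finite = Σ (List (Word n)) λ L → ∀ w → Any (w ≈_) L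

  Reduced : Word n → Set
  Reduced w = ∀ u → u ≈ w → length w ≤ length u

  -- reduced expression of the longest element w∘
  -- (a reduced word of maximal length among all reduced words)
  IsLongestWord : Word n → Set
  IsLongestWord w = Reduced w × (∀ u → Reduced u → length u ≤ length w)

  -- 𝐜 is a reduced word for a Coxeter element: σ lists every element of S
  -- exactly once (in some order), c = product of σ, and 𝐜 is a reduced word for c
  IsCoxeterWord : Word n → Set
  IsCoxeterWord 𝐜 =
    Σ (Word n) λ σ → (∀ s → Σ (Fin (length σ)) λ i → lookup σ i ≡ s)
                   × length σ ≡ n × 𝐜 ≈ σ × Reduced 𝐜

  -- c-sorting word of w∘: positions in 𝐜𝐜𝐜⋯ are pairs (copy index, index in 𝐜)

  Pos : Word n → Set
  Pos 𝐜 = ℕ × Fin (length 𝐜)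

  letterAt : (𝐜 : Word n) → Pos 𝐜 → Fin n
  letterAt 𝐜 (i , j) = lookup 𝐜 j

  data PosLt (𝐜 : Word n) : Pos 𝐜 → Pos 𝐜 → Set where
    <copy  : ∀ {i i' j j'} → i < i' → PosLt 𝐜 (i , j) (i' , j')
    <inner : ∀ {i j j'} → toℕ j < toℕ j' → PosLt 𝐜 (i , j) (i , j')

  data LexLeq (𝐜 : Word n) : List (Pos 𝐜) → List (Pos 𝐜) → Set where
    lex-[] : ∀ {ys} → LexLeq 𝐜 [] ys
    lex-<  : ∀ {x y xs ys} → PosLt 𝐜 x y → LexLeq 𝐜 (x ∷ xs) (y ∷ ys)
    lex-≡  : ∀ {x xs ys} → LexLeq 𝐜 xs ys → LexLeq 𝐜 (x ∷ xs) (x ∷ ys)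

  IsSortingWord : Word n → Word n → Set
  IsSortingWord 𝐜 w =
    Σ (List (Pos 𝐜)) λ ps →
      Linked (PosLt 𝐜) ps × map (letterAt 𝐜) ps ≡ w × IsLongestWord w
      × (∀ ps' → Linked (PosLt 𝐜) ps' → IsLongestWord (map (letterAt 𝐜) ps')
               → LexLeq 𝐜 ps ps')

  Subset : ℕ → Set
  Subset r = Fin r → Bool

  select : (Q : Word n) → Subset (length Q) → Word n
  select [] T = []
  select (x ∷ xs) T = if T zero then x ∷ select xs (λ i → T (suc i))
                                 else select xs (λ i → T (suc i))

  SubwordFace : (Q : Word n) → Subset (length Q) → Set
  SubwordFace Q P = Σ (Subset (length Q)) λ T →
    (∀ i → T i ≡ true → P i ≡ false) × IsLongestWord (select Q T)

  multiWord : ℕ → Word n → Word n → Word n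
  multiWord k 𝐜 w = concat (replicate k 𝐜) ++ w

  MultiClusterFace : (k : ℕ) (𝐜 w : Word n) → Subset (length (multiWord k 𝐜 w)) → Set
  MultiClusterFace k 𝐜 w = SubwordFace (multiWord k 𝐜 w)

-- isomorphism of simplicial complexes given by face predicates on
-- subsets of a ground set Fin r: a bijection of vertex sets
-- (vertices = i with {i} a face) sending faces to faces in both directions.

singleton : ∀ {r} → Fin r → Fin r → Bool
singleton i j = does (i ≟ j)

image : ∀ {r r'} → (Fin r → Fin r') → (Fin r → Bool) → Fin r' → Bool
image f P j = does (any? λ i → P i ∧ does (f i ≟ j) Data.Bool.≟ true)

SimplicialIso : ∀ {r r'} → ((Fin r → Bool) → Set) → ((Fin r' → Bool) → Set) → Set
SimplicialIso {r} {r'} Δ Δ' =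
  Σ (Fin r → Fin r') λ f → Σ (Fin r' → Fin r) λ g →
      (∀ i → Δ (singleton i) → Δ' (singleton (f i)))
    × (∀ j → Δ' (singleton j) → Δ (singleton (g j)))
    × (∀ i → Δ (singleton i) → g (f i) ≡ i)
    × (∀ j → Δ' (singleton j) → f (g j) ≡ j)
    × (∀ P → Δ P → Δ' (image f P))
    × (∀ P → Δ' P → Δ (image g P))

{-# OPTIONS --safe #-}
module Submission where

-- Rotating the word s Q to Q y, where s w∘ = w∘ y, and commuting adjacent letters of Q change Δ(Q , w∘) only by
-- renaming positions, so it suffices to connect any two Coxeter words by commutations and by moves s d ↦ d s, and
-- to see that the word 𝐜^k w∘(𝐜) follows along.
--
-- Connecting Coxeter words: if every vertex of some subgraph of the Coxeter graph had two neighbours there, a walk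
-- that never backtracks would spell reduced words of unbounded length.  Hence every subgraph has a vertex with at
-- most one neighbour, and one inducts by removing it.
--
-- Following along: w∘(𝐜) is the greedy reduced subword of 𝐜𝐜𝐜⋯.  The greedy runs for s d and d s differ only in that
-- the second one takes a letter y that the first one skips.  A letter skipped by a greedy run commutes with
-- everything taken later, so y can be moved to the end.  This uses the skew form ω_c on the root space: along the
-- run, ω_c(β , γ) ≤ 0 whenever the positive root β is already inverted and the positive root γ is not, whereas
-- ω_c(α_x , γ) ≥ 0 for the first letter x of c; so if x is skipped, all γ not yet inverted are supported away from x
-- and its neighbours.
--
-- The root space is integral: instead of 2 cos (π / m) the edge s t acts on ℤ^ℕ as the adjacency operator of a
-- disjoint union of paths with m − 1 vertices, which is a non-negative operator a with U_{m−1}(a / 2) = 0 and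
-- U_{k−1}(a / 2) ≥ 0 for k ≤ m.

open import Defs
open import Data.Nat using (ℕ; zero; suc)
open import Data.Bool using (Bool; true; false; not; _xor_; if_then_else_; _∧_)
open import Data.Bool.Properties using (not-involutive; not-¬; xor-assoc; xor-same)
open import Data.Empty using (⊥; ⊥-elim)
open import Data.Fin using (Fin; zero; suc; punchIn; punchOut)
open import Data.Fin.Properties using (any?; all?; _≟_; punchIn-punchOut; ¬∀⟶∃¬)
open import Data.List using (List; []; _∷_; _++_; _∷ʳ_; length; lookup; concat; replicate; reverse; allFin; initLast; _∷ʳ′_; map)
open import Data.List.Membership.Propositional using (_∈_; _∉_; find)
open import Data.List.Membership.Propositional.Properties using (∈-allFin; ∈-map⁺; ∈-∃++; ∈-++⁺ˡ; ∈-++⁺ʳ; ∈-lookup)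
open import Data.List.Properties using (++-assoc; ++-identityʳ; length-++; unfold-reverse; length-reverse; ∷-injective; length-tabulate; map-++; map-∘; map-tabulate; tabulate-lookup)
open import Data.List.Relation.Binary.Permutation.Propositional using (_↭_; prep; swap; ↭-sym; ↭-trans; ↭⇒↭ₛ; ↭-refl; ↭-reflexive)
open import Data.List.Relation.Binary.Permutation.Propositional.Properties using (++-comm; ∈-resp-↭; All-resp-↭; shift; drop-mid; ↭-empty-inv; ↭-length)
open import Data.List.Relation.Unary.All using (All; []; _∷_)
open import Data.List.Relation.Unary.AllPairs using ([]; _∷_; AllPairs)
open import Data.List.Relation.Unary.Any using (Any; here; there)
open import Data.List.Relation.Unary.Linked.Properties using (Linked⇒AllPairs; AllPairs⇒Linked)
open import Data.List.Relation.Unary.Unique.Propositional using (Unique)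
open import Data.List.Relation.Unary.Unique.Propositional.Properties using (allFin⁺)
open import Data.Product using (Σ; ∃; ∃₂; _×_; _,_; proj₁; proj₂)
open import Data.Sum using (_⊎_; inj₁; inj₂)
open import Function using (_∘_)
open import Function.Bundles using (mk⇔)
open import Relation.Binary.Bundles using (Setoid)
open import Relation.Binary.PropositionalEquality
open import Relation.Nullary using (¬_; Dec; yes; no; contradiction; does)
open import Relation.Nullary.Decidable using (dec-true; does-⇔; dec-yes; dec-no; _⊎-dec_)
import Data.List.Relation.Unary.Any as Any
import Data.List.Relation.Unary.Any.Properties as Any
import Data.List.Relation.Unary.All as All
import Data.List.Relation.Unary.All.Properties as All
import Data.List.Relation.Binary.Permutation.Setoid.Properties as SetoidPerm
import Data.List.Relation.Binary.Permutation.Propositional as Perm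
import Data.Bool
import Data.List.Relation.Unary.AllPairs.Properties as AllPairs

-- The argument is constructive and stays in ℤ. `Finite` only supplies a list that meets every group
-- element, so decidability of `_≈_` has to be extracted from it first; greedy runs, descents and
-- reduction of words all branch on it. With operators as matrix entries a root is no longer one
-- vector up to a positive scalar: it is a family obtained from a simple root with any non-negative
-- coefficient sequence, zero included, and vanishing is tested coordinate by coordinate. The
-- pairing behind ω_c would be an infinite sum; it is cut off at a K divisible by the lengths of all
-- paths, because only then is the adjacency operator self-adjoint. The sign condition on ω_c
-- travels along a run because the reflection in the first letter x carries the form of the rotated
-- word to the form of the original one. The delicate case is a skipped letter: the word rotates
-- while the group element reached stays the same, and the condition survives only because x then
-- fixes every positive root that is not yet inverted.

-- Words modulo the Coxeter relations: cancellation, decidability, descents.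

module Group {n : ℕ} (M : CoxeterMatrix n) where
  open import Data.Nat using (_+_; _≤_; _<_; s≤s; s≤s⁻¹)
  open import Data.Nat.Properties hiding (_≟_)
  open import Data.Nat.Induction using (<-rec)
  open CoxeterMatrix M
  open Coxeter M

  ≈-reflexive : ∀ {u v} → u ≡ v → u ≈ v
  ≈-reflexive refl = ≈refl

  ≈-setoid : Setoid _ _
  ≈-setoid = record
    { Carrier = Word n ; _≈_ = _≈_
    ; isEquivalence = record { refl = ≈refl ; sym = ≈sym ; trans = ≈trans } }

  module ≈-Reasoning where
    open import Relation.Binary.Reasoning.Setoid ≈-setoid public

  ++-congˡ : ∀ p {u v} → u ≈ v → (p ++ u) ≈ (p ++ v)
  ++-congˡ p (rel u v s t)  =
    subst₂ _≈_ (++-assoc p u (relator s t ++ v)) (++-assoc p u v) (rel (p ++ u) v s t)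
  ++-congˡ p ≈refl          = ≈refl
  ++-congˡ p (≈sym e)       = ≈sym (++-congˡ p e)
  ++-congˡ p (≈trans e f)   = ≈trans (++-congˡ p e) (++-congˡ p f)

  ++-congʳ : ∀ q {u v} → u ≈ v → (u ++ q) ≈ (v ++ q)
  ++-congʳ q (rel u v s t)  =
    subst₂ _≈_ (sym (trans (++-assoc u (relator s t ++ v) q) (cong (u ++_) (++-assoc (relator s t) v q))))
               (sym (++-assoc u v q)) (rel u (v ++ q) s t)
  ++-congʳ q ≈refl          = ≈refl
  ++-congʳ q (≈sym e)       = ≈sym (++-congʳ q e)
  ++-congʳ q (≈trans e f)   = ≈trans (++-congʳ q e) (++-congʳ q f)

  ∷-cong : ∀ x {u v} → u ≈ v → (x ∷ u) ≈ (x ∷ v)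
  ∷-cong x = ++-congˡ (x ∷ [])

  square-cancel : ∀ x u → (x ∷ x ∷ u) ≈ u
  square-cancel x u =
    subst (λ k → (concat (replicate k (x ∷ x ∷ [])) ++ u) ≈ u) (m-diag x) (rel [] u x x)

  reverse-cancelˡ : ∀ u v → (reverse u ++ u ++ v) ≈ v
  reverse-cancelˡ []      v = ≈refl
  reverse-cancelˡ (x ∷ u) v = begin
    reverse (x ∷ u) ++ x ∷ u ++ v       ≡⟨ cong (_++ x ∷ u ++ v) (unfold-reverse x u) ⟩
    (reverse u ∷ʳ x) ++ x ∷ u ++ v      ≡⟨ ++-assoc (reverse u) (x ∷ []) _ ⟩
    reverse u ++ x ∷ x ∷ u ++ v         ≈⟨ ++-congˡ (reverse u) (square-cancel x (u ++ v)) ⟩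
    reverse u ++ u ++ v                 ≈⟨ reverse-cancelˡ u v ⟩
    v                                   ∎
    where open ≈-Reasoning

  reverse-cancelʳ : ∀ u v → (u ++ reverse u ++ v) ≈ v
  reverse-cancelʳ []      v = ≈refl
  reverse-cancelʳ (x ∷ u) v = begin
    x ∷ u ++ reverse (x ∷ u) ++ v       ≡⟨ cong (λ r → x ∷ u ++ r ++ v) (unfold-reverse x u) ⟩
    x ∷ u ++ (reverse u ∷ʳ x) ++ v      ≡⟨ cong (λ r → x ∷ u ++ r) (++-assoc (reverse u) (x ∷ []) v) ⟩
    x ∷ u ++ reverse u ++ x ∷ v         ≈⟨ ∷-cong x (reverse-cancelʳ u (x ∷ v)) ⟩
    x ∷ x ∷ v                           ≈⟨ square-cancel x v ⟩
    v                                   ∎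
    where open ≈-Reasoning

  ∷ʳ-square-cancel : ∀ u x → ((u ∷ʳ x) ∷ʳ x) ≈ u
  ∷ʳ-square-cancel u x = begin
    (u ∷ʳ x) ∷ʳ x    ≡⟨ ++-assoc u (x ∷ []) (x ∷ []) ⟩
    u ++ x ∷ x ∷ []  ≈⟨ ++-congˡ u (square-cancel x []) ⟩
    u ++ []          ≡⟨ ++-identityʳ u ⟩
    u                ∎
    where open ≈-Reasoning

  odd : ℕ → Bool
  odd zero    = false
  odd (suc k) = not (odd k)

  -- Relators have even length. This is the sign character, which forbids that multiplication by a
  -- letter preserves the length.
  odd-length : ∀ {u v} → u ≈ v → odd (length u) ≡ odd (length v)
  odd-length (rel u v s t) = go u
    where
    power : ∀ k → odd (length (concat (replicate k (s ∷ t ∷ [])) ++ v)) ≡ odd (length v)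
    power zero    = refl
    power (suc k) = trans (not-involutive _) (power k)
    go : ∀ u → odd (length (u ++ relator s t ++ v)) ≡ odd (length (u ++ v))
    go []      = power (m s t)
    go (x ∷ u) = cong not (go u)
  odd-length ≈refl        = refl
  odd-length (≈sym e)     = sym (odd-length e)
  odd-length (≈trans e f) = trans (odd-length e) (odd-length f)

  -- A table of right multiplication on a list of representatives either is an honest
  -- permutation action, hence decides equality, or exhibits a superfluous representative.
  ≈-dec : Finite → ∀ u v → Dec (u ≈ v)
  ≈-dec (L , cover) = go (length L) (lookup L) λ w → Any.index (cover w) , Any.lookup-index (cover w)
    where
    go : ∀ N (L : Fin N → Word n) → (∀ w → Σ (Fin N) λ i → w ≈ L i) → ∀ u v → Dec (u ≈ v)
    go zero    L cov = ⊥-elim (¬Fin0 (proj₁ (cov [])))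
      where
      ¬Fin0 : Fin 0 → ⊥
      ¬Fin0 ()
    go (suc N) L cov = byTable (all? λ s → all? λ t → all? λ i → run (relator s t) i ≟ i)
      where
      run : Word n → Fin (suc N) → Fin (suc N)
      run []      i = i
      run (x ∷ u) i = run u (proj₁ (cov (L i ∷ʳ x)))

      run-sound : ∀ u i → (L i ++ u) ≈ L (run u i)
      run-sound []      i = ≈-reflexive (++-identityʳ (L i))
      run-sound (x ∷ u) i = begin
        L i ++ x ∷ u       ≡⟨ ++-assoc (L i) (x ∷ []) u ⟨
        (L i ∷ʳ x) ++ u    ≈⟨ ++-congʳ u (proj₂ (cov (L i ∷ʳ x))) ⟩
        L _ ++ u           ≈⟨ run-sound u _ ⟩
        L _                ∎
        where open ≈-Reasoning

      run-++ : ∀ u v i → run (u ++ v) i ≡ run v (run u i)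
      run-++ []      v i = refl
      run-++ (x ∷ u) v i = run-++ u v _

      start : Fin (suc N)
      start = proj₁ (cov [])

      value : ∀ u → u ≈ L (run u start)
      value u = ≈trans (++-congʳ u (proj₂ (cov []))) (run-sound u start)

      byTable : Dec (∀ s t i → run (relator s t) i ≡ i) → ∀ u v → Dec (u ≈ v)
      byTable (yes strict) u v with run u start ≟ run v start
      ... | yes p = yes (≈trans (value u) (≈trans (≈-reflexive (cong L p)) (≈sym (value v))))
      ... | no ¬p = no λ e → ¬p (run-cong e start)
        where
        run-cong : ∀ {u v} → u ≈ v → ∀ i → run u i ≡ run v i
        run-cong (rel u v s t) i = begin
          run (u ++ relator s t ++ v) i         ≡⟨ run-++ u _ i ⟩
          run (relator s t ++ v) (run u i)      ≡⟨ run-++ (relator s t) v _ ⟩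
          run v (run (relator s t) (run u i))   ≡⟨ cong (run v) (strict s t _) ⟩
          run v (run u i)                       ≡⟨ run-++ u v i ⟨
          run (u ++ v) i                        ∎
          where open ≡-Reasoning
        run-cong ≈refl        i = refl
        run-cong (≈sym e)     i = sym (run-cong e i)
        run-cong (≈trans e f) i = trans (run-cong e i) (run-cong f i)
      byTable (no ¬strict) with ¬∀⟶∃¬ n _ (λ s → all? λ t → all? λ i → run (relator s t) i ≟ i) ¬strict
      ... | s , ¬s with ¬∀⟶∃¬ n _ (λ t → all? λ i → run (relator s t) i ≟ i) ¬s
      ... | t , ¬t with ¬∀⟶∃¬ (suc N) _ (λ i → run (relator s t) i ≟ i) ¬t
      ... | i , j≢i = go N (λ k → L (punchIn j k)) cov'
        where
        j = run (relator s t) i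
        Li≈Lj : L i ≈ L j
        Li≈Lj = begin
          L i                            ≡⟨ ++-identityʳ (L i) ⟨
          L i ++ []                      ≈⟨ rel (L i) [] s t ⟨
          L i ++ relator s t ++ []       ≡⟨ cong (L i ++_) (++-identityʳ (relator s t)) ⟩
          L i ++ relator s t             ≈⟨ run-sound (relator s t) i ⟩
          L j                            ∎
          where open ≈-Reasoning
        cov' : ∀ w → Σ (Fin N) λ k → w ≈ L (punchIn j k)
        cov' w with cov w
        ... | k , e with j ≟ k
        ... | yes refl = punchOut j≢i , ≈trans e (≈trans (≈sym Li≈Lj) (≈-reflexive (cong L (sym (punchIn-punchOut j≢i)))))
        ... | no  j≢k  = punchOut j≢k , ≈trans e (≈-reflexive (cong L (sym (punchIn-punchOut j≢k))))

  Reduced-resp-≈ : ∀ {u v} → u ≈ v → length v ≤ length u → Reduced u → Reduced v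
  Reduced-resp-≈ e le r w w≈v = ≤-trans le (r w (≈trans w≈v (≈sym e)))

  Reduced-suffix : ∀ p {q} → Reduced (p ++ q) → Reduced q
  Reduced-suffix p {q} r w e = +-cancelˡ-≤ (length p) _ _
    (subst₂ _≤_ (length-++ p) (length-++ p) (r (p ++ w) (++-congˡ p e)))

  Reduced-prefix : ∀ p {q} → Reduced (p ++ q) → Reduced p
  Reduced-prefix p {q} r w e = +-cancelʳ-≤ (length q) _ _
    (subst₂ _≤_ (length-++ p) (length-++ w) (r (w ++ q) (++-congʳ q e)))

  length-∷ʳ : ∀ (u : Word n) x → length (u ∷ʳ x) ≡ suc (length u)
  length-∷ʳ u x = trans (length-++ u) (+-comm (length u) 1)

  ¬Reduced-square : ∀ p x q → ¬ Reduced (p ++ x ∷ x ∷ q)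
  ¬Reduced-square p x q r = 1+n≰n (≤-trans (n≤1+n _) (r′ q (≈sym (square-cancel x q))))
    where r′ = Reduced-suffix p {x ∷ x ∷ q} r

  module Decidable (_≈?_ : ∀ u v → Dec (u ≈ v)) where

    anyOfLength? : ∀ k {P : Word n → Set} → (∀ v → Dec (P v)) → Dec (Σ (Word n) λ v → length v ≡ k × P v)
    anyOfLength? zero P? with P? []
    ... | yes p = yes ([] , refl , p)
    ... | no ¬p = no λ { ([] , _ , p) → ¬p p }
    anyOfLength? (suc k) P? with any? (λ x → anyOfLength? k λ v → P? (x ∷ v))
    ... | yes (x , v , e , p) = yes (x ∷ v , cong suc e , p)
    ... | no ¬p = no λ { (x ∷ v , e , p) → ¬p (x , v , suc-injective e , p) }

    anyShorter? : ∀ k {P : Word n → Set} → (∀ v → Dec (P v)) → Dec (Σ (Word n) λ v → length v < k × P v)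
    anyShorter? zero P? = no λ { (_ , () , _) }
    anyShorter? (suc k) P? with anyOfLength? k P? | anyShorter? k P?
    ... | yes (v , e , p) | _               = yes (v , s≤s (≤-reflexive e) , p)
    ... | no _            | yes (v , l , p) = yes (v , m≤n⇒m≤1+n l , p)
    ... | no ¬p           | no ¬q           = no λ { (v , l , p) → split v p (m≤n⇒m<n∨m≡n (s≤s⁻¹ l)) }
      where
      split : ∀ v → _ → length v < k ⊎ length v ≡ k → ⊥
      split v p (inj₁ l) = ¬q (v , l , p)
      split v p (inj₂ e) = ¬p (v , e , p)

    reduced⊎shorter : ∀ u → Reduced u ⊎ Σ (Word n) λ v → v ≈ u × length v < length u
    reduced⊎shorter u with anyShorter? (length u) (λ v → v ≈? u)
    ... | yes (v , l , e) = inj₂ (v , e , l)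
    ... | no ¬p           = inj₁ λ v e → ≮⇒≥ λ l → ¬p (v , l , e)

    Reduced? : ∀ u → Dec (Reduced u)
    Reduced? u with reduced⊎shorter u
    ... | inj₁ r           = yes r
    ... | inj₂ (v , e , l) = no λ r → <⇒≱ l (r v e)

    reduce : ∀ u → Σ (Word n) λ v → v ≈ u × Reduced v
    reduce u = <-rec (λ k → ∀ u → length u ≡ k → Σ (Word n) λ v → v ≈ u × Reduced v) step (length u) u refl
      where
      step : ∀ k → (∀ {j} → j < k → ∀ u → length u ≡ j → Σ (Word n) λ v → v ≈ u × Reduced v)
           → ∀ u → length u ≡ k → Σ (Word n) λ v → v ≈ u × Reduced v
      step k ih u refl with reduced⊎shorter u
      ... | inj₁ r = u , ≈refl , r
      ... | inj₂ (v , e , l) with ih l v refl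
      ...   | w , e' , r = w , ≈trans e' e , r

    private
      -- Here `w` is `u` with one letter added. A shorter word for it cannot have the length of `u`,
      -- by parity, so it is shorter than `u` itself, by exactly one letter.
      drop-two : ∀ {u v w : Word n} → Reduced u → v ≈ w → length w ≡ suc (length u)
               → length v < length w → length u ≤ suc (length v) → suc (length v) ≡ length u
      drop-two {u} {v} {w} r e lw v<w u≤ = ≤-antisym (≤∧≢⇒< (s≤s⁻¹ (subst (_ <_) lw v<w)) differ) u≤
        where
        differ : length v ≢ length u
        differ p = not-¬ refl (trans (cong odd (sym p)) (trans (odd-length e) (cong odd lw)))

    descentʳ : ∀ {u x} → Reduced u → ¬ Reduced (u ∷ʳ x)
             → Σ (Word n) λ v → (v ∷ʳ x) ≈ u × suc (length v) ≡ length u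
    descentʳ {u} {x} r ¬r with reduced⊎shorter (u ∷ʳ x)
    ... | inj₁ r' = contradiction r' ¬r
    ... | inj₂ (v , e , l) = v , vx≈u , drop-two r e (length-∷ʳ u x) l (subst (length u ≤_) (length-∷ʳ v x) (r _ vx≈u))
      where vx≈u = ≈trans (++-congʳ (x ∷ []) e) (∷ʳ-square-cancel u x)

    descentˡ : ∀ {u x} → Reduced u → ¬ Reduced (x ∷ u)
             → Σ (Word n) λ v → (x ∷ v) ≈ u × suc (length v) ≡ length u
    descentˡ {u} {x} r ¬r with reduced⊎shorter (x ∷ u)
    ... | inj₁ r' = contradiction r' ¬r
    ... | inj₂ (v , e , l) = v , xv≈u , drop-two r e refl l (r _ xv≈u)
      where xv≈u = ≈trans (∷-cong x e) (square-cancel x u)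

-- Parity of inversions and the exchange condition.

module Reflections where
  open import Data.Nat using (_+_; _≤_)
  open import Data.Nat.Properties hiding (_≟_)

  alternating : {A : Set} → A → A → ℕ → List A
  alternating s t zero    = []
  alternating s t (suc k) = s ∷ alternating t s k

  alternating-odd-∷ʳ : {A : Set} (s t : A) (k : ℕ)
                     → alternating t s (suc (k + k)) ∷ʳ s ≡ t ∷ alternating s t (suc (k + k))
  alternating-odd-∷ʳ s t zero    = refl
  alternating-odd-∷ʳ s t (suc k) rewrite +-suc k k = cong (λ u → t ∷ s ∷ u) (alternating-odd-∷ʳ s t k)

  alternating-even-++ : {A : Set} (s t : A) (j k : ℕ)
                      → alternating s t (j + j + k) ≡ concat (replicate j (s ∷ t ∷ [])) ++ alternating s t k
  alternating-even-++ s t zero    k = refl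
  alternating-even-++ s t (suc j) k rewrite +-suc j j = cong (λ u → s ∷ t ∷ u) (alternating-even-++ s t j k)

  ++-split : {A : Set} (u v p : List A) {x : A} {q : List A} → u ++ v ≡ p ++ x ∷ q
           → (Σ (List A) λ q' → u ≡ p ++ x ∷ q') ⊎ (Σ (List A) λ p' → p ≡ u ++ p' × v ≡ p' ++ x ∷ q)
  ++-split []      v p       e    = inj₂ (p , refl , e)
  ++-split (y ∷ u) v []      refl = inj₁ (u , refl)
  ++-split (y ∷ u) v (z ∷ p) e with ∷-injective e
  ... | refl , e' with ++-split u v p e'
  ...   | inj₁ (q' , refl)        = inj₁ (q' , refl)
  ...   | inj₂ (p' , refl , refl) = inj₂ (p' , refl , refl)

  module Exchange {n : ℕ} (M : CoxeterMatrix n)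
                  (_≈?_ : ∀ u v → Dec (Coxeter._≈_ M u v)) where
    open CoxeterMatrix M
    open Coxeter M
    open Group M
    open Decidable _≈?_

    -- inv u r is the parity of the number of prefixes p ∷ʳ x of u with r = p x p⁻¹.
    inv : Word n → Word n → Bool
    inv []      r = false
    inv (x ∷ u) r = does (r ≈? (x ∷ [])) xor inv u (x ∷ r ∷ʳ x)

    does-cong : ∀ {r r' q q'} → (r ≈ q → r' ≈ q') → (r' ≈ q' → r ≈ q) → does (r ≈? q) ≡ does (r' ≈? q')
    does-cong f g = does-⇔ (mk⇔ f g) (_ ≈? _) (_ ≈? _)

    inv-congʳ : ∀ u {r r'} → r ≈ r' → inv u r ≡ inv u r'
    inv-congʳ []      e = refl
    inv-congʳ (x ∷ u) e = cong₂ _xor_ (does-cong (≈trans (≈sym e)) (≈trans e))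
                                      (inv-congʳ u (∷-cong x (++-congʳ (x ∷ []) e)))

    -- The cocycle rule for inversion sets: the inversions contributed by `q` are conjugated by `p`,
    -- and `reverse p` spells the inverse of `p`.
    inv-++ : ∀ p q r → inv (p ++ q) r ≡ inv p r xor inv q (reverse p ++ r ++ p)
    inv-++ []      q r = cong (inv q) (sym (++-identityʳ r))
    inv-++ (x ∷ p) q r = begin
      d xor inv (p ++ q) (x ∷ r ∷ʳ x)                                            ≡⟨ cong (d xor_) (inv-++ p q _) ⟩
      d xor (inv p (x ∷ r ∷ʳ x) xor inv q (reverse p ++ (x ∷ r ∷ʳ x) ++ p))      ≡⟨ xor-assoc d _ _ ⟨
      (d xor inv p (x ∷ r ∷ʳ x)) xor inv q (reverse p ++ (x ∷ r ∷ʳ x) ++ p)      ≡⟨ cong (λ w → inv (x ∷ p) r xor inv q w) conj ⟩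
      inv (x ∷ p) r xor inv q (reverse (x ∷ p) ++ r ++ x ∷ p)                    ∎
      where
      open ≡-Reasoning
      d = does (r ≈? (x ∷ []))
      conj : reverse p ++ (x ∷ r ∷ʳ x) ++ p ≡ reverse (x ∷ p) ++ r ++ x ∷ p
      conj = begin
        reverse p ++ x ∷ (r ∷ʳ x) ++ p        ≡⟨ cong (λ w → reverse p ++ x ∷ w) (++-assoc r (x ∷ []) p) ⟩
        reverse p ++ x ∷ r ++ x ∷ p           ≡⟨ ++-assoc (reverse p) (x ∷ []) _ ⟨
        (reverse p ∷ʳ x) ++ r ++ x ∷ p        ≡⟨ cong (_++ r ++ x ∷ p) (unfold-reverse x p) ⟨
        reverse (x ∷ p) ++ r ++ x ∷ p         ∎

    -- The reflections attached to the prefixes of s t s t ⋯ are the odd palindromes s, s t s, s t s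
    -- t s, ...; the parity is taken over `k` of them, from the one numbered `i` on.
    palindromes : Fin n → Fin n → ℕ → ℕ → Word n → Bool
    palindromes s t i zero    r = false
    palindromes s t i (suc k) r = does (r ≈? alternating s t (suc (i + i))) xor palindromes s t (suc i) k r

    conj-palindrome : ∀ s t i k r → palindromes t s i k (s ∷ r ∷ʳ s) ≡ palindromes s t (suc i) k r
    conj-palindrome s t i zero    r = refl
    conj-palindrome s t i (suc k) r = cong₂ _xor_ (does-cong to from) (conj-palindrome s t (suc i) k r)
      where
      A = alternating t s (suc (i + i))
      sAs : (s ∷ A ∷ʳ s) ≡ alternating s t (suc (suc i + suc i))
      sAs rewrite +-suc i i = cong (s ∷_) (alternating-odd-∷ʳ s t i)
      conj : ∀ w → (s ∷ (s ∷ w ∷ʳ s) ∷ʳ s) ≈ w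
      conj w = ≈trans (square-cancel s _) (∷ʳ-square-cancel w s)
      to : (s ∷ r ∷ʳ s) ≈ A → r ≈ alternating s t (suc (suc i + suc i))
      to e = ≈trans (≈sym (conj r)) (≈trans (∷-cong s (++-congʳ (s ∷ []) e)) (≈-reflexive sAs))
      from : r ≈ alternating s t (suc (suc i + suc i)) → (s ∷ r ∷ʳ s) ≈ A
      from e = ≈trans (∷-cong s (++-congʳ (s ∷ []) (≈trans e (≈-reflexive (sym sAs))))) (conj A)

    inv-alternating : ∀ s t k r → inv (alternating s t k) r ≡ palindromes s t 0 k r
    inv-alternating s t zero    r = refl
    inv-alternating s t (suc k) r = cong (does (r ≈? (s ∷ [])) xor_)
      (trans (inv-alternating t s k (s ∷ r ∷ʳ s)) (conj-palindrome s t 0 k r))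

    palindromes-+ : ∀ s t i j k r → palindromes s t i (j + k) r ≡ palindromes s t i j r xor palindromes s t (j + i) k r
    palindromes-+ s t i zero    k r = refl
    palindromes-+ s t i (suc j) k r = begin
      d xor palindromes s t (suc i) (j + k) r                                          ≡⟨ cong (d xor_) (palindromes-+ s t (suc i) j k r) ⟩
      d xor (palindromes s t (suc i) j r xor palindromes s t (j + suc i) k r)          ≡⟨ xor-assoc d _ _ ⟨
      palindromes s t i (suc j) r xor palindromes s t (j + suc i) k r                  ≡⟨ cong (λ l → palindromes s t i (suc j) r xor palindromes s t l k r) (+-suc j i) ⟩
      palindromes s t i (suc j) r xor palindromes s t (suc j + i) k r                  ∎
      where
      open ≡-Reasoning
      d = does (r ≈? alternating s t (suc (i + i)))

    palindromes-period : ∀ s t i k r → palindromes s t (m s t + i) k r ≡ palindromes s t i k r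
    palindromes-period s t i zero    r = refl
    palindromes-period s t i (suc k) r = cong₂ _xor_
      (does-cong (λ e → ≈trans e periodic) (λ e → ≈trans e (≈sym periodic)))
      (trans (cong (λ l → palindromes s t l k r) (sym (+-suc (m s t) i))) (palindromes-period s t (suc i) k r))
      where
      μ = m s t
      rearrange : suc (μ + i + (μ + i)) ≡ μ + μ + suc (i + i)
      rearrange = begin
        suc (μ + i + (μ + i))     ≡⟨ cong suc (+-assoc μ i (μ + i)) ⟩
        suc (μ + (i + (μ + i)))   ≡⟨ cong (λ l → suc (μ + l)) (trans (sym (+-assoc i μ i)) (trans (cong (_+ i) (+-comm i μ)) (+-assoc μ i i))) ⟩
        suc (μ + (μ + (i + i)))   ≡⟨ cong suc (+-assoc μ μ (i + i)) ⟨
        suc (μ + μ + (i + i))     ≡⟨ +-suc (μ + μ) (i + i) ⟨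
        μ + μ + suc (i + i)       ∎
        where open ≡-Reasoning
      periodic : alternating s t (suc (μ + i + (μ + i))) ≈ alternating s t (suc (i + i))
      periodic = begin
        alternating s t (suc (μ + i + (μ + i)))         ≡⟨ cong (alternating s t) rearrange ⟩
        alternating s t (μ + μ + suc (i + i))           ≡⟨ alternating-even-++ s t μ (suc (i + i)) ⟩
        relator s t ++ alternating s t (suc (i + i))    ≈⟨ rel [] _ s t ⟩
        alternating s t (suc (i + i))                   ∎
        where open ≈-Reasoning

    -- The palindromes numbered i and i + m spell the same element, so the 2m palindromes of the
    -- relator are m of them listed twice, and they cancel modulo 2.
    inv-relator : ∀ s t r → inv (relator s t) r ≡ false
    inv-relator s t r = begin
      inv (relator s t) r                                        ≡⟨ cong (λ w → inv w r) (++-identityʳ (relator s t)) ⟨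
      inv (relator s t ++ []) r                                  ≡⟨ cong (λ w → inv w r) (alternating-even-++ s t μ 0) ⟨
      inv (alternating s t (μ + μ + 0)) r                        ≡⟨ inv-alternating s t (μ + μ + 0) r ⟩
      palindromes s t 0 (μ + μ + 0) r                            ≡⟨ cong (λ l → palindromes s t 0 l r) (+-identityʳ (μ + μ)) ⟩
      palindromes s t 0 (μ + μ) r                                ≡⟨ palindromes-+ s t 0 μ μ r ⟩
      palindromes s t 0 μ r xor palindromes s t (μ + 0) μ r      ≡⟨ cong (palindromes s t 0 μ r xor_) (palindromes-period s t 0 μ r) ⟩
      palindromes s t 0 μ r xor palindromes s t 0 μ r            ≡⟨ xor-same (palindromes s t 0 μ r) ⟩
      false                                                      ∎
      where
      open ≡-Reasoning
      μ = m s t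

    inv-congˡ : ∀ {u v} → u ≈ v → ∀ r → inv u r ≡ inv v r
    inv-congˡ (rel u v s t) r = begin
      inv (u ++ R ++ v) r                                             ≡⟨ inv-++ u (R ++ v) r ⟩
      inv u r xor inv (R ++ v) r'                                     ≡⟨ cong (inv u r xor_) (inv-++ R v r') ⟩
      inv u r xor (inv R r' xor inv v (reverse R ++ r' ++ R))         ≡⟨ cong (λ b → inv u r xor (b xor inv v (reverse R ++ r' ++ R))) (inv-relator s t r') ⟩
      inv u r xor inv v (reverse R ++ r' ++ R)                        ≡⟨ cong (inv u r xor_) (inv-congʳ v conj) ⟩
      inv u r xor inv v r'                                            ≡⟨ inv-++ u v r ⟨
      inv (u ++ v) r                                                  ∎
      where
      open ≡-Reasoning
      R = relator s t
      r' = reverse u ++ r ++ u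
      R≈[] : R ≈ []
      R≈[] = ≈trans (≈-reflexive (sym (++-identityʳ R))) (rel [] [] s t)
      reverseR≈[] : reverse R ≈ []
      reverseR≈[] = ≈trans (≈-reflexive (sym (++-identityʳ _))) (≈trans (++-congˡ (reverse R) (≈sym R≈[]))
                    (≈trans (≈-reflexive (cong (reverse R ++_) (sym (++-identityʳ R)))) (reverse-cancelˡ R [])))
      conj : (reverse R ++ r' ++ R) ≈ r'
      conj = ≈trans (++-congʳ (r' ++ R) reverseR≈[]) (≈trans (++-congˡ r' R≈[]) (≈-reflexive (++-identityʳ r')))
    inv-congˡ ≈refl        r = refl
    inv-congˡ (≈sym e)     r = sym (inv-congˡ e r)
    inv-congˡ (≈trans e f) r = trans (inv-congˡ e r) (inv-congˡ f r)

    -- An odd count is not zero, so some prefix accounts for it. The equation `r p = p x` expresses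
    -- the conjugation without an inverse.
    inv-true : ∀ u r → inv u r ≡ true
             → ∃ λ p → ∃₂ λ x q → u ≡ p ++ x ∷ q × (r ++ p) ≈ (p ∷ʳ x)
    inv-true (x ∷ u) r e with r ≈? (x ∷ [])
    ... | yes r≈x = [] , x , u , refl , ≈trans (≈-reflexive (++-identityʳ r)) r≈x
    ... | no _ with inv-true u (x ∷ r ∷ʳ x) e
    ...   | p , y , q , refl , f = x ∷ p , y , q , refl , (begin
      r ++ x ∷ p                  ≡⟨ ++-assoc r (x ∷ []) p ⟨
      (r ∷ʳ x) ++ p               ≈⟨ square-cancel x _ ⟨
      x ∷ (x ∷ r ∷ʳ x) ++ p       ≈⟨ ∷-cong x f ⟩
      x ∷ p ∷ʳ y                  ∎)
      where open ≈-Reasoning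

    conj-deletes : ∀ s p x q → (s ∷ p) ≈ (p ∷ʳ x) → (s ∷ p ++ x ∷ q) ≈ (p ++ q)
    conj-deletes s p x q e = begin
      s ∷ p ++ x ∷ q          ≈⟨ ++-congʳ (x ∷ q) e ⟩
      (p ∷ʳ x) ++ x ∷ q       ≡⟨ ++-assoc p (x ∷ []) (x ∷ q) ⟩
      p ++ x ∷ x ∷ q          ≈⟨ ++-congˡ p (square-cancel x q) ⟩
      p ++ q                  ∎
      where open ≈-Reasoning

    length-deletes : ∀ (p : Word n) x q → length (p ++ x ∷ q) ≡ suc (length (p ++ q))
    length-deletes []      x q = refl
    length-deletes (_ ∷ p) x q = cong suc (length-deletes p x q)

    ¬Reduced-conj : ∀ s p x q → (s ∷ p) ≈ (p ∷ʳ x) → ¬ Reduced (s ∷ p ++ x ∷ q)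
    ¬Reduced-conj s p x q e r = 1+n≰n (≤-trans (n≤1+n _)
      (subst (λ l → suc l ≤ length (p ++ q)) (length-deletes p x q) (r (p ++ q) (≈sym (conj-deletes s p x q e)))))

    -- The reflection `s` has odd parity in `s ∷ v`: the first letter counts it, and another
    -- occurrence would allow `s ∷ v` to be shortened. The parity depends only on the group element,
    -- so it is odd in `u` too and points at the letter to delete.
    exchange : ∀ s u → Reduced u → ¬ Reduced (s ∷ u)
             → ∃ λ p → ∃₂ λ x q → u ≡ p ++ x ∷ q × (s ∷ p) ≈ (p ∷ʳ x)
    exchange s u ru ¬r with descentˡ ru ¬r
    ... | v , sv≈u , len = inv-true u (s ∷ []) (trans (sym (inv-congˡ sv≈u (s ∷ []))) sv-true)
      where
      rsv : Reduced (s ∷ v)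
      rsv = Reduced-resp-≈ (≈sym sv≈u) (≤-reflexive len) ru
      -- `s ∷ s ∷ s ∷ []` is the reflection `s` conjugated by the first letter `s`, in the
      -- unsimplified form that the recursion of `inv` produces.
      v-false : inv v (s ∷ s ∷ s ∷ []) ≡ false
      v-false with inv v (s ∷ s ∷ s ∷ []) in eq
      ... | false = refl
      ... | true with inv-true v _ eq
      ...   | p , x , q , refl , e = contradiction rsv (¬Reduced-conj s p x q (≈trans (≈sym (square-cancel s _)) e))
      sv-true : inv (s ∷ v) (s ∷ []) ≡ true
      sv-true rewrite v-false with (s ∷ []) ≈? (s ∷ [])
      ... | yes _ = refl
      ... | no ¬p = contradiction ≈refl ¬p

    -- The exchanged letter cannot lie in `u`, since deleting it there would shorten the reduced
    -- word `s ∷ u`.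
    exchange-++ : ∀ s u v → Reduced (s ∷ u) → Reduced (u ++ v) → ¬ Reduced (s ∷ u ++ v)
                → ∃ λ p → ∃₂ λ x q → v ≡ p ++ x ∷ q × (s ∷ u ++ p) ≈ (u ++ p ∷ʳ x)
    exchange-++ s u v rsu ruv ¬r with exchange s (u ++ v) ruv ¬r
    ... | p , x , q , e , f with ++-split u v p e
    ...   | inj₁ (q' , refl)        = contradiction rsu (¬Reduced-conj s p x q' f)
    ...   | inj₂ (p' , refl , refl) = p' , x , q , refl , ≈trans f (≈-reflexive (++-assoc u p' (x ∷ [])))

open Reflections

-- The discrete wave equation on paths, standing in for Chebyshev identities.

module Waves where
  open import Data.Nat as ℕ using (_∸_; _%_; _/_; ∣_-_∣; z≤n; s≤s)
  import Data.Nat.Properties as ℕ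
  open import Data.Nat.DivMod using ([m+kn]%n≡m%n; m<n⇒m%n≡m; m*n%n≡0; m≡m%n+[m/n]*n; m%n<n)
  open import Data.Nat.Divisibility using (divides)
  import Data.Nat.Divisibility as ℕ
  open import Data.Integer using (ℤ; 0ℤ; 1ℤ; _+_; _-_; _*_; -_; _≤_; +≤+)
  open import Data.Integer.Properties
  open import Data.Integer.Tactic.RingSolver using (solve-∀)

  Seq : Set
  Seq = ℕ → ℤ

  infix 4 _≐_
  _≐_ : Seq → Seq → Set
  f ≐ g = ∀ i → f i ≡ g i

  +-interchange : ∀ a b c d → (a + b) + (c + d) ≡ (a + c) + (b + d)
  +-interchange = solve-∀

  -- The first argument is a vertex number modulo the block length. Residue zero marks the first
  -- vertex of a block, and the edge to its left is removed; in particular the default value of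
  -- `0 ∸ 1` is never read.
  gate : ℕ → ℤ → ℤ
  gate zero    z = 0ℤ
  gate (suc _) z = z

  -- Adjacency operator of the graph on ℕ whose components are the paths
  -- {q b , … , q b + b − 1} with b = suc c vertices.
  path : ℕ → Seq → Seq
  path c f i = gate (i % suc c) (f (i ∸ 1)) + gate (suc i % suc c) (f (suc i))

  gate-+ : ∀ a x y → gate a (x + y) ≡ gate a x + gate a y
  gate-+ zero    x y = refl
  gate-+ (suc _) x y = refl

  gate-neg : ∀ a x → gate a (- x) ≡ - gate a x
  gate-neg zero    x = refl
  gate-neg (suc _) x = refl

  gate-0 : ∀ a → gate a 0ℤ ≡ 0ℤ
  gate-0 zero    = refl
  gate-0 (suc _) = refl

  gate-*ˡ : ∀ a x y → x * gate a y ≡ gate a (x * y)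
  gate-*ˡ zero    x y = *-zeroʳ x
  gate-*ˡ (suc _) x y = refl

  gate-*ʳ : ∀ a x y → gate a x * y ≡ gate a (x * y)
  gate-*ʳ zero    x y = refl
  gate-*ʳ (suc _) x y = refl

  gate-≥0 : ∀ a {x} → 0ℤ ≤ x → 0ℤ ≤ gate a x
  gate-≥0 zero    p = ≤-refl
  gate-≥0 (suc _) p = p

  path-cong : ∀ c {f g} → f ≐ g → path c f ≐ path c g
  path-cong c e i = cong₂ _+_ (cong (gate (i % suc c)) (e (i ∸ 1))) (cong (gate (suc i % suc c)) (e (suc i)))

  path-+ : ∀ c f g → path c (λ i → f i + g i) ≐ (λ i → path c f i + path c g i)
  path-+ c f g i = trans (cong₂ _+_ (gate-+ (i % suc c) _ _) (gate-+ (suc i % suc c) _ _))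
                         (+-interchange (gate (i % suc c) _) _ (gate (suc i % suc c) _) _)

  path-neg : ∀ c f → path c (λ i → - f i) ≐ (λ i → - path c f i)
  path-neg c f i = trans (cong₂ _+_ (gate-neg (i % suc c) _) (gate-neg (suc i % suc c) _))
                         (sym (neg-distrib-+ (gate (i % suc c) _) _))

  path-0 : ∀ c → path c (λ _ → 0ℤ) ≐ (λ _ → 0ℤ)
  path-0 c i = cong₂ _+_ (gate-0 (i % suc c)) (gate-0 (suc i % suc c))

  path-≥0 : ∀ c {f} → (∀ i → 0ℤ ≤ f i) → ∀ i → 0ℤ ≤ path c f i
  path-≥0 c p i = +-mono-≤ (gate-≥0 (i % suc c) (p _)) (gate-≥0 (suc i % suc c) (p _))

  %-zero : ∀ i → i % 1 ≡ 0
  %-zero i = ℕ.n<1⇒n≡0 (m%n<n i 1)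

  path-trivial : ∀ f → path 0 f ≐ (λ _ → 0ℤ)
  path-trivial f i = cong₂ (λ a b → gate a (f (i ∸ 1)) + gate b (f (suc i))) (%-zero i) (%-zero (suc i))

  residue : ∀ c p q → p ℕ.≤ c → (p ℕ.+ q ℕ.* suc c) % suc c ≡ p
  residue c p q p≤c = trans ([m+kn]%n≡m%n p q (suc c)) (m<n⇒m%n≡m (s≤s p≤c))

  inBlock : ∀ c i → ∃ λ p → ∃ λ q → p ℕ.≤ c × i ≡ p ℕ.+ q ℕ.* suc c
  inBlock c i = i % suc c , i / suc c , ℕ.s≤s⁻¹ (m%n<n i (suc c)) , m≡m%n+[m/n]*n i (suc c)

  -- A block with at least two vertices has no isolated vertex: each one has a left neighbour,
  -- except the first, which has a right one.
  path-≥1 : ∀ c {f} → 1 ℕ.≤ c → (∀ i → 1ℤ ≤ f i) → ∀ i → 1ℤ ≤ path c f i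
  path-≥1 c {f} 1≤c p i with inBlock c i
  ... | suc p' , q , p≤c , refl =
    +-mono-≤ (subst (λ a → 1ℤ ≤ gate a (f (p' ℕ.+ q ℕ.* suc c))) (sym (residue c (suc p') q p≤c)) (p _))
             (gate-≥0 (suc i % suc c) (≤-trans (+≤+ z≤n) (p _)))
  ... | zero , q , _ , refl =
    +-mono-≤ {0ℤ} {_} {1ℤ} (gate-≥0 (i % suc c) (≤-trans (+≤+ z≤n) (p _)))
             (subst (λ a → 1ℤ ≤ gate a (f (suc (q ℕ.* suc c)))) (sym (residue c 1 q 1≤c)) (p _))

  module Wave (c : ℕ) where

    private
      b μ : ℕ
      b = suc c
      μ = suc b

    -- Reflection of the half line at μ.
    fold : ℕ → ℕ
    fold x = μ ∸ ∣ x - μ ∣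

    fold-≤ : ∀ {x} → x ℕ.≤ μ → fold x ≡ x
    fold-≤ {x} x≤μ = trans (cong (μ ∸_) (ℕ.m≤n⇒∣m-n∣≡n∸m x≤μ)) (ℕ.m∸[m∸n]≡n x≤μ)

    fold-μ+ : ∀ k → fold (μ ℕ.+ k) ≡ μ ∸ k
    fold-μ+ k = cong (μ ∸_) (trans (ℕ.∣-∣-comm (μ ℕ.+ k) μ) (ℕ.∣m-m+n∣≡n μ k))

    -- The excess over k - p is 2p as long as p + k has not passed μ, and 2(μ - k) once it has been
    -- reflected. It must be even because `G` is monotone only in steps of two.
    fold-diff-≤ : ∀ p k → p ℕ.≤ k → k ℕ.≤ μ → ∃ λ j → fold (p ℕ.+ k) ≡ j ℕ.+ j ℕ.+ ∣ p - k ∣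
    fold-diff-≤ p k p≤k k≤μ with ℕ.≤-total (p ℕ.+ k) μ
    ... | inj₁ s≤μ = p , trans (fold-≤ s≤μ) (trans (cong (p ℕ.+_) (trans (sym (ℕ.m+[n∸m]≡n p≤k)) (cong (p ℕ.+_) (sym (ℕ.m≤n⇒∣m-n∣≡n∸m p≤k)))))
                                             (sym (ℕ.+-assoc p p _)))
    ... | inj₂ μ≤s = e , (begin
        μ ∸ ∣ p ℕ.+ k - μ ∣        ≡⟨ cong (μ ∸_) (trans (ℕ.∣-∣-comm (p ℕ.+ k) μ) (ℕ.m≤n⇒∣m-n∣≡n∸m μ≤s)) ⟩
        μ ∸ (p ℕ.+ k ∸ μ)          ≡⟨ cong (_∸ (p ℕ.+ k ∸ μ)) μ-split ⟩
        ((e ℕ.+ e ℕ.+ d) ℕ.+ (p ℕ.+ k ∸ μ)) ∸ (p ℕ.+ k ∸ μ) ≡⟨ ℕ.m+n∸n≡m _ (p ℕ.+ k ∸ μ) ⟩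
        e ℕ.+ e ℕ.+ d              ≡⟨ cong (e ℕ.+ e ℕ.+_) (ℕ.m≤n⇒∣m-n∣≡n∸m p≤k) ⟨
        e ℕ.+ e ℕ.+ ∣ p - k ∣      ∎)
      where
      open ≡-Reasoning
      e = μ ∸ k
      d = k ∸ p
      k≡ : p ℕ.+ d ≡ k
      k≡ = ℕ.m+[n∸m]≡n p≤k
      μ≡ : k ℕ.+ e ≡ μ
      μ≡ = ℕ.m+[n∸m]≡n k≤μ
      h = p ℕ.+ k ∸ μ
      s≡ : p ℕ.+ k ≡ μ ℕ.+ h
      s≡ = sym (ℕ.m+[n∸m]≡n μ≤s)
      p≡ : p ≡ e ℕ.+ h
      p≡ = ℕ.+-cancelʳ-≡ k p (e ℕ.+ h) (begin
        p ℕ.+ k              ≡⟨ s≡ ⟩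
        μ ℕ.+ h              ≡⟨ cong (ℕ._+ h) μ≡ ⟨
        (k ℕ.+ e) ℕ.+ h      ≡⟨ ℕ.+-assoc k e h ⟩
        k ℕ.+ (e ℕ.+ h)      ≡⟨ ℕ.+-comm k _ ⟩
        (e ℕ.+ h) ℕ.+ k      ∎)
      open import Data.Nat.Tactic.RingSolver renaming (solve-∀ to solveℕ)
      rearr : ∀ e h d → ((e ℕ.+ h) ℕ.+ d) ℕ.+ e ≡ (e ℕ.+ e ℕ.+ d) ℕ.+ h
      rearr = solveℕ
      μ-split : μ ≡ (e ℕ.+ e ℕ.+ d) ℕ.+ h
      μ-split = trans (sym μ≡) (trans (cong (ℕ._+ e) (trans (sym k≡) (cong (ℕ._+ d) p≡))) (rearr e h d))

    fold-diff : ∀ p k → p ℕ.≤ μ → k ℕ.≤ μ → ∃ λ j → fold (p ℕ.+ k) ≡ j ℕ.+ j ℕ.+ ∣ p - k ∣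
    fold-diff p k p≤μ k≤μ with ℕ.≤-total p k
    ... | inj₁ p≤k = fold-diff-≤ p k p≤k k≤μ
    ... | inj₂ k≤p with fold-diff-≤ k p k≤p p≤μ
    ...   | j , eq = j , trans (cong fold (ℕ.+-comm p k)) (trans eq (cong (j ℕ.+ j ℕ.+_) (ℕ.∣-∣-comm k p)))

    module _ (f : Seq) (q : ℕ) where

      -- G (x + 1) − G (x − 1) = f at the x-th vertex of the q-th path.
      G : ℕ → ℤ
      G zero          = 0ℤ
      G (suc zero)    = 0ℤ
      G (suc (suc x)) = G x + f (x ℕ.+ q ℕ.* b)

      -- d'Alembert's solution of y (k + 1) + y (k − 1) = path c (y k), vanishing at both ends of the path.
      wave : ℕ → ℕ → ℤ
      wave p k = G (fold (p ℕ.+ k)) - G ∣ p - k ∣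

      wave-start : ∀ k → k ℕ.≤ μ → wave 0 k ≡ 0ℤ
      wave-start k k≤μ = trans (cong (λ x → G x - G k) (fold-≤ k≤μ)) (+-inverseʳ (G k))

      wave-end : ∀ k → k ℕ.≤ μ → wave μ k ≡ 0ℤ
      wave-end k k≤μ = trans (cong₂ (λ x y → G x - G y) (fold-μ+ k)
                               (trans (ℕ.∣-∣-comm μ k) (ℕ.m≤n⇒∣m-n∣≡n∸m k≤μ))) (+-inverseʳ (G (μ ∸ k)))

      -- Position and time can be exchanged, so the boundary values at the two ends of a path become
      -- vanishing at the times 0 and μ.
      wave-sym : ∀ p k → wave p k ≡ wave k p
      wave-sym p k = cong₂ (λ x y → G (fold x) - G y) (ℕ.+-comm p k) (ℕ.∣-∣-comm p k)

      wave-one : ∀ p → p ℕ.≤ c → wave (suc p) 1 ≡ f (p ℕ.+ q ℕ.* b)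
      wave-one p p≤c = begin
        G (fold (suc p ℕ.+ 1)) - G ∣ p - 0 ∣       ≡⟨ cong₂ (λ x y → G x - G y) (trans (cong fold (ℕ.+-comm (suc p) 1)) (fold-≤ (s≤s (s≤s p≤c)))) (ℕ.∣-∣-identityʳ p) ⟩
        (G p + f (p ℕ.+ q ℕ.* b)) - G p            ≡⟨ cancel (G p) _ ⟩
        f (p ℕ.+ q ℕ.* b)                          ∎
        where
        open ≡-Reasoning
        cancel : ∀ x y → (x + y) - x ≡ y
        cancel = solve-∀

      wave-step : ∀ p k → wave (suc p) (suc (suc k)) ≡ (wave p (suc k) + wave (suc (suc p)) (suc k)) - wave (suc p) k
      wave-step p k rewrite ℕ.+-suc p (suc k) | ℕ.+-suc p k =
        cancel (G (fold (suc (suc (suc (p ℕ.+ k)))))) (G ∣ p - suc k ∣) (G (fold (suc (p ℕ.+ k)))) (G ∣ suc p - k ∣)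
        where
        cancel : ∀ w x y z → w - x ≡ ((y - x) + (w - z)) - (y - z)
        cancel = solve-∀

      module _ (f≥0 : ∀ i → 0ℤ ≤ f i) where

        G-mono : ∀ j x → G x ≤ G (j ℕ.+ j ℕ.+ x)
        G-mono zero    x = ≤-refl
        G-mono (suc j) x rewrite ℕ.+-suc j j =
          ≤-trans (G-mono j x) (i≤i+j-≥0 (G (j ℕ.+ j ℕ.+ x)) (f≥0 _))
          where
          i≤i+j-≥0 : ∀ i {j} → 0ℤ ≤ j → i ≤ i + j
          i≤i+j-≥0 i p = subst (_≤ i + _) (+-identityʳ i) (+-monoʳ-≤ i p)

        wave-≥0 : ∀ p k → p ℕ.≤ μ → k ℕ.≤ μ → 0ℤ ≤ wave p k
        wave-≥0 p k p≤μ k≤μ with fold-diff p k p≤μ k≤μ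
        ... | j , eq = subst (λ x → 0ℤ ≤ G x - G ∣ p - k ∣) (sym eq) (i≤j⇒0≤j-i (G-mono j ∣ p - k ∣))

    module Homogeneous (y : ℕ → Seq) (y0 : ∀ i → y 0 i ≡ 0ℤ)
      (y-rec : ∀ k → suc (suc k) ℕ.≤ μ → ∀ i → y (suc (suc k)) i ≡ path c (y (suc k)) i - y k i) where

      -- Vertex `p` of a block has coordinate `suc p`, which leaves the coordinates 0 and μ for the
      -- missing neighbours at the two ends.
      Solution : ℕ → Set
      Solution k = k ℕ.≤ μ → ∀ p q → p ℕ.≤ c → y k (p ℕ.+ q ℕ.* b) ≡ wave (y 1) q (suc p) k

      solution-step : ∀ k → Solution k → Solution (suc k) → Solution (suc (suc k))
      solution-step k sol₀ sol₁ k≤μ p q p≤c = begin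
        y (suc (suc k)) (p ℕ.+ q ℕ.* b)                                       ≡⟨ y-rec k k≤μ _ ⟩
        path c (y (suc k)) (p ℕ.+ q ℕ.* b) - y k (p ℕ.+ q ℕ.* b)              ≡⟨ cong₂ _-_ (cong₂ _+_ (left p p≤c) (right (ℕ.m≤n⇒m<n∨m≡n p≤c))) (sol₀ (ℕ.≤-trans (ℕ.n≤1+n _) k+1≤μ) p q p≤c) ⟩
        (w p (suc k) + w (suc (suc p)) (suc k)) - w (suc p) k                 ≡⟨ wave-step (y 1) q p k ⟨
        w (suc p) (suc (suc k))                                               ∎
        where
        open ≡-Reasoning
        w = wave (y 1) q
        k+1≤μ : suc k ℕ.≤ μ
        k+1≤μ = ℕ.≤-trans (ℕ.n≤1+n _) k≤μ
        left : ∀ p → p ℕ.≤ c → gate ((p ℕ.+ q ℕ.* b) % b) (y (suc k) ((p ℕ.+ q ℕ.* b) ∸ 1)) ≡ w p (suc k)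
        left zero    p≤c = trans (cong (λ a → gate a (y (suc k) (q ℕ.* b ∸ 1))) (residue c 0 q p≤c)) (sym (wave-start (y 1) q (suc k) k+1≤μ))
        left (suc p) p≤c = trans (cong (λ a → gate a (y (suc k) (p ℕ.+ q ℕ.* b))) (residue c (suc p) q p≤c))
                                 (sol₁ k+1≤μ p q (ℕ.≤-trans (ℕ.n≤1+n _) p≤c))
        right : p ℕ.< c ⊎ p ≡ c → gate ((suc p ℕ.+ q ℕ.* b) % b) (y (suc k) (suc p ℕ.+ q ℕ.* b)) ≡ w (suc (suc p)) (suc k)
        right (inj₁ p<c)  = trans (cong (λ a → gate a (y (suc k) (suc p ℕ.+ q ℕ.* b))) (residue c (suc p) q p<c))
                                 (sol₁ k+1≤μ (suc p) q p<c)
        right (inj₂ refl) = trans (cong (λ a → gate a (y (suc k) (suc p ℕ.+ q ℕ.* b))) (m*n%n≡0 (suc q) b)) (sym (wave-end (y 1) q (suc k) k+1≤μ))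

      solution : ∀ k → Solution k
      solution zero _ p q p≤c =
        trans (y0 _) (trans (sym (wave-start (y 1) q (suc p) (s≤s (ℕ.m≤n⇒m≤1+n p≤c)))) (wave-sym (y 1) q 0 (suc p)))
      solution (suc zero) _ p q p≤c = sym (wave-one (y 1) q p p≤c)
      solution (suc (suc k)) = solution-step k (solution k) (solution (suc k))

      -- The recurrence makes `y k` equal to U_{k-1}(a / 2) applied to `y 1`, with a = `path c`, so
      -- this is U_{m-1}(a / 2) = 0 for m = μ.
      vanishes : ∀ i → y μ i ≡ 0ℤ
      vanishes i with inBlock c i
      ... | p , q , p≤c , refl = trans (solution μ ℕ.≤-refl p q p≤c)
        (trans (wave-sym (y 1) q (suc p) μ) (wave-end (y 1) q (suc p) (s≤s (ℕ.m≤n⇒m≤1+n p≤c))))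

      nonnegative : (∀ i → 0ℤ ≤ y 1 i) → ∀ k → k ℕ.≤ μ → ∀ i → 0ℤ ≤ y k i
      nonnegative y1≥0 k k≤μ i with inBlock c i
      ... | p , q , p≤c , refl = subst (0ℤ ≤_) (sym (solution k k≤μ p q p≤c))
        (wave-≥0 (y 1) q y1≥0 (suc p) k (s≤s (ℕ.m≤n⇒m≤1+n p≤c)) k≤μ)

    -- Reflecting a solution at time μ gives another solution with the same source,
    -- and the difference of the two starts at 0, hence vanishes again μ steps later.
    periodic : (σ : ℕ → Seq) → (∀ k i → σ (suc (suc k)) i ≡ σ k i) → (z : ℕ → Seq)
      → (∀ k i → z (suc (suc k)) i ≡ (path c (z (suc k)) i - z k i) + σ k i)
      → z (μ ℕ.+ μ) ≐ z 0
    periodic σ σ-per z z-rec i = i-j≡0⇒i≡j _ _ (subst (λ l → z (μ ℕ.+ μ) i - z l i ≡ 0ℤ) (ℕ.n∸n≡0 μ) (Homogeneous.vanishes e e0 e-rec i))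
      where
      e : ℕ → Seq
      e j i = z (μ ℕ.+ j) i - z (μ ∸ j) i

      e0 : ∀ i → e 0 i ≡ 0ℤ
      e0 i = trans (cong (λ l → z l i - z μ i) (ℕ.+-identityʳ μ)) (+-inverseʳ (z μ i))

      σ-shift : ∀ j x i → σ (j ℕ.+ j ℕ.+ x) i ≡ σ x i
      σ-shift zero    x i = refl
      σ-shift (suc j) x i rewrite ℕ.+-suc j j = trans (σ-per _ i) (σ-shift j x i)

      e-rec : ∀ j → suc (suc j) ℕ.≤ μ → ∀ i → e (suc (suc j)) i ≡ path c (e (suc j)) i - e j i
      e-rec j j≤μ i = begin
        z (μ ℕ.+ suc (suc j)) i - z x i
          ≡⟨ cong (λ l → z l i - z x i) (trans (ℕ.+-suc μ (suc j)) (cong suc (ℕ.+-suc μ j))) ⟩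
        z (suc (suc (μ ℕ.+ j))) i - z x i
          ≡⟨ cong (_- z x i) (z-rec (μ ℕ.+ j) i) ⟩
        ((path c (z (suc (μ ℕ.+ j))) i - z (μ ℕ.+ j) i) + σ (μ ℕ.+ j) i) - z x i
          ≡⟨ cong₂ (λ A B → ((A - z (μ ℕ.+ j) i) + B) - z x i) (cong (λ l → path c (z l) i) (sym (ℕ.+-suc μ j))) σ≡ ⟩
        ((path c (z (μ ℕ.+ suc j)) i - z (μ ℕ.+ j) i) + σ x i) - z x i
          ≡⟨ regroup (path c (z (μ ℕ.+ suc j)) i) (z (μ ℕ.+ j) i) (σ x i) (z x i) (path c (z (suc x)) i) ⟩
        (path c (z (μ ℕ.+ suc j)) i + - path c (z (suc x)) i) - (z (μ ℕ.+ j) i - ((path c (z (suc x)) i - z x i) + σ x i))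
          ≡⟨ cong (λ A → (path c (z (μ ℕ.+ suc j)) i + - path c (z (suc x)) i) - (z (μ ℕ.+ j) i - A)) (sym (z-rec x i)) ⟩
        (path c (z (μ ℕ.+ suc j)) i + - path c (z (suc x)) i) - (z (μ ℕ.+ j) i - z (suc (suc x)) i)
          ≡⟨ cong₂ (λ k l → (path c (z (μ ℕ.+ suc j)) i + - path c (z k) i) - (z (μ ℕ.+ j) i - z l i)) (sym μ∸1+j) (sym μ∸j) ⟩
        (path c (z (μ ℕ.+ suc j)) i + - path c (z (μ ∸ suc j)) i) - e j i
          ≡⟨ cong (_- e j i) (sym (trans (path-+ c (z (μ ℕ.+ suc j)) (λ i → - z (μ ∸ suc j) i) i) (cong (path c (z (μ ℕ.+ suc j)) i +_) (path-neg c (z (μ ∸ suc j)) i)))) ⟩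
        path c (e (suc j)) i - e j i ∎
        where
        open ≡-Reasoning
        open import Data.Nat.Tactic.RingSolver renaming (solve-∀ to solveℕ)
        x = μ ∸ suc (suc j)
        μ≡ : suc (suc j) ℕ.+ x ≡ μ
        μ≡ = ℕ.m+[n∸m]≡n j≤μ
        μ∸1+j : μ ∸ suc j ≡ suc x
        μ∸1+j = trans (cong (_∸ suc j) (trans (sym μ≡) (sym (ℕ.+-suc (suc j) x)))) (ℕ.m+n∸m≡n (suc j) (suc x))
        μ∸j : μ ∸ j ≡ suc (suc x)
        μ∸j = trans (cong (_∸ j) (trans (sym μ≡) (sym (trans (ℕ.+-suc j (suc x)) (cong suc (ℕ.+-suc j x)))))) (ℕ.m+n∸m≡n j (suc (suc x)))
        rearr : ∀ j x → (suc (suc j) ℕ.+ x) ℕ.+ j ≡ (suc j ℕ.+ suc j) ℕ.+ x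
        rearr = solveℕ
        σ≡ : σ (μ ℕ.+ j) i ≡ σ x i
        σ≡ = trans (cong (λ l → σ l i) (trans (cong (ℕ._+ j) (sym μ≡)) (rearr j x))) (σ-shift (suc j) x i)
        regroup : ∀ A B S X P → ((A - B) + S) - X ≡ (A + - P) - (B - ((P - X) + S))
        regroup = solve-∀

  ∑ : ℕ → (ℕ → ℤ) → ℤ
  ∑ zero    f = 0ℤ
  ∑ (suc K) f = ∑ K f + f K

  ∑-cong : ∀ K {f g} → (∀ i → f i ≡ g i) → ∑ K f ≡ ∑ K g
  ∑-cong zero    e = refl
  ∑-cong (suc K) e = cong₂ _+_ (∑-cong K e) (e K)

  ∑-0 : ∀ K {f} → (∀ i → f i ≡ 0ℤ) → ∑ K f ≡ 0ℤ
  ∑-0 zero    e = refl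
  ∑-0 (suc K) e = cong₂ _+_ (∑-0 K e) (e K)

  ∑-+ : ∀ K f g → ∑ K (λ i → f i + g i) ≡ ∑ K f + ∑ K g
  ∑-+ zero    f g = refl
  ∑-+ (suc K) f g = trans (cong (_+ (f K + g K)) (∑-+ K f g)) (+-interchange (∑ K f) (∑ K g) (f K) (g K))

  ∑-neg : ∀ K f → ∑ K (λ i → - f i) ≡ - ∑ K f
  ∑-neg zero    f = refl
  ∑-neg (suc K) f = trans (cong (_+ - f K) (∑-neg K f)) (sym (neg-distrib-+ (∑ K f) (f K)))

  ∑-≥0 : ∀ K {f} → (∀ i → 0ℤ ≤ f i) → 0ℤ ≤ ∑ K f
  ∑-≥0 zero    p = ≤-refl
  ∑-≥0 (suc K) p = +-mono-≤ (∑-≥0 K p) (p K)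

  +-≥0-≤0ˡ : ∀ {x y} → 0ℤ ≤ x → 0ℤ ≤ y → x + y ≤ 0ℤ → x ≤ 0ℤ
  +-≥0-≤0ˡ {x} {y} p q r = ≤-trans (subst (_≤ x + y) (+-identityʳ x) (+-monoʳ-≤ x q)) r

  +-≥0-≤0ʳ : ∀ {x y} → 0ℤ ≤ x → 0ℤ ≤ y → x + y ≤ 0ℤ → y ≤ 0ℤ
  +-≥0-≤0ʳ {x} {y} p q r = +-≥0-≤0ˡ q p (subst (_≤ 0ℤ) (+-comm x y) r)

  ∑-≤0 : ∀ K {f} → (∀ i → 0ℤ ≤ f i) → ∑ K f ≤ 0ℤ → ∀ i → i ℕ.< K → f i ≡ 0ℤ
  ∑-≤0 (suc K) {f} p r i i<K with ℕ.m≤n⇒m<n∨m≡n (ℕ.s≤s⁻¹ i<K)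
  ... | inj₁ i<K' = ∑-≤0 K p (+-≥0-≤0ˡ (∑-≥0 K p) (p K) r) i i<K'
  ... | inj₂ refl = ≤-antisym (+-≥0-≤0ʳ (∑-≥0 K p) (p K) r) (p K)

  ⟨_∣_⟩⟨_⟩ : Seq → Seq → ℕ → ℤ
  ⟨ f ∣ g ⟩⟨ K ⟩ = ∑ K λ i → f i * g i

  -- Every edge inside the range contributes the same to both sides. Only the edge leaving the range
  -- at K could differ, and divisibility puts K at the start of a block, where that edge is absent.
  path-self-adjoint : ∀ c f g K → suc c ℕ.∣ K → ⟨ f ∣ path c g ⟩⟨ K ⟩ ≡ ⟨ path c f ∣ g ⟩⟨ K ⟩
  path-self-adjoint c f g K (divides q refl) = begin
    ∑ K (λ i → f i * path c g i)             ≡⟨ ∑-cong K (λ i → trans (*-distribˡ-+ (f i) (gate (i % suc c) _) _) (cong₂ _+_ (gate-*ˡ (i % suc c) (f i) _) (gate-*ˡ (suc i % suc c) (f i) _))) ⟩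
    ∑ K (λ i → β i + δ (suc i))              ≡⟨ drop-ends (∑ K (λ i → β i + δ (suc i))) (∑ K (λ i → δ i + β (suc i))) (δ K) (β K) (telescope K) closedδ closedβ ⟩
    ∑ K (λ i → δ i + β (suc i))              ≡⟨ ∑-cong K (λ i → trans (*-distribʳ-+ (g i) (gate (i % suc c) _) _) (cong₂ _+_ (gate-*ʳ (i % suc c) _ (g i)) (gate-*ʳ (suc i % suc c) _ (g i)))) ⟨
    ∑ K (λ i → path c f i * g i)             ∎
    where
    open ≡-Reasoning
    β δ : ℕ → ℤ
    β i = gate (i % suc c) (f i * g (i ∸ 1))
    δ i = gate (i % suc c) (f (i ∸ 1) * g i)
    telescope : ∀ K → ∑ K (λ i → β i + δ (suc i)) + β K ≡ ∑ K (λ i → δ i + β (suc i)) + δ K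
    telescope zero    = refl
    telescope (suc K) = begin
      (∑ K (λ i → β i + δ (suc i)) + (β K + δ (suc K))) + β (suc K)    ≡⟨ regroup (∑ K (λ i → β i + δ (suc i))) _ _ _ ⟩
      (∑ K (λ i → β i + δ (suc i)) + β K) + (δ (suc K) + β (suc K))    ≡⟨ cong (_+ (δ (suc K) + β (suc K))) (telescope K) ⟩
      (∑ K (λ i → δ i + β (suc i)) + δ K) + (δ (suc K) + β (suc K))    ≡⟨ regroup' (∑ K (λ i → δ i + β (suc i))) _ _ _ ⟩
      (∑ K (λ i → δ i + β (suc i)) + (δ K + β (suc K))) + δ (suc K)    ∎
      where
      regroup : ∀ a b c d → (a + (b + c)) + d ≡ (a + b) + (c + d)
      regroup = solve-∀
      regroup' : ∀ a b c d → (a + b) + (c + d) ≡ (a + (b + d)) + c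
      regroup' = solve-∀
    closedδ : δ K ≡ 0ℤ
    closedδ = cong (λ a → gate a (f (K ∸ 1) * g K)) (m*n%n≡0 q (suc c))
    closedβ : β K ≡ 0ℤ
    closedβ = cong (λ a → gate a (f K * g (K ∸ 1))) (m*n%n≡0 q (suc c))
    drop-ends : ∀ A B D E → A + E ≡ B + D → D ≡ 0ℤ → E ≡ 0ℤ → A ≡ B
    drop-ends A B D E p refl refl = trans (sym (+-identityʳ A)) (trans p (+-identityʳ B))

open Waves

-- The integral root space: reflections, relations, positivity.

module Roots where
  open import Data.Nat as ℕ using (_∸_; z≤n)
  import Data.Nat.Properties as ℕ
  open import Data.Integer using (ℤ; 0ℤ; 1ℤ; _+_; _-_; -_; _≤_; +≤+)
  open import Data.Integer.Properties hiding (_≟_)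
  open import Data.Integer.Tactic.RingSolver using (solve-∀)

  sumOver : {A : Set} → List A → (A → ℤ) → ℤ
  sumOver []      F = 0ℤ
  sumOver (q ∷ l) F = F q + sumOver l F

  module _ {A : Set} where

    sumOver-cong : ∀ (l : List A) {F G} → (∀ q → F q ≡ G q) → sumOver l F ≡ sumOver l G
    sumOver-cong []      e = refl
    sumOver-cong (q ∷ l) e = cong₂ _+_ (e q) (sumOver-cong l e)

    sumOver-+ : ∀ (l : List A) F G → sumOver l (λ q → F q + G q) ≡ sumOver l F + sumOver l G
    sumOver-+ []      F G = refl
    sumOver-+ (q ∷ l) F G = trans (cong (F q + G q +_) (sumOver-+ l F G)) (+-interchange (F q) (G q) (sumOver l F) (sumOver l G))

    sumOver-neg : ∀ (l : List A) F → sumOver l (λ q → - F q) ≡ - sumOver l F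
    sumOver-neg []      F = refl
    sumOver-neg (q ∷ l) F = trans (cong (- F q +_) (sumOver-neg l F)) (sym (neg-distrib-+ (F q) _))

    sumOver-≥0 : ∀ (l : List A) {F} → (∀ q → 0ℤ ≤ F q) → 0ℤ ≤ sumOver l F
    sumOver-≥0 []      p = ≤-refl
    sumOver-≥0 (q ∷ l) p = +-mono-≤ (p q) (sumOver-≥0 l p)

    sumOver-∉ : ∀ (l : List A) {F q} → (∀ r → r ≢ q → F r ≡ 0ℤ) → q ∉ l → sumOver l F ≡ 0ℤ
    sumOver-∉ []      h ∉l = refl
    sumOver-∉ (r ∷ l) h ∉l = cong₂ _+_ (h r λ { refl → ∉l (here refl) }) (sumOver-∉ l h (∉l ∘ there))

    sumOver-single : ∀ (l : List A) {F q} → Unique l → q ∈ l → (∀ r → r ≢ q → F r ≡ 0ℤ) → sumOver l F ≡ F q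
    sumOver-single (q ∷ l) {F} (q≢l ∷ _) (here refl) h =
      trans (cong (F q +_) (sumOver-∉ l h λ q∈l → All.lookup q≢l q∈l refl)) (+-identityʳ (F q))
    sumOver-single (r ∷ l) (r≢l ∷ ul) (there q∈l) h =
      trans (cong₂ _+_ (h r (All.lookup r≢l q∈l)) (sumOver-single l ul q∈l h)) (+-identityˡ _)

  -- The pattern … t s t of length k, ending in t; lead s t k is the letter that extends it to the left.
  lead : {A : Set} → A → A → ℕ → A
  lead s t zero    = t
  lead s t (suc k) = lead t s k

  altʳ : {A : Set} → A → A → ℕ → List A
  altʳ s t zero    = []
  altʳ s t (suc k) = altʳ t s k ∷ʳ t

  module _ {A : Set} where

    altʳ-suc : ∀ (s t : A) k → altʳ s t (suc k) ≡ lead s t k ∷ altʳ s t k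
    altʳ-suc s t zero    = refl
    altʳ-suc s t (suc k) = cong (_∷ʳ t) (altʳ-suc t s k)

    lead-even : ∀ (s t : A) k → lead s t (k ℕ.+ k) ≡ t
    lead-even s t zero    = refl
    lead-even s t (suc k) rewrite ℕ.+-suc k k = lead-even s t k

    altʳ-even : ∀ (s t : A) k → altʳ s t (k ℕ.+ k) ≡ concat (replicate k (s ∷ t ∷ []))
    altʳ-even s t zero    = refl
    altʳ-even s t (suc k) = begin
      altʳ s t (suc k ℕ.+ suc k)                                          ≡⟨ cong (altʳ s t ∘ suc) (ℕ.+-suc k k) ⟩
      altʳ s t (suc (suc (k ℕ.+ k)))                                      ≡⟨ altʳ-suc s t (suc (k ℕ.+ k)) ⟩
      lead t s (k ℕ.+ k) ∷ altʳ s t (suc (k ℕ.+ k))                       ≡⟨ cong₂ _∷_ (lead-even t s k) (altʳ-suc s t (k ℕ.+ k)) ⟩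
      s ∷ lead s t (k ℕ.+ k) ∷ altʳ s t (k ℕ.+ k)                         ≡⟨ cong₂ (λ x u → s ∷ x ∷ u) (lead-even s t k) (altʳ-even s t k) ⟩
      s ∷ t ∷ concat (replicate k (s ∷ t ∷ []))                           ∎
      where open ≡-Reasoning

    altʳ-+ : ∀ (s t : A) i k → Σ (List A) λ X → altʳ s t (i ℕ.+ k) ≡ X ++ altʳ s t k × length X ≡ i
    altʳ-+ s t zero    k = [] , refl , refl
    altʳ-+ s t (suc i) k with altʳ-+ s t i k
    ... | X , e , l = lead s t (i ℕ.+ k) ∷ X , trans (altʳ-suc s t (i ℕ.+ k)) (cong (_ ∷_) e) , cong suc l

    lead-≢ : ∀ {s t : A} → s ≢ t → ∀ k → lead s t k ≢ lead t s k
    lead-≢ s≢t zero    = s≢t ∘ sym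
    lead-≢ s≢t (suc k) = lead-≢ (s≢t ∘ sym) k

    length-altʳ : ∀ (s t : A) k → length (altʳ s t k) ≡ k
    length-altʳ s t zero    = refl
    length-altʳ s t (suc k) = trans (cong length (altʳ-suc s t k)) (cong suc (length-altʳ s t k))

  module Rep {n : ℕ} (M : CoxeterMatrix n) where
    open CoxeterMatrix M
    open Coxeter M
    open Group M

    -- For s ≢ t the paths of path (width s t) have m s t − 1 vertices; path (width s s) is zero.
    width : Fin n → Fin n → ℕ
    width s t = m s t ∸ 2

    width-diag : ∀ s → width s s ≡ 0
    width-diag s = cong (_∸ 2) (m-diag s)

    width-sym : ∀ s t → width s t ≡ width t s
    width-sym s t = cong (_∸ 2) (m-sym s t)

    m≡width : ∀ {s t} → s ≢ t → suc (suc (width s t)) ≡ m s t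
    m≡width {s} {t} s≢t = ℕ.m+[n∸m]≡n (m-offdiag s t s≢t)

    V : Set
    V = Fin n → Seq

    infix 4 _≋_
    _≋_ : V → V → Set
    v ≋ w = ∀ r i → v r i ≡ w r i

    ≋-sym : ∀ {v w} → v ≋ w → w ≋ v
    ≋-sym e r i = sym (e r i)

    ≋-trans : ∀ {u v w} → u ≋ v → v ≋ w → u ≋ w
    ≋-trans e f r i = trans (e r i) (f r i)

    0V : V
    0V _ _ = 0ℤ

    infixl 6 _⊕_
    _⊕_ : V → V → V
    (v ⊕ w) r i = v r i + w r i

    ⊖_ : V → V
    (⊖ v) r i = - v r i

    NonNeg NonPos : V → Set
    NonNeg v = ∀ r i → 0ℤ ≤ v r i
    NonPos v = ∀ r i → v r i ≤ 0ℤ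

    NonNeg-resp : ∀ {v w} → v ≋ w → NonNeg v → NonNeg w
    NonNeg-resp e p r i = subst (0ℤ ≤_) (e r i) (p r i)

    NonPos-resp : ∀ {v w} → v ≋ w → NonPos v → NonPos w
    NonPos-resp e p r i = subst (_≤ 0ℤ) (e r i) (p r i)

    NonNeg-NonPos : ∀ {v} → NonNeg v → NonPos v → v ≋ 0V
    NonNeg-NonPos p q r i = ≤-antisym (q r i) (p r i)

    ⊖-NonNeg : ∀ {v} → NonNeg v → NonPos (⊖ v)
    ⊖-NonNeg p r i = neg-mono-≤ (p r i)

    ⊕-NonNeg : ∀ {v w} → NonNeg v → NonNeg w → NonNeg (v ⊕ w)
    ⊕-NonNeg p q r i = +-mono-≤ (p r i) (q r i)

    ⊕-NonPosˡ : ∀ {v w} → NonNeg w → NonPos (v ⊕ w) → NonPos v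
    ⊕-NonPosˡ {v} {w} p q r i = ≤-trans (subst (_≤ v r i + w r i) (+-identityʳ (v r i)) (+-monoʳ-≤ (v r i) (p r i))) (q r i)

    update : Fin n → Seq → V → V
    update x f v r = if does (r ≟ x) then f else v r

    update-same : ∀ x f v → update x f v x ≡ f
    update-same x f v rewrite proj₂ (dec-yes (x ≟ x) refl) = refl

    update-other : ∀ {x r} f v → r ≢ x → update x f v r ≡ v r
    update-other {x} {r} f v r≢x rewrite dec-no (r ≟ x) r≢x = refl

    -- The simple root of `s` with coefficient `f`; a choice of `f` takes the place of a scalar
    -- factor.
    e : Fin n → Seq → V
    e s f = update s f 0V

    e-same : ∀ s f → e s f s ≡ f
    e-same s f = update-same s f 0V

    e-other : ∀ {s r} f → r ≢ s → e s f r ≡ λ _ → 0ℤ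
    e-other f = update-other f 0V

    e-NonNeg : ∀ s {f} → (∀ i → 0ℤ ≤ f i) → NonNeg (e s f)
    e-NonNeg s {f} p r i with r ≟ s
    ... | yes _ = p i
    ... | no _  = ≤-refl

    neighbours : Fin n → V → Seq
    neighbours x v i = sumOver (allFin n) λ q → path (width x q) (v q) i

    neighbours-cong : ∀ x {v w} → v ≋ w → neighbours x v ≐ neighbours x w
    neighbours-cong x e i = sumOver-cong (allFin n) λ q → path-cong (width x q) (e q) i

    neighbours-⊕ : ∀ x v w i → neighbours x (v ⊕ w) i ≡ neighbours x v i + neighbours x w i
    neighbours-⊕ x v w i = trans (sumOver-cong (allFin n) λ q → path-+ (width x q) (v q) (w q) i) (sumOver-+ (allFin n) _ _)

    neighbours-⊖ : ∀ x v i → neighbours x (⊖ v) i ≡ - neighbours x v i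
    neighbours-⊖ x v i = trans (sumOver-cong (allFin n) λ q → path-neg (width x q) (v q) i) (sumOver-neg (allFin n) _)

    neighbours-NonNeg : ∀ x {v} → NonNeg v → ∀ i → 0ℤ ≤ neighbours x v i
    neighbours-NonNeg x p i = sumOver-≥0 (allFin n) λ q → path-≥0 (width x q) (p q) i

    path-self : ∀ x f → path (width x x) f ≐ (λ _ → 0ℤ)
    path-self x f i = trans (cong (λ c → path c f i) (width-diag x)) (path-trivial f i)

    neighbours-e : ∀ x q f → neighbours x (e q f) ≐ path (width x q) f
    neighbours-e x q f i =
      trans (sumOver-single (allFin n) (allFin⁺ n) (∈-allFin q)
               λ r r≢q → trans (cong (λ g → path (width x r) g i) (e-other f r≢q)) (path-0 (width x r) i))
            (cong (λ g → path (width x q) g i) (e-same q f))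

    neighbours-off : ∀ x {v w} → (∀ r → r ≢ x → v r ≐ w r) → neighbours x v ≐ neighbours x w
    neighbours-off x {v} {w} h i = sumOver-cong (allFin n) same
      where
      same : ∀ q → path (width x q) (v q) i ≡ path (width x q) (w q) i
      same q with q ≟ x
      ... | yes refl = trans (path-self x (v x) i) (sym (path-self x (w x) i))
      ... | no q≢x   = path-cong (width x q) (h q q≢x) i

    -- The simple reflection v - ⟨v , α_x^∨⟩ α_x for the Cartan matrix with 2 on the diagonal and
    -- the operators - `path (width x q)` off it.
    act₁ : Fin n → V → V
    act₁ x v = update x (λ i → - v x i + neighbours x v i) v

    act₁-same : ∀ x v i → act₁ x v x i ≡ - v x i + neighbours x v i
    act₁-same x v i = cong (λ f → f i) (update-same x _ v)

    act₁-other : ∀ {x r} v → r ≢ x → act₁ x v r ≡ v r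
    act₁-other v = update-other _ v

    by-cases : ∀ x {v w : V} → v x ≐ w x → (∀ r → r ≢ x → v r ≐ w r) → v ≋ w
    by-cases x p q r with r ≟ x
    ... | yes refl = p
    ... | no r≢x   = q r r≢x

    act₁-cong : ∀ x {v w} → v ≋ w → act₁ x v ≋ act₁ x w
    act₁-cong x {v} {w} e = by-cases x
      (λ i → trans (act₁-same x v i) (trans (cong₂ (λ a b → - a + b) (e x i) (neighbours-cong x e i)) (sym (act₁-same x w i))))
      (λ r r≢x i → trans (cong (λ f → f i) (act₁-other v r≢x)) (trans (e r i) (cong (λ f → f i) (sym (act₁-other w r≢x)))))

    act₁-⊕ : ∀ x v w → act₁ x (v ⊕ w) ≋ act₁ x v ⊕ act₁ x w
    act₁-⊕ x v w = by-cases x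
      (λ i → trans (act₁-same x (v ⊕ w) i) (trans (cong (- (v x i + w x i) +_) (neighbours-⊕ x v w i))
               (trans (regroup (v x i) (w x i) _ _) (sym (cong₂ _+_ (act₁-same x v i) (act₁-same x w i))))))
      (λ r r≢x i → trans (cong (λ f → f i) (act₁-other (v ⊕ w) r≢x))
                         (sym (cong₂ (λ f g → f i + g i) (act₁-other v r≢x) (act₁-other w r≢x))))
      where
      regroup : ∀ a b c d → - (a + b) + (c + d) ≡ (- a + c) + (- b + d)
      regroup = solve-∀

    act₁-⊖ : ∀ x v → act₁ x (⊖ v) ≋ ⊖ act₁ x v
    act₁-⊖ x v = by-cases x
      (λ i → trans (act₁-same x (⊖ v) i) (trans (cong (- - v x i +_) (neighbours-⊖ x v i))
               (trans (sym (neg-distrib-+ (- v x i) _)) (sym (cong -_ (act₁-same x v i))))))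
      (λ r r≢x i → trans (cong (λ f → f i) (act₁-other (⊖ v) r≢x)) (sym (cong (λ f → - f i) (act₁-other v r≢x))))

    neighbours-act₁ : ∀ x v → neighbours x (act₁ x v) ≐ neighbours x v
    neighbours-act₁ x v = neighbours-off x λ r r≢x i → cong (λ f → f i) (act₁-other v r≢x)

    act₁-square : ∀ x v → act₁ x (act₁ x v) ≋ v
    act₁-square x v = by-cases x
      (λ i → trans (act₁-same x (act₁ x v) i) (trans (cong₂ (λ a b → - a + b) (act₁-same x v i) (neighbours-act₁ x v i)) (cancel (v x i) _)))
      (λ r r≢x i → cong (λ f → f i) (trans (act₁-other (act₁ x v) r≢x) (act₁-other v r≢x)))
      where
      cancel : ∀ a b → - (- a + b) + b ≡ a
      cancel = solve-∀

    act : Word n → V → V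
    act []      v = v
    act (x ∷ u) v = act₁ x (act u v)

    act-++ : ∀ u w v → act (u ++ w) v ≡ act u (act w v)
    act-++ []      w v = refl
    act-++ (x ∷ u) w v = cong (act₁ x) (act-++ u w v)

    act-cong : ∀ u {v w} → v ≋ w → act u v ≋ act u w
    act-cong []      e = e
    act-cong (x ∷ u) e = act₁-cong x (act-cong u e)

    act-⊕ : ∀ u v w → act u (v ⊕ w) ≋ act u v ⊕ act u w
    act-⊕ []      v w r i = refl
    act-⊕ (x ∷ u) v w = ≋-trans (act₁-cong x (act-⊕ u v w)) (act₁-⊕ x (act u v) (act u w))

    act-⊖ : ∀ u v → act u (⊖ v) ≋ ⊖ act u v
    act-⊖ []      v r i = refl
    act-⊖ (x ∷ u) v = ≋-trans (act₁-cong x (act-⊖ u v)) (act₁-⊖ x (act u v))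

    act₁-0 : ∀ x → act₁ x 0V ≋ 0V
    act₁-0 x = by-cases x
      (λ i → trans (act₁-same x 0V i) (trans (+-identityˡ _) (zero-neighbours i)))
      (λ r r≢x i → cong (λ f → f i) (act₁-other 0V r≢x))
      where
      zero-neighbours : ∀ i → neighbours x 0V i ≡ 0ℤ
      zero-neighbours i = trans (sumOver-cong (allFin n) {G = λ _ → 0ℤ} λ q → path-0 (width x q) i) (zeros (allFin n))
        where
        zeros : ∀ (l : List (Fin n)) → sumOver l (λ _ → 0ℤ) ≡ 0ℤ
        zeros []      = refl
        zeros (_ ∷ l) = trans (+-identityˡ _) (zeros l)

    act-0 : ∀ u → act u 0V ≋ 0V
    act-0 []      r i = refl
    act-0 (x ∷ u) = ≋-trans (act₁-cong x (act-0 u)) (act₁-0 x)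

    act₁-e-same : ∀ s f → act₁ s (e s f) ≋ ⊖ e s f
    act₁-e-same s f = by-cases s
      (λ i → trans (act₁-same s (e s f) i)
               (trans (cong (- e s f s i +_) (trans (neighbours-e s s f i) (path-self s f i))) (+-identityʳ _)))
      (λ r r≢s i → trans (cong (λ g → g i) (trans (act₁-other (e s f) r≢s) (e-other f r≢s)))
                         (sym (cong (λ g → - g i) (e-other f r≢s))))

    act₁-e-other : ∀ {x s} f → x ≢ s → act₁ x (e s f) ≋ e s f ⊕ e x (path (width x s) f)
    act₁-e-other {x} {s} f x≢s = by-cases x
      (λ i → trans (act₁-same x (e s f) i)
               (cong₂ _+_ (trans (cong (λ g → - g i) (e-other f x≢s)) (sym (cong (λ g → g i) (e-other f x≢s))))
                          (trans (neighbours-e x s f i) (sym (cong (λ g → g i) (e-same x _))))))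
      (λ r r≢x i → trans (cong (λ g → g i) (act₁-other (e s f) r≢x))
                         (sym (trans (cong (λ g → e s f r i + g i) (e-other _ r≢x)) (+-identityʳ _))))

    module Dihedral (c : ℕ) where

      -- Reflecting alternately in two letters changes one of two coordinates at a time. Listed in
      -- order of appearance, the values obey a single three-term recurrence, whose sources `p` and
      -- `q` alternate and come from the other coordinates.
      orbit : Seq → Seq → Seq → Seq → ℕ → Seq
      orbit p q g₀ g₁ zero    = g₀
      orbit p q g₀ g₁ (suc k) = orbit q p g₁ (λ i → (path c g₁ i - g₀ i) + p i) k

      source : Seq → Seq → ℕ → Seq
      source p q zero    = p
      source p q (suc k) = source q p k

      orbit-rec : ∀ p q g₀ g₁ k i → orbit p q g₀ g₁ (suc (suc k)) i
                ≡ (path c (orbit p q g₀ g₁ (suc k)) i - orbit p q g₀ g₁ k i) + source p q k i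
      orbit-rec p q g₀ g₁ zero    i = refl
      orbit-rec p q g₀ g₁ (suc k) i = orbit-rec q p g₁ _ k i

      orbit-period : ∀ p q g₀ g₁ → orbit p q g₀ g₁ (suc (suc c) ℕ.+ suc (suc c)) ≐ g₀
      orbit-period p q g₀ g₁ = Wave.periodic c (source p q) (λ k i → refl) (orbit p q g₀ g₁) (orbit-rec p q g₀ g₁)

      act₁-plane : ∀ {s t} v g₀ g₁ → s ≢ t → width t s ≡ c → (∀ i → v t i ≡ 0ℤ)
                 → act₁ t (v ⊕ e s g₁ ⊕ e t g₀) ≋ v ⊕ e t (λ i → (path c g₁ i - g₀ i) + neighbours t v i) ⊕ e s g₁
      act₁-plane {s} {t} v g₀ g₁ s≢t refl vt = by-cases t
        (λ i → begin
          act₁ t w t i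
            ≡⟨ act₁-same t w i ⟩
          - ((v t i + e s g₁ t i) + e t g₀ t i) + neighbours t w i
            ≡⟨ cong₂ (λ a b → - a + b) (cong₂ _+_ (cong₂ _+_ (vt i) (cong (λ f → f i) (e-other g₁ (s≢t ∘ sym)))) (cong (λ f → f i) (e-same t g₀)))
                                       (nb i) ⟩
          - ((0ℤ + 0ℤ) + g₀ i) + ((neighbours t v i + path c g₁ i) + 0ℤ)
            ≡⟨ regroup (g₀ i) (neighbours t v i) (path c g₁ i) ⟩
          (0ℤ + ((path c g₁ i - g₀ i) + neighbours t v i)) + 0ℤ
            ≡⟨ cong₂ _+_ (cong₂ _+_ (vt i) (cong (λ f → f i) (e-same t _))) (cong (λ f → f i) (e-other g₁ (s≢t ∘ sym))) ⟨
          (v t i + e t _ t i) + e s g₁ t i ∎)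
        (λ r r≢t i → begin
          act₁ t w r i                          ≡⟨ cong (λ f → f i) (act₁-other w r≢t) ⟩
          (v r i + e s g₁ r i) + e t g₀ r i     ≡⟨ cong (λ f → (v r i + e s g₁ r i) + f i) (e-other g₀ r≢t) ⟩
          (v r i + e s g₁ r i) + 0ℤ             ≡⟨ regroup' (v r i) (e s g₁ r i) ⟩
          (v r i + 0ℤ) + e s g₁ r i             ≡⟨ cong (λ f → (v r i + f i) + e s g₁ r i) (e-other _ r≢t) ⟨
          (v r i + e t _ r i) + e s g₁ r i      ∎)
        where
        open ≡-Reasoning
        w = v ⊕ e s g₁ ⊕ e t g₀
        nb : ∀ i → neighbours t w i ≡ (neighbours t v i + path c g₁ i) + 0ℤ
        nb i = trans (neighbours-⊕ t (v ⊕ e s g₁) (e t g₀) i) (cong₂ _+_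
          (trans (neighbours-⊕ t v (e s g₁) i) (cong (neighbours t v i +_) (neighbours-e t s g₁ i)))
          (trans (neighbours-e t t g₀ i) (path-self t g₀ i)))
        regroup : ∀ g x y → - ((0ℤ + 0ℤ) + g) + ((x + y) + 0ℤ) ≡ (0ℤ + ((y - g) + x)) + 0ℤ
        regroup = solve-∀
        regroup' : ∀ x y → (x + y) + 0ℤ ≡ (x + 0ℤ) + y
        regroup' = solve-∀

      act-altʳ : ∀ {s t} v g₀ g₁ k → s ≢ t → width s t ≡ c → width t s ≡ c → (∀ i → v s i ≡ 0ℤ) → (∀ i → v t i ≡ 0ℤ)
               → let z = orbit (neighbours t v) (neighbours s v) g₀ g₁
                 in act (altʳ s t k) (v ⊕ e s g₁ ⊕ e t g₀) ≋ v ⊕ e (lead t s k) (z (suc k)) ⊕ e (lead s t k) (z k)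
      act-altʳ v g₀ g₁ zero s≢t _ _ _ _ r i = refl
      act-altʳ {s} {t} v g₀ g₁ (suc k) s≢t st ts vs vt =
        ≋-trans (λ r i → cong (λ f → f r i) (act-++ (altʳ t s k) (t ∷ []) (v ⊕ e s g₁ ⊕ e t g₀)))
        (≋-trans (act-cong (altʳ t s k) (act₁-plane v g₀ g₁ s≢t ts vt))
                 (act-altʳ v g₁ _ k (s≢t ∘ sym) ts st vt vs))

    act-relator : ∀ s t v → act (relator s t) v ≋ v
    act-relator s t v with s ≟ t
    ... | yes refl rewrite m-diag s = act₁-square s v
    ... | no s≢t = ≋-trans (λ r i → cong (λ u → act u v r i) relator≡)
        (≋-trans (act-cong (altʳ s t 2μ) decompose) (≋-trans (act-altʳ v° (v t) (v s) 2μ s≢t refl (width-sym t s) vs vt)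
          (≋-trans final (≋-sym decompose))))
      where
      open Dihedral (width s t)
      μ 2μ : ℕ
      μ = suc (suc (width s t))
      2μ = μ ℕ.+ μ
      relator≡ : relator s t ≡ altʳ s t 2μ
      relator≡ = trans (cong (λ k → concat (replicate k (s ∷ t ∷ []))) (sym (m≡width s≢t))) (sym (altʳ-even s t μ))
      -- The coordinates away from `s` and `t` never change, so they act as a source of period two,
      -- and `orbit-period` applies after 2m reflections.
      v° = update s (λ _ → 0ℤ) (update t (λ _ → 0ℤ) v)
      vs : ∀ i → v° s i ≡ 0ℤ
      vs i = cong (λ f → f i) (update-same s (λ _ → 0ℤ) (update t (λ _ → 0ℤ) v))
      vt : ∀ i → v° t i ≡ 0ℤ
      vt i = cong (λ f → f i) (trans (update-other (λ _ → 0ℤ) (update t (λ _ → 0ℤ) v) (s≢t ∘ sym)) (update-same t (λ _ → 0ℤ) v))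
      decompose : v ≋ v° ⊕ e s (v s) ⊕ e t (v t)
      decompose r i with r ≟ s | r ≟ t
      ... | yes refl | yes refl = contradiction refl s≢t
      ... | yes refl | no _     = sym (trans (+-identityʳ _) (+-identityˡ _))
      ... | no _     | yes refl = sym (+-identityˡ _)
      ... | no _     | no _     = sym (trans (+-identityʳ _) (+-identityʳ _))
      z = orbit (neighbours t v°) (neighbours s v°) (v t) (v s)
      e-cong : ∀ x {f g} → f ≐ g → e x f ≋ e x g
      e-cong x h r i with r ≟ x
      ... | yes _ = h i
      ... | no _  = refl
      final : v° ⊕ e (lead t s 2μ) (z (suc 2μ)) ⊕ e (lead s t 2μ) (z 2μ) ≋ v° ⊕ e s (v s) ⊕ e t (v t)
      final r i rewrite lead-even s t μ | lead-even t s μ =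
        cong₂ (λ a b → (v° r i + a) + b) (e-cong s (orbit-period (neighbours s v°) (neighbours t v°) (v s) _) r i)
                                         (e-cong t (orbit-period (neighbours t v°) (neighbours s v°) (v t) (v s)) r i)

    act-resp-≈ : ∀ {u w} → u ≈ w → ∀ v → act u v ≋ act w v
    act-resp-≈ (rel u w s t) v =
      ≋-trans (λ r i → cong (λ f → f r i) (trans (act-++ u (relator s t ++ w) v) (cong (act u) (act-++ (relator s t) w v))))
      (≋-trans (act-cong u (act-relator s t (act w v))) λ r i → cong (λ f → f r i) (sym (act-++ u w v)))
    act-resp-≈ ≈refl        v r i = refl
    act-resp-≈ (≈sym p)     v = ≋-sym (act-resp-≈ p v)
    act-resp-≈ (≈trans p q) v = ≋-trans (act-resp-≈ p v) (act-resp-≈ q v)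

    act-injective : ∀ u {v} → act u v ≋ 0V → v ≋ 0V
    act-injective u {v} h = ≋-trans (≋-sym (act-resp-≈ (≈trans (≈-reflexive (cong (reverse u ++_) (sym (++-identityʳ u)))) (reverse-cancelˡ u [])) v))
      (≋-trans (λ r i → cong (λ f → f r i) (act-++ (reverse u) u v)) (≋-trans (act-cong (reverse u) h) (act-0 (reverse u))))

    act-∉ : ∀ u {s} v → s ∉ u → act u v s ≡ v s
    act-∉ []      v _   = refl
    act-∉ (x ∷ u) v s∉u = trans (act₁-other (act u v) (s∉u ∘ here)) (act-∉ u v (s∉u ∘ there))

    -- A coefficient that is strictly positive at every index, so that a root carrying it is visibly
    -- non-zero already at index 0.
    one : Seq
    one _ = 1ℤ

    one≥0 : ∀ i → 0ℤ ≤ one i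
    one≥0 _ = +≤+ z≤n

    -- Of the 2m letters of the relator, the last m + 1 spell the inverse of the first m - 1, which
    -- is a shorter word.
    altʳ-bound : ∀ {s t} k → s ≢ t → Reduced (altʳ s t k) → k ℕ.≤ m s t
    altʳ-bound {s} {t} k s≢t r with k ℕ.≤? m s t
    ... | yes k≤m = k≤m
    ... | no k≰m = ⊥-elim (ℕ.1+n≰n (ℕ.≤-trans (ℕ.n≤1+n _) too-short))
      where
      μ = m s t
      i = k ∸ suc μ
      X₁ = altʳ-+ s t i (suc μ)
      reduced : Reduced (altʳ s t (suc μ))
      reduced = Reduced-suffix (proj₁ X₁) (subst Reduced (trans (cong (altʳ s t) (sym (ℕ.m∸n+n≡m (ℕ.≰⇒> k≰m)))) (proj₁ (proj₂ X₁))) r)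
      μ' : ℕ
      μ' = suc (width s t)
      X₂ = altʳ-+ s t μ' (suc μ)
      whole : (proj₁ X₂ ++ altʳ s t (suc μ)) ≈ []
      whole = ≈trans (≈-reflexive (trans (sym (proj₁ (proj₂ X₂))) (trans (cong (altʳ s t) (trans (ℕ.+-suc μ' μ) (cong (ℕ._+ μ) (m≡width s≢t))))
                (altʳ-even s t μ)))) (≈trans (≈-reflexive (sym (++-identityʳ (relator s t)))) (rel [] [] s t))
      inverse : reverse (proj₁ X₂) ≈ altʳ s t (suc μ)
      inverse = ≈trans (≈-reflexive (sym (++-identityʳ _))) (≈trans (++-congˡ (reverse (proj₁ X₂)) (≈sym whole)) (reverse-cancelˡ (proj₁ X₂) _))
      too-short : suc (suc μ') ℕ.≤ μ'
      too-short = subst₂ ℕ._≤_ (trans (length-altʳ s t (suc μ)) (cong suc (sym (m≡width s≢t)))) (trans (length-reverse (proj₁ X₂)) (proj₂ (proj₂ X₂)))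
                    (reduced _ inverse)

  module Positivity {n : ℕ} (M : CoxeterMatrix n) (_≈?_ : ∀ u v → Dec (Coxeter._≈_ M u v)) where
    open CoxeterMatrix M
    open Coxeter M
    open Group M
    open Decidable _≈?_
    open Rep M

    -- The rank two case: the coefficients are consecutive terms of the homogeneous recurrence that
    -- starts with 0 and `f`, which stays non-negative up to time m.
    altʳ-positive : ∀ {s t} → s ≢ t → ∀ k → suc k ℕ.≤ m s t → ∀ {f} → (∀ i → 0ℤ ≤ f i)
      → ∃₂ λ g h → (∀ i → 0ℤ ≤ g i) × (∀ i → 0ℤ ≤ h i)
          × act (altʳ s t k) (e s f) ≋ 0V ⊕ e (lead t s k) g ⊕ e (lead s t k) h
    altʳ-positive {s} {t} s≢t k k<m {f} f≥0 = z (suc k) , z k , z≥0 (suc k) k<m , z≥0 k (ℕ.<⇒≤ k<m) ,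
      ≋-trans (act-cong (altʳ s t k) pad) (act-altʳ 0V (λ _ → 0ℤ) f k s≢t refl (width-sym t s) (λ _ → refl) (λ _ → refl))
      where
      open Dihedral (width s t)
      N₀ : ∀ x i → neighbours x 0V i ≡ 0ℤ
      N₀ x i = trans (sym (+-identityˡ _)) (trans (sym (act₁-same x 0V i)) (act₁-0 x x i))
      z = orbit (neighbours t 0V) (neighbours s 0V) (λ _ → 0ℤ) f
      source-0 : ∀ x y k i → source (neighbours x 0V) (neighbours y 0V) k i ≡ 0ℤ
      source-0 x y zero    i = N₀ x i
      source-0 x y (suc k) i = source-0 y x k i
      z≥0 : ∀ k → k ℕ.≤ m s t → ∀ i → 0ℤ ≤ z k i
      z≥0 k k≤m = Wave.Homogeneous.nonnegative (width s t) z (λ _ → refl)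
        (λ k _ i → trans (orbit-rec _ _ _ f k i) (trans (cong (path _ (z (suc k)) i - z k i +_) (source-0 t s k i)) (+-identityʳ _)))
        f≥0 k (subst (k ℕ.≤_) (sym (m≡width s≢t)) k≤m)
      pad : e s f ≋ 0V ⊕ e s f ⊕ e t (λ _ → 0ℤ)
      pad r i with r ≟ t
      ... | yes _ = sym (trans (+-identityʳ _) (+-identityˡ _))
      ... | no _  = sym (trans (+-identityʳ _) (+-identityˡ _))

    -- Let t be the last letter of `u` and split `u` as `z` times an alternating word in s and t
    -- such that neither letter is a descent of `z`. The alternating word turns α_s into a
    -- non-negative combination of α_s and α_t, and `z` keeps both positive by induction.
    positive-bounded : ∀ k u s → length u ℕ.≤ k → Reduced (u ∷ʳ s) → ∀ {f} → (∀ i → 0ℤ ≤ f i) → NonNeg (act u (e s f))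
    positive-bounded k u s l r f≥0 with initLast u
    positive-bounded k _ s l r f≥0 | [] = e-NonNeg s f≥0
    positive-bounded zero _ s l r f≥0 | u₁ ∷ʳ′ t = ⊥-elim (ℕ.1+n≰n (ℕ.≤-trans (ℕ.≤-reflexive (sym (length-∷ʳ u₁ t))) (ℕ.≤-trans l z≤n)))
    positive-bounded (suc k) _ s l r {f} f≥0 | u₁ ∷ʳ′ t =
      strip (length u₁) u₁ 0 ℕ.≤-refl (ℕ.s≤s⁻¹ (subst (ℕ._≤ suc k) (length-∷ʳ u₁ t) l)) ≈refl (sym (length-++ u₁))
      where
      u = u₁ ∷ʳ t
      u-red : Reduced u
      u-red = Reduced-prefix u r
      s≢t : s ≢ t
      s≢t refl = ¬Reduced-square u₁ s [] (subst Reduced (++-assoc u₁ (s ∷ []) (s ∷ [])) r)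

      -- Finds that splitting. The first letter of the suffix is an ascent of `z` because the
      -- product is reduced; the other letter is tested, and if it is a descent it is split off from
      -- `z` and lengthens the suffix. `j` only bounds the search, while `k` is the induction bound.
      strip : ∀ j z i → length z ℕ.≤ j → length z ℕ.≤ k → (z ++ altʳ s t (suc i)) ≈ u → length z ℕ.+ suc i ≡ length u
            → NonNeg (act u (e s f))
      strip j z i z≤j z≤k z≈u len with Reduced? (z ∷ʳ lead s t (suc i))
      ... | yes r₂ with altʳ-positive s≢t (suc i) bound f≥0
        where
        total : (z ++ altʳ t s (suc (suc i))) ≈ (u ∷ʳ s)
        total = ≈trans (≈-reflexive (sym (++-assoc z (altʳ s t (suc i)) (s ∷ [])))) (++-congʳ (s ∷ []) z≈u)
        total-length : length (z ++ altʳ t s (suc (suc i))) ≡ length (u ∷ʳ s)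
        total-length = begin
          length (z ++ altʳ t s (suc (suc i)))                ≡⟨ length-++ z ⟩
          length z ℕ.+ length (altʳ t s (suc (suc i)))        ≡⟨ cong (length z ℕ.+_) (length-altʳ t s (suc (suc i))) ⟩
          length z ℕ.+ suc (suc i)                            ≡⟨ ℕ.+-suc (length z) (suc i) ⟩
          suc (length z ℕ.+ suc i)                            ≡⟨ cong suc len ⟩
          suc (length u)                                      ≡⟨ length-∷ʳ u s ⟨
          length (u ∷ʳ s)                                     ∎
          where open ≡-Reasoning
        bound : suc (suc i) ℕ.≤ m s t
        bound = subst (suc (suc i) ℕ.≤_) (m-sym t s) (altʳ-bound (suc (suc i)) (s≢t ∘ sym)
          (Reduced-suffix z (Reduced-resp-≈ (≈sym total) (ℕ.≤-reflexive total-length) r)))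
      ...   | g , h , g≥0 , h≥0 , eq = NonNeg-resp (≋-sym equation)
          (⊕-NonNeg (⊕-NonNeg (λ r i → ≤-refl) (positive-bounded k z _ z≤k r₁ g≥0)) (positive-bounded k z _ z≤k r₂ h≥0))
        where
        r₁ : Reduced (z ∷ʳ lead s t i)
        r₁ = Reduced-prefix (z ∷ʳ lead s t i) (subst Reduced (trans (cong (z ++_) (altʳ-suc s t i)) (sym (++-assoc z (lead s t i ∷ []) _)))
               (Reduced-resp-≈ (≈sym z≈u) (ℕ.≤-reflexive (trans (length-++ z) (trans (cong (length z ℕ.+_) (length-altʳ s t (suc i))) len))) u-red))
        equation : act u (e s f) ≋ 0V ⊕ act z (e (lead s t i) g) ⊕ act z (e (lead s t (suc i)) h)
        equation = ≋-trans (≋-sym (act-resp-≈ z≈u (e s f)))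
          (≋-trans (λ r' i' → cong (λ v → v r' i') (act-++ z (altʳ s t (suc i)) (e s f)))
          (≋-trans (act-cong z eq) (≋-trans (act-⊕ z (0V ⊕ e₁) e₂) λ r' i' → cong (_+ act z e₂ r' i')
            (trans (act-⊕ z 0V e₁ r' i') (cong (_+ act z e₁ r' i') (act-0 z r' i'))))))
          where
          e₁ = e (lead s t i) g
          e₂ = e (lead s t (suc i)) h
      strip j z i z≤j z≤k z≈u len | no ¬r with descentʳ z-red ¬r
        where
        z-red : Reduced z
        z-red = Reduced-prefix z (Reduced-resp-≈ (≈sym z≈u)
          (ℕ.≤-reflexive (trans (length-++ z) (trans (cong (length z ℕ.+_) (length-altʳ s t (suc i))) len))) u-red)
      strip zero z i z≤j z≤k z≈u len | no ¬r | z' , e' , l' = ⊥-elim (ℕ.1+n≰n (ℕ.≤-trans (ℕ.≤-trans (ℕ.≤-reflexive l') z≤j) z≤n))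
      strip (suc j) z i z≤j z≤k z≈u len | no ¬r | z' , e' , l' =
        strip j z' (suc i) (ℕ.s≤s⁻¹ (ℕ.≤-trans (ℕ.≤-reflexive l') z≤j)) (ℕ.≤-trans (ℕ.n≤1+n _) (ℕ.≤-trans (ℕ.≤-reflexive l') z≤k))
          (≈trans (≈-reflexive (trans (cong (z' ++_) (altʳ-suc s t (suc i))) (sym (++-assoc z' (lead s t (suc i) ∷ []) _))))
                  (≈trans (++-congʳ (altʳ s t (suc i)) e') z≈u))
          (trans (ℕ.+-suc (length z') (suc i)) (trans (cong (ℕ._+ suc i) l') len))

    positive : ∀ {u s} → Reduced (u ∷ʳ s) → ∀ {f} → (∀ i → 0ℤ ≤ f i) → NonNeg (act u (e s f))
    positive {u} {s} = positive-bounded (length u) u s ℕ.≤-refl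

    negative : ∀ {u s} → Reduced u → ¬ Reduced (u ∷ʳ s) → ∀ {f} → (∀ i → 0ℤ ≤ f i) → NonPos (act u (e s f))
    negative {u} {s} r ¬r {f} f≥0 with descentʳ r ¬r
    ... | v , vs≈u , l = NonPos-resp (≋-sym equation) (⊖-NonNeg (positive vs-red f≥0))
      where
      vs-red : Reduced (v ∷ʳ s)
      vs-red = Reduced-resp-≈ (≈sym vs≈u) (ℕ.≤-reflexive (trans (length-∷ʳ v s) l)) r
      equation : act u (e s f) ≋ ⊖ act v (e s f)
      equation = ≋-trans (≋-sym (act-resp-≈ vs≈u (e s f))) (≋-trans (λ r i → cong (λ w → w r i) (act-++ v (s ∷ []) (e s f)))
        (≋-trans (act-cong v (act₁-e-same s f)) (act-⊖ v (e s f))))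

    -- A vector of both signs is zero, and words act injectively, so `f` would vanish. Together with
    -- `negative` this lets ascents be read off from signs.
    not-NonPos : ∀ {u s} → Reduced (u ∷ʳ s) → ∀ {f} → (∀ i → 1ℤ ≤ f i) → ¬ NonPos (act u (e s f))
    not-NonPos {u} {s} r {f} f≥1 np = 1≰0 (subst (1ℤ ≤_) (trans (sym (cong (λ g → g 0) (e-same s f))) (zero-vector s 0)) (f≥1 0))
      where
      zero-vector : e s f ≋ 0V
      zero-vector = act-injective u (NonNeg-NonPos (positive r λ i → ≤-trans (+≤+ z≤n) (f≥1 i)) np)
      1≰0 : ¬ 1ℤ ≤ 0ℤ
      1≰0 (+≤+ ())

    ascent : ∀ {u s} → Reduced u → ¬ NonPos (act u (e s one)) → Reduced (u ∷ʳ s)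
    ascent {u} {s} r h with Reduced? (u ∷ʳ s)
    ... | yes r' = r'
    ... | no ¬r' = ⊥-elim (h (negative r ¬r' one≥0))

    -- The zero vector counts as a root, and it is the only one with both signs; the contradictions
    -- below therefore take the form that some root is zero.
    Root : V → Set
    Root γ = ∃₂ λ u s → ∃ λ f → (∀ i → 0ℤ ≤ f i) × act u (e s f) ≋ γ

    Root-act : ∀ w {γ} → Root γ → Root (act w γ)
    Root-act w (u , s , f , f≥0 , p) = w ++ u , s , f , f≥0 , ≋-trans (λ r i → cong (λ v → v r i) (act-++ w u (e s f))) (act-cong w p)

    Root-sign : ∀ {γ} → Root γ → NonNeg γ ⊎ NonPos γ
    Root-sign (u , s , f , f≥0 , p) with reduce u
    ... | v , v≈u , r with Reduced? (v ∷ʳ s)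
    ...   | yes r' = inj₁ (NonNeg-resp (≋-trans (act-resp-≈ v≈u _) p) (positive r' f≥0))
    ...   | no ¬r' = inj₂ (NonPos-resp (≋-trans (act-resp-≈ v≈u _) p) (negative r ¬r' f≥0))

open Roots

-- Greedy reduced subwords and the longest element.

module GreedyWords where
  open import Data.Nat as ℕ using (_+_; _≤_; z≤n; s≤s)
  open import Data.Nat.Properties hiding (_≟_)

  infixr 8 _^^_
  _^^_ : {A : Set} → List A → ℕ → List A
  c ^^ L = concat (replicate L c)

  module Greedy {n : ℕ} (M : CoxeterMatrix n) (_≈?_ : ∀ u v → Dec (Coxeter._≈_ M u v)) where
    open Coxeter M
    open Group M
    open Decidable _≈?_
    open Exchange M _≈?_

    greedy : Word n → Word n → Word n
    greedy u []      = []
    greedy u (x ∷ D) with Reduced? (u ∷ʳ x)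
    ... | yes _ = x ∷ greedy (u ∷ʳ x) D
    ... | no  _ = greedy u D

    greedy-take : ∀ {u x} D → Reduced (u ∷ʳ x) → greedy u (x ∷ D) ≡ x ∷ greedy (u ∷ʳ x) D
    greedy-take {u} {x} D r with Reduced? (u ∷ʳ x)
    ... | yes _ = refl
    ... | no ¬r = contradiction r ¬r

    greedy-skip : ∀ {u x} D → ¬ Reduced (u ∷ʳ x) → greedy u (x ∷ D) ≡ greedy u D
    greedy-skip {u} {x} D ¬r with Reduced? (u ∷ʳ x)
    ... | yes r = contradiction r ¬r
    ... | no _  = refl

    Reduced-∷ʳ-resp : ∀ {u v} x → u ≈ v → length u ≡ length v → Reduced (u ∷ʳ x) → Reduced (v ∷ʳ x)
    Reduced-∷ʳ-resp {u} {v} x e l = Reduced-resp-≈ (++-congʳ (x ∷ []) e)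
      (≤-reflexive (trans (length-∷ʳ v x) (trans (cong suc (sym l)) (sym (length-∷ʳ u x)))))

    greedy-cong : ∀ {u v} D → u ≈ v → length u ≡ length v → greedy u D ≡ greedy v D
    greedy-cong []      e l = refl
    greedy-cong {u} {v} (x ∷ D) e l with Reduced? (u ∷ʳ x)
    ... | yes r = sym (trans (greedy-take D (Reduced-∷ʳ-resp x e l r))
        (cong (x ∷_) (sym (greedy-cong D (++-congʳ (x ∷ []) e) (trans (length-∷ʳ u x) (trans (cong suc l) (sym (length-∷ʳ v x))))))))
    ... | no ¬r = sym (trans (greedy-skip D λ r → ¬r (Reduced-∷ʳ-resp x (≈sym e) (sym l) r)) (sym (greedy-cong D e l)))

    greedy-++ : ∀ u D E → greedy u (D ++ E) ≡ greedy u D ++ greedy (u ++ greedy u D) E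
    greedy-++ u []      E = cong (λ v → greedy v E) (sym (++-identityʳ u))
    greedy-++ u (x ∷ D) E with Reduced? (u ∷ʳ x)
    ... | yes _ = cong (x ∷_) (trans (greedy-++ (u ∷ʳ x) D E) (cong (λ v → greedy (u ∷ʳ x) D ++ greedy v E) (++-assoc u (x ∷ []) _)))
    ... | no _  = greedy-++ u D E

    greedy-reduced : ∀ u D → Reduced u → Reduced (u ++ greedy u D)
    greedy-reduced u []      r = subst Reduced (sym (++-identityʳ u)) r
    greedy-reduced u (x ∷ D) r with Reduced? (u ∷ʳ x)
    ... | yes r' = subst Reduced (++-assoc u (x ∷ []) _) (greedy-reduced (u ∷ʳ x) D r')
    ... | no _   = greedy-reduced u D r

    greedy-progress : ∀ {u s} D → Reduced (u ∷ʳ s) → s ∈ D → 1 ≤ length (greedy u D)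
    greedy-progress {u} (x ∷ D) r (here refl) = subst (λ w → 1 ≤ length w) (sym (greedy-take D r)) (s≤s z≤n)
    greedy-progress {u} (x ∷ D) r (there s∈D) with Reduced? (u ∷ʳ x)
    ... | yes _ = s≤s z≤n
    ... | no _  = greedy-progress D r s∈D

    module Longest (w₀ : Word n) (long : IsLongestWord w₀) where

      N : ℕ
      N = length w₀

      Reduced-length : ∀ {u} → Reduced u → length u ≤ N
      Reduced-length = proj₂ long _

      -- Once `u z` spells `w₀`, the word `s u z` is too long to be reduced. Since `s u` is reduced,
      -- exchange removes a letter of `z`, and the rest of `z` completes `s u`.
      extend : ∀ u → Reduced u → ∃ λ z → (u ++ z) ≈ w₀ × length (u ++ z) ≡ N
      extend []      r = w₀ , ≈refl , refl
      extend (s ∷ u) r with extend u (Reduced-suffix (s ∷ []) r)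
      ... | z , uz≈w₀ , len with exchange-++ s u z r (Reduced-resp-≈ (≈sym uz≈w₀) (≤-reflexive len) (proj₁ long))
                                   (λ r' → 1+n≰n (subst (λ l → suc l ≤ N) len (Reduced-length r')))
      ...   | p , x , q , refl , f = p ++ q , equal , length-equal
        where
        equal : (s ∷ u ++ p ++ q) ≈ w₀
        equal = begin
          s ∷ u ++ p ++ q           ≡⟨ cong (s ∷_) (++-assoc u p q) ⟨
          (s ∷ u ++ p) ++ q         ≈⟨ ++-congʳ q f ⟩
          (u ++ p ∷ʳ x) ++ q        ≡⟨ ++-assoc u (p ∷ʳ x) q ⟩
          u ++ (p ∷ʳ x) ++ q        ≡⟨ cong (u ++_) (++-assoc p (x ∷ []) q) ⟩
          u ++ p ++ x ∷ q           ≈⟨ uz≈w₀ ⟩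
          w₀                        ∎
          where open ≈-Reasoning
        length-equal : suc (length (u ++ p ++ q)) ≡ N
        length-equal = trans (trans (cong (λ v → suc (length v)) (sym (++-assoc u p q))) (trans (sym (length-deletes (u ++ p) x q)) (cong length (++-assoc u p (x ∷ q))))) len

      IsLongest-length : ∀ {v} → IsLongestWord v → length v ≡ N
      IsLongest-length (r , l) = ≤-antisym (Reduced-length r) (l w₀ (proj₁ long))

      IsLongest-≈ : ∀ {v} → IsLongestWord v → v ≈ w₀
      IsLongest-≈ {v} lv with extend v (proj₁ lv)
      ... | []    , e , _ = ≈trans (≈-reflexive (sym (++-identityʳ v))) e
      ... | x ∷ z , e , l = ⊥-elim (1+n≰n (≤-trans (s≤s (m≤m+n _ (length z))) (≤-reflexive
              (trans (sym (+-suc (length v) (length z))) (trans (sym (length-++ v)) (trans l (sym (IsLongest-length lv))))))))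

      Reduced⇒IsLongest : ∀ {v} → Reduced v → length v ≡ N → IsLongestWord v
      Reduced⇒IsLongest r l = r , λ u ru → subst (length u ≤_) (sym l) (Reduced-length ru)

      ≈⇒IsLongest : ∀ {v} → v ≈ w₀ → length v ≡ N → IsLongestWord v
      ≈⇒IsLongest e l = Reduced⇒IsLongest (Reduced-resp-≈ (≈sym e) (≤-reflexive l) (proj₁ long)) l

      ¬Reduced-longer : ∀ {u x} → length u ≡ N → ¬ Reduced (u ∷ʳ x)
      ¬Reduced-longer {u} {x} l r = 1+n≰n (subst (_≤ N) (trans (length-∷ʳ u x) (cong suc l)) (Reduced-length r))

      greedy-full : ∀ {u} D → length u ≡ N → greedy u D ≡ []
      greedy-full []      l = refl
      greedy-full {u} (x ∷ D) l = trans (greedy-skip {u} {x} D (¬Reduced-longer {u} {x} l)) (greedy-full {u} D l)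

      -- A reduced word below maximal length has an ascent, by `extend`, and this letter occurs in
      -- `c`; hence every pass through `c` takes at least one letter.
      greedy-complete : ∀ {c} → (∀ s → s ∈ c) → ∀ L u → Reduced u → N ≤ length u + L → length (u ++ greedy u (c ^^ L)) ≡ N
      greedy-complete all∈ zero u r l = ≤-antisym (Reduced-length (greedy-reduced u [] r))
        (≤-trans l (≤-reflexive (trans (+-identityʳ _) (cong length (sym (++-identityʳ u))))))
      greedy-complete {c} all∈ (suc L) u r l =
        trans (cong length (trans (cong (u ++_) (greedy-++ u c (c ^^ L))) (sym (++-assoc u (greedy u c) _))))
              (greedy-complete all∈ L u' (greedy-reduced u c r) grown)
        where
        u' = u ++ greedy u c
        grown : N ≤ length u' + L
        grown with extend u r
        ... | [] , _ , len = ≤-trans (≤-reflexive (sym (trans (sym (cong length (++-identityʳ u))) len)))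
                (≤-trans (m≤m+n _ _) (≤-trans (≤-reflexive (sym (length-++ u))) (m≤m+n _ L)))
        ... | s ∷ z , e , len = ≤-trans l (≤-trans (≤-reflexive (+-suc (length u) L)) (+-monoˡ-≤ L longer))
          where
          asc : Reduced (u ∷ʳ s)
          asc = Reduced-prefix (u ∷ʳ s) (subst Reduced (sym (++-assoc u (s ∷ []) z)) (Reduced-resp-≈ (≈sym e) (≤-reflexive len) (proj₁ long)))
          longer : suc (length u) ≤ length u'
          longer = subst (suc (length u) ≤_) (sym (length-++ u)) (≤-trans (≤-reflexive (+-comm 1 (length u)))
            (+-monoʳ-≤ (length u) (greedy-progress c asc (all∈ s))))

open GreedyWords

-- The skew form of an oriented Coxeter graph, and the letters a greedy run skips.

module Orientations where
  import Data.Nat as ℕ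
  import Data.Nat.Properties as ℕ
  import Data.Nat.Divisibility as ℕ
  open import Data.Nat.ListAction using (product)
  open import Data.Nat.ListAction.Properties using (∈⇒∣product; product≢0)
  open import Data.Integer using (ℤ; 0ℤ; 1ℤ; _+_; _-_; _*_; -_; _≤_; +≤+; nonNegative)
  open import Data.Integer.Properties hiding (_≟_)
  open import Data.Integer.Tactic.RingSolver using (solve-∀)

  module _ {A : Set} where

    sumOver-↭ : ∀ {l l' : List A} F → l ↭ l' → sumOver l F ≡ sumOver l' F
    sumOver-↭ F Perm.refl         = refl
    sumOver-↭ F (prep x p)        = cong (F x +_) (sumOver-↭ F p)
    sumOver-↭ F (swap {xs = xs} {ys} x y p) =
      trans (cong (λ S → F x + (F y + S)) (sumOver-↭ F p)) (exchange (F x) (F y) (sumOver ys F))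
      where
      exchange : ∀ a b c → a + (b + c) ≡ b + (a + c)
      exchange = solve-∀
    sumOver-↭ F (Perm.trans p q)  = trans (sumOver-↭ F p) (sumOver-↭ F q)

    sumOver-0 : ∀ (l : List A) {F} → (∀ q → q ∈ l → F q ≡ 0ℤ) → sumOver l F ≡ 0ℤ
    sumOver-0 []      h = refl
    sumOver-0 (q ∷ l) h = cong₂ _+_ (h q (here refl)) (sumOver-0 l λ r r∈l → h r (there r∈l))

    sumOver-∷ʳ : ∀ (l : List A) x F → sumOver (l ∷ʳ x) F ≡ sumOver l F + F x
    sumOver-∷ʳ l x F = trans (sumOver-↭ F (++-comm l (x ∷ []))) (+-comm (F x) (sumOver l F))

    sumOver-∈-cong : ∀ (l : List A) {F G} → (∀ q → q ∈ l → F q ≡ G q) → sumOver l F ≡ sumOver l G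
    sumOver-∈-cong []      h = refl
    sumOver-∈-cong (q ∷ l) h = cong₂ _+_ (h q (here refl)) (sumOver-∈-cong l λ r r∈l → h r (there r∈l))

    sumOver-term : ∀ (l : List A) {F} → (∀ q → 0ℤ ≤ F q) → sumOver l F ≡ 0ℤ → ∀ {q} → q ∈ l → F q ≤ 0ℤ
    sumOver-term (q ∷ l) p e (here refl) = +-≥0-≤0ˡ (p q) (sumOver-≥0 l p) (≤-reflexive e)
    sumOver-term (r ∷ l) p e (there q∈l) =
      sumOver-term l p (≤-antisym (+-≥0-≤0ʳ (p r) (sumOver-≥0 l p) (≤-reflexive e)) (sumOver-≥0 l p)) q∈l

    ∑-sumOver : ∀ K (l : List A) (F : A → ℕ → ℤ) → ∑ K (λ i → sumOver l (λ q → F q i)) ≡ sumOver l (λ q → ∑ K (F q))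
    ∑-sumOver K []      F = ∑-0 K λ _ → refl
    ∑-sumOver K (q ∷ l) F = trans (∑-+ K (F q) _) (cong (∑ K (F q) +_) (∑-sumOver K l F))

    sumOver-*ˡ : ∀ (l : List A) a F → a * sumOver l F ≡ sumOver l (λ q → a * F q)
    sumOver-*ˡ []      a F = *-zeroʳ a
    sumOver-*ˡ (q ∷ l) a F = trans (*-distribˡ-+ a (F q) _) (cong (a * F q +_) (sumOver-*ˡ l a F))

    sumOver-*ʳ : ∀ (l : List A) a F → sumOver l F * a ≡ sumOver l (λ q → F q * a)
    sumOver-*ʳ []      a F = refl
    sumOver-*ʳ (q ∷ l) a F = trans (*-distribʳ-+ a (F q) _) (cong (F q * a +_) (sumOver-*ʳ l a F))

  Unique-resp-↭ : {A : Set} {xs ys : List A} → xs ↭ ys → Unique xs → Unique ys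
  Unique-resp-↭ {A} p = SetoidPerm.Unique-resp-↭ (setoid A) (↭⇒↭ₛ p)

  ∉-of-↭ : ∀ {n x} {e : List (Fin n)} → x ∷ e ↭ allFin n → x ∉ e
  ∉-of-↭ {n} p x∈e with Unique-resp-↭ (↭-sym p) (allFin⁺ n)
  ... | x≢e ∷ _ = All.lookup x≢e x∈e refl

  module SkewForm {n : ℕ} (M : CoxeterMatrix n) where
    open Rep M

    Modulus : ℕ → Set
    Modulus K = ∀ x y → suc (width x y) ℕ.∣ K

    -- The cut-off must suit all path lengths at once and still lie beyond the coordinate `i` under
    -- inspection; hence a multiple of the product of all lengths.
    large-modulus : ∀ i → Σ ℕ λ K → Modulus K × i ℕ.< K
    large-modulus i = suc i ℕ.* K₀ , (λ x y → ℕ.∣n⇒∣m*n (suc i) (divides₀ x y)) , ℕ.m≤m*n (suc i) K₀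
      where
      rows : Fin n → List ℕ
      rows x = map (λ y → suc (width x y)) (allFin n)
      K₀ = product (map (λ x → product (rows x)) (allFin n))
      divides₀ : ∀ x y → suc (width x y) ℕ.∣ K₀
      divides₀ x y = ℕ.∣-trans (∈⇒∣product (∈-map⁺ (λ y → suc (width x y)) (∈-allFin y)))
                               (∈⇒∣product (∈-map⁺ (λ x → product (rows x)) (∈-allFin x)))
      instance
        K₀≢0 : ℕ.NonZero K₀
        K₀≢0 = product≢0 (All.map⁺ (All.universal (λ x → product≢0 (All.map⁺ (All.universal (λ y → _) (allFin n)))) (allFin n)))

    module _ (K : ℕ) where

      pair : V → V → Fin n → Fin n → ℤ
      pair β γ x r = ⟨ β x ∣ path (width x r) (γ r) ⟩⟨ K ⟩ - ⟨ path (width x r) (β r) ∣ γ x ⟩⟨ K ⟩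

      -- The skew-symmetric form ω_c, oriented by the order of the letters in c.
      ω : Word n → V → V → ℤ
      ω []      β γ = 0ℤ
      ω (x ∷ e) β γ = sumOver e (pair β γ x) + ω e β γ

      -- The part of ω at the edges of `x` when `x` precedes all other letters. The sum may run over
      -- all of S, since `pair` vanishes at `x` itself.
      total : V → V → Fin n → ℤ
      total β γ x = ⟨ β x ∣ neighbours x γ ⟩⟨ K ⟩ - ⟨ neighbours x β ∣ γ x ⟩⟨ K ⟩

      pair-self : ∀ β γ x → pair β γ x x ≡ 0ℤ
      pair-self β γ x = cong₂ _-_ (∑-0 K λ i → trans (cong (β x i *_) (path-self x (γ x) i)) (*-zeroʳ (β x i)))
                                  (∑-0 K λ i → cong (_* γ x i) (path-self x (β x) i))

      ⟨∣neighbours⟩ : ∀ f x γ → ⟨ f ∣ neighbours x γ ⟩⟨ K ⟩ ≡ sumOver (allFin n) λ r → ⟨ f ∣ path (width x r) (γ r) ⟩⟨ K ⟩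
      ⟨∣neighbours⟩ f x γ = trans (∑-cong K λ i → sumOver-*ˡ (allFin n) (f i) _) (∑-sumOver K (allFin n) _)

      ⟨neighbours∣⟩ : ∀ g x β → ⟨ neighbours x β ∣ g ⟩⟨ K ⟩ ≡ sumOver (allFin n) λ r → ⟨ path (width x r) (β r) ∣ g ⟩⟨ K ⟩
      ⟨neighbours∣⟩ g x β = trans (∑-cong K λ i → sumOver-*ʳ (allFin n) (g i) _) (∑-sumOver K (allFin n) _)

      sumOver-pair : ∀ β γ {x e} → x ∷ e ↭ allFin n → sumOver e (pair β γ x) ≡ total β γ x
      sumOver-pair β γ {x} {e} p = begin
        sumOver e (pair β γ x)                        ≡⟨ +-identityˡ _ ⟨
        0ℤ + sumOver e (pair β γ x)                   ≡⟨ cong (_+ sumOver e (pair β γ x)) (pair-self β γ x) ⟨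
        sumOver (x ∷ e) (pair β γ x)                  ≡⟨ sumOver-↭ (pair β γ x) p ⟩
        sumOver (allFin n) (pair β γ x)               ≡⟨ trans (sumOver-+ (allFin n) _ _) (cong (sumOver (allFin n) (λ r → ⟨ β x ∣ path (width x r) (γ r) ⟩⟨ K ⟩) +_) (sumOver-neg (allFin n) _)) ⟩
        _                                             ≡⟨ cong₂ _-_ (⟨∣neighbours⟩ (β x) x γ) (⟨neighbours∣⟩ (γ x) x β) ⟨
        total β γ x                                   ∎
        where open ≡-Reasoning

      ω-cons : ∀ β γ {x e} → x ∷ e ↭ allFin n → ω (x ∷ e) β γ ≡ total β γ x + ω e β γ
      ω-cons β γ {x} {e} p = cong (_+ ω e β γ) (sumOver-pair β γ p)

      ω-0 : ∀ e {β γ} → (∀ p q → p ∈ e → q ∈ e → pair β γ p q ≡ 0ℤ) → ω e β γ ≡ 0ℤ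
      ω-0 []      h = refl
      ω-0 (x ∷ e) h = cong₂ _+_ (sumOver-0 e λ q q∈e → h x q (here refl) (there q∈e))
                                (ω-0 e λ p q p∈e q∈e → h p q (there p∈e) (there q∈e))

      ω-cong : ∀ e {β γ β' γ'} → (∀ p q → p ∈ e → q ∈ e → pair β γ p q ≡ pair β' γ' p q) → ω e β γ ≡ ω e β' γ'
      ω-cong []      h = refl
      ω-cong (x ∷ e) h = cong₂ _+_ (sumOver-∈-cong e λ q q∈e → h x q (here refl) (there q∈e))
                                   (ω-cong e λ p q p∈e q∈e → h p q (there p∈e) (there q∈e))

      pair-cong : ∀ {β γ β' γ'} p q → β p ≐ β' p → β q ≐ β' q → γ p ≐ γ' p → γ q ≐ γ' q → pair β γ p q ≡ pair β' γ' p q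
      pair-cong p q βp βq γp γq = cong₂ _-_
        (∑-cong K λ i → cong₂ _*_ (βp i) (path-cong (width p q) γq i))
        (∑-cong K λ i → cong₂ _*_ (path-cong (width p q) βq i) (γp i))

      pair-0ˡ : ∀ {β} γ p q → β p ≐ 0V p → β q ≐ 0V q → pair β γ p q ≡ 0ℤ
      pair-0ˡ γ p q βp βq = cong₂ _-_
        (∑-0 K λ i → cong (_* path (width p q) (γ q) i) (βp i))
        (∑-0 K λ i → cong (_* γ p i) (trans (path-cong (width p q) βq i) (path-0 (width p q) i)))

      pair-0ʳ : ∀ β {γ} p q → γ p ≐ 0V p → γ q ≐ 0V q → pair β γ p q ≡ 0ℤ
      pair-0ʳ β p q γp γq = cong₂ _-_
        (∑-0 K λ i → trans (cong (β p i *_) (trans (path-cong (width p q) γq i) (path-0 (width p q) i))) (*-zeroʳ (β p i)))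
        (∑-0 K λ i → trans (cong (path (width p q) (β q) i *_) (γp i)) (*-zeroʳ (path (width p q) (β q) i)))

      module _ (mod : Modulus K) where

        pair-skew : ∀ β γ x r → pair β γ r x ≡ - pair β γ x r
        pair-skew β γ x r = trans (cong₂ _-_ first second) (flip ⟨ path (width x r) (β r) ∣ γ x ⟩⟨ K ⟩ ⟨ β x ∣ path (width x r) (γ r) ⟩⟨ K ⟩)
          where
          first : ⟨ β r ∣ path (width r x) (γ x) ⟩⟨ K ⟩ ≡ ⟨ path (width x r) (β r) ∣ γ x ⟩⟨ K ⟩
          first = trans (path-self-adjoint (width r x) (β r) (γ x) K (mod r x)) (cong (λ w → ⟨ path w (β r) ∣ γ x ⟩⟨ K ⟩) (width-sym r x))
          second : ⟨ path (width r x) (β x) ∣ γ r ⟩⟨ K ⟩ ≡ ⟨ β x ∣ path (width x r) (γ r) ⟩⟨ K ⟩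
          second = trans (sym (path-self-adjoint (width r x) (β x) (γ r) K (mod r x))) (cong (λ w → ⟨ β x ∣ path w (γ r) ⟩⟨ K ⟩) (width-sym r x))
          flip : ∀ a b → a - b ≡ - (b - a)
          flip = solve-∀

        ω-snoc : ∀ β γ {x} e → ω (e ∷ʳ x) β γ ≡ ω e β γ - sumOver e (pair β γ x)
        ω-snoc β γ []      = refl
        ω-snoc β γ {x} (y ∷ e) = begin
          sumOver (e ∷ʳ x) (pair β γ y) + ω (e ∷ʳ x) β γ
            ≡⟨ cong₂ _+_ (trans (sumOver-∷ʳ e x (pair β γ y)) (cong (sumOver e (pair β γ y) +_) (pair-skew β γ x y))) (ω-snoc β γ e) ⟩
          (sumOver e (pair β γ y) + - pair β γ x y) + (ω e β γ - sumOver e (pair β γ x))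
            ≡⟨ regroup (sumOver e (pair β γ y)) (pair β γ x y) (ω e β γ) (sumOver e (pair β γ x)) ⟩
          (sumOver e (pair β γ y) + ω e β γ) - (pair β γ x y + sumOver e (pair β γ x)) ∎
          where
          open ≡-Reasoning
          regroup : ∀ a b c d → (a + - b) + (c - d) ≡ (a + c) - (b + d)
          regroup = solve-∀

        ω-last : ∀ β γ {x e} → x ∷ e ↭ allFin n → ω (e ∷ʳ x) β γ ≡ ω e β γ - total β γ x
        ω-last β γ {x} {e} p = trans (ω-snoc β γ e) (cong (λ t → ω e β γ - t) (sumOver-pair β γ p))

        -- The reflection replaces the coordinate β_x by - β_x + Nβ and leaves the neighbour sum Nβ
        -- alone. The new terms ⟨Nβ , Nγ⟩ occur on both sides of the difference and cancel.
        total-act₁ : ∀ β γ x → total (act₁ x β) (act₁ x γ) x ≡ - total β γ x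
        total-act₁ β γ x = trans (cong₂ _-_ first second) (cancel ⟨ β x ∣ neighbours x γ ⟩⟨ K ⟩ ⟨ neighbours x β ∣ γ x ⟩⟨ K ⟩ ⟨ neighbours x β ∣ neighbours x γ ⟩⟨ K ⟩)
          where
          Nβ = neighbours x β
          Nγ = neighbours x γ
          first : ⟨ act₁ x β x ∣ neighbours x (act₁ x γ) ⟩⟨ K ⟩ ≡ - ⟨ β x ∣ Nγ ⟩⟨ K ⟩ + ⟨ Nβ ∣ Nγ ⟩⟨ K ⟩
          first = trans (∑-cong K λ i → trans (cong₂ _*_ (act₁-same x β i) (neighbours-act₁ x γ i)) (expand (β x i) (Nβ i) (Nγ i)))
                        (trans (∑-+ K (λ i → - (β x i * Nγ i)) (λ i → Nβ i * Nγ i)) (cong (_+ ⟨ Nβ ∣ Nγ ⟩⟨ K ⟩) (∑-neg K _)))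
            where
            expand : ∀ a b c → (- a + b) * c ≡ - (a * c) + b * c
            expand = solve-∀
          second : ⟨ neighbours x (act₁ x β) ∣ act₁ x γ x ⟩⟨ K ⟩ ≡ - ⟨ Nβ ∣ γ x ⟩⟨ K ⟩ + ⟨ Nβ ∣ Nγ ⟩⟨ K ⟩
          second = trans (∑-cong K λ i → trans (cong₂ _*_ (neighbours-act₁ x β i) (act₁-same x γ i)) (expand (Nβ i) (γ x i) (Nγ i)))
                        (trans (∑-+ K (λ i → - (Nβ i * γ x i)) (λ i → Nβ i * Nγ i)) (cong (_+ ⟨ Nβ ∣ Nγ ⟩⟨ K ⟩) (∑-neg K _)))
            where
            expand : ∀ a b c → a * (- b + c) ≡ - (a * b) + a * c
            expand = solve-∀
          cancel : ∀ a b c → (- a + c) - (- b + c) ≡ - (a - b)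
          cancel = solve-∀

        -- Moving `x` from first to last place reverses the edges at `x`, so `total` changes sign;
        -- the reflection in `x` changes the same sign and fixes the remaining coordinates.
        ω-rotate : ∀ β γ {x e} → x ∷ e ↭ allFin n → ω (e ∷ʳ x) β γ ≡ ω (x ∷ e) (act₁ x β) (act₁ x γ)
        ω-rotate β γ {x} {e} p = begin
          ω (e ∷ʳ x) β γ                                                     ≡⟨ ω-last β γ p ⟩
          ω e β γ - total β γ x                                              ≡⟨ +-comm (ω e β γ) (- total β γ x) ⟩
          - total β γ x + ω e β γ                                            ≡⟨ cong₂ _+_ (total-act₁ β γ x) (ω-cong e λ p q p∈e q∈e →
                                                                                   pair-cong p q (fix β p∈e) (fix β q∈e) (fix γ p∈e) (fix γ q∈e)) ⟨
          total (act₁ x β) (act₁ x γ) x + ω e (act₁ x β) (act₁ x γ)          ≡⟨ ω-cons (act₁ x β) (act₁ x γ) p ⟨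
          ω (x ∷ e) (act₁ x β) (act₁ x γ)                                    ∎
          where
          open ≡-Reasoning
          fix : ∀ v {q} → q ∈ e → act₁ x v q ≐ v q
          fix v q∈e i = cong (λ f → f i) (act₁-other v λ { refl → ∉-of-↭ p q∈e })

        ω-last-≤0 : ∀ {β γ x e} → x ∷ e ↭ allFin n → NonNeg β → NonNeg γ → (∀ r → r ≢ x → β r ≐ 0V r) → ω (e ∷ʳ x) β γ ≤ 0ℤ
        ω-last-≤0 {β} {γ} {x} {e} p β≥0 γ≥0 off = subst (_≤ 0ℤ) (sym value) (neg-mono-≤ (∑-≥0 K λ i → *-≥0 (β≥0 x i) (neighbours-NonNeg x γ≥0 i)))
          where
          *-≥0 : ∀ {a b} → 0ℤ ≤ a → 0ℤ ≤ b → 0ℤ ≤ a * b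
          *-≥0 {a} {b} p q = *-monoʳ-≤-nonNeg b {{nonNegative q}} p
          off' : ∀ {q} → q ∈ e → β q ≐ 0V q
          off' q∈e = off _ λ { refl → ∉-of-↭ p q∈e }
          no-neighbours : ∀ i → neighbours x β i ≡ 0ℤ
          no-neighbours i = trans (neighbours-off x off i) (trans (sym (+-identityˡ _)) (trans (sym (act₁-same x 0V i)) (act₁-0 x x i)))
          value : ω (e ∷ʳ x) β γ ≡ - ⟨ β x ∣ neighbours x γ ⟩⟨ K ⟩
          value = trans (ω-last β γ p) (trans (cong₂ _-_ (ω-0 e λ p q p∈e q∈e → pair-0ˡ γ p q (off' p∈e) (off' q∈e))
                         (cong (λ t → ⟨ β x ∣ neighbours x γ ⟩⟨ K ⟩ - t) (∑-0 K λ i → cong (_* γ x i) (no-neighbours i))))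
                         (simplify _))
            where
            simplify : ∀ a → 0ℤ - (a - 0ℤ) ≡ - a
            simplify = solve-∀

  module Skip {n : ℕ} (M : CoxeterMatrix n) (_≈?_ : ∀ u v → Dec (Coxeter._≈_ M u v)) where
    open CoxeterMatrix M
    open Coxeter M
    open Group M
    open Rep M
    open Positivity M _≈?_
    open SkewForm M
    open import Data.List.Membership.DecPropositional (_≟_ {n}) using (_∈?_)

    -- `c` is the Coxeter word as it continues from the current position and `u` the word taken so
    -- far. Roots are seen from the right of `u`: a positive β is inverted when `u` makes it
    -- negative. All cut-offs `K` are covered because conclusions about a coordinate need a `K`
    -- beyond it.
    Aligned : Word n → Word n → Set
    Aligned c u = ∀ K → Modulus K → ∀ {β γ} → Root β → Root γ → NonNeg β → NonPos (act u β) → NonNeg γ → NonNeg (act u γ)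
                → ω K c β γ ≤ 0ℤ

    zeroˡ : ∀ K c {β} γ → β ≋ 0V → ω K c β γ ≤ 0ℤ
    zeroˡ K c γ z = ≤-reflexive (ω-0 K c λ p q _ _ → pair-0ˡ K γ p q (z p) (z q))

    zeroʳ : ∀ K c β {γ} → γ ≋ 0V → ω K c β γ ≤ 0ℤ
    zeroʳ K c β z = ≤-reflexive (ω-0 K c λ p q _ _ → pair-0ʳ K β p q (z p) (z q))

    Aligned-[] : ∀ c → Aligned c []
    Aligned-[] c K mod {β} {γ} _ _ β≥0 β≤0 _ _ = zeroˡ K c γ (NonNeg-NonPos β≥0 β≤0)

    concentrated : ∀ {x γ} → NonNeg γ → NonPos (act₁ x γ) → ∀ r → r ≢ x → γ r ≐ 0V r
    concentrated {x} {γ} γ≥0 xγ≤0 r r≢x i = ≤-antisym (subst (λ f → f i ≤ 0ℤ) (act₁-other γ r≢x) (xγ≤0 r i)) (γ≥0 r i)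

    concentrated-e : ∀ {x γ} → (∀ r → r ≢ x → γ r ≐ 0V r) → γ ≋ e x (γ x)
    concentrated-e {x} {γ} h = by-cases x (λ i → sym (cong (λ f → f i) (e-same x (γ x))))
      λ r r≢x i → trans (h r r≢x i) (sym (cong (λ f → f i) (e-other (γ x) r≢x)))

    act-∷ʳ : ∀ u x v → act (u ∷ʳ x) v ≡ act u (act₁ x v)
    act-∷ʳ u x v = act-++ u (x ∷ []) v

    -- Reflecting both roots in `x` leads back to the earlier condition unless `x` makes one of them
    -- negative. Such a root is supported at `x`: for β the form is then visibly non-positive, while
    -- γ would be inverted by `u x` and so must be zero.
    Aligned-take : ∀ {x e u} → x ∷ e ↭ allFin n → Reduced (u ∷ʳ x) → Aligned (x ∷ e) u → Aligned (e ∷ʳ x) (u ∷ʳ x)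
    Aligned-take {x} {e'} {u} p r al K mod {β} {γ} Rβ Rγ β≥0 uβ≤0 γ≥0 uγ≥0
      with Root-sign (Root-act (x ∷ []) Rβ) | Root-sign (Root-act (x ∷ []) Rγ)
    ... | inj₂ xβ≤0 | _ = ω-last-≤0 K mod p β≥0 γ≥0 (concentrated β≥0 xβ≤0)
    ... | inj₁ xβ≥0 | inj₁ xγ≥0 = subst (_≤ 0ℤ) (sym (ω-rotate K mod β γ p))
            (al K mod (Root-act (x ∷ []) Rβ) (Root-act (x ∷ []) Rγ) xβ≥0 (subst NonPos (act-∷ʳ u x β) uβ≤0)
                      xγ≥0 (subst NonNeg (act-∷ʳ u x γ) uγ≥0))
    ... | inj₁ xβ≥0 | inj₂ xγ≤0 = zeroʳ K (e' ∷ʳ x) β (act-injective u (NonNeg-NonPos uγ≥0' uγ≤0'))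
      where
      γ≋e : γ ≋ e x (γ x)
      γ≋e = concentrated-e (concentrated γ≥0 xγ≤0)
      uγ≥0' : NonNeg (act u γ)
      uγ≥0' = NonNeg-resp (act-cong u (≋-sym γ≋e)) (positive r (γ≥0 x))
      flipped : act (u ∷ʳ x) γ ≋ ⊖ act u γ
      flipped = ≋-trans (λ r i → cong (λ v → v r i) (act-∷ʳ u x γ)) (≋-trans (act-cong u (≋-trans (act₁-cong x γ≋e)
        (≋-trans (act₁-e-same x (γ x)) (λ r i → cong -_ (sym (γ≋e r i)))))) (act-⊖ u γ))
      uγ≤0' : NonPos (act u γ)
      uγ≤0' r i = neg-cancel-≤ (subst (0ℤ ≤_) (flipped r i) (uγ≥0 r i))

    module _ {x e' u} (p : x ∷ e' ↭ allFin n) (r : Reduced u) (¬r : ¬ Reduced (u ∷ʳ x)) (al : Aligned (x ∷ e') u) where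

      -- Skipping means that α_x is already inverted, so it may be put in for β. The form then is
      -- the sum of the non-negative neighbour values, and each of them below `K` vanishes.
      skip-neighbours : ∀ {γ} → Root γ → NonNeg γ → NonNeg (act u γ) → ∀ i → neighbours x γ i ≡ 0ℤ
      skip-neighbours {γ} Rγ γ≥0 uγ≥0 i with large-modulus i
      ... | K , mod , i<K = ∑-≤0 K (neighbours-NonNeg x γ≥0) (subst (_≤ 0ℤ) value
              (al K mod ([] , x , one , one≥0 , λ _ _ → refl) Rγ (e-NonNeg x one≥0) (negative r ¬r one≥0) γ≥0 uγ≥0)) i i<K
        where
        β = e x one
        off : ∀ r → r ≢ x → β r ≐ 0V r
        off r r≢x i = cong (λ f → f i) (e-other one r≢x)
        off' : ∀ {q} → q ∈ e' → β q ≐ 0V q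
        off' {q} q∈e = off q λ { refl → ∉-of-↭ p q∈e }
        value : ω K (x ∷ e') β γ ≡ ∑ K (neighbours x γ)
        value = trans (ω-cons K β γ p) (trans (cong₂ _+_
          (cong₂ _-_ (∑-cong K λ i → trans (cong (λ f → f i * neighbours x γ i) (e-same x one)) (*-identityˡ _))
                     (∑-0 K λ i → cong (_* γ x i) (trans (neighbours-e x x one i) (path-self x one i))))
          (ω-0 K e' λ p q p∈e q∈e → pair-0ˡ K γ p q (off' p∈e) (off' q∈e))) (simplify _))
          where
          simplify : ∀ a → (a - 0ℤ) + 0ℤ ≡ a
          simplify = solve-∀

      -- With vanishing neighbours the reflection merely negates γ_x. If the reflected root is
      -- positive, this forces γ_x = 0; if it is negative, γ is supported at `x`, hence inverted by
      -- `u`, hence zero.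
      skip-coordinate : ∀ {γ} → Root γ → NonNeg γ → NonNeg (act u γ) → γ x ≐ 0V x
      skip-coordinate {γ} Rγ γ≥0 uγ≥0 i with Root-sign (Root-act (x ∷ []) Rγ)
      ... | inj₁ xγ≥0 = ≤-antisym (neg-cancel-≤ (subst (0ℤ ≤_) (trans (act₁-same x γ i)
              (trans (cong (- γ x i +_) (skip-neighbours Rγ γ≥0 uγ≥0 i)) (+-identityʳ _))) (xγ≥0 x i))) (γ≥0 x i)
      ... | inj₂ xγ≤0 = act-injective u (NonNeg-NonPos uγ≥0 (NonPos-resp (act-cong u (≋-sym γ≋e)) (negative r ¬r (γ≥0 x)))) x i
        where
        γ≋e : γ ≋ e x (γ x)
        γ≋e = concentrated-e (concentrated γ≥0 xγ≤0)

      skip-fixed : ∀ {γ} → Root γ → NonNeg γ → NonNeg (act u γ) → act₁ x γ ≋ γ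
      skip-fixed {γ} Rγ γ≥0 uγ≥0 = by-cases x
        (λ i → trans (act₁-same x γ i) (trans (cong₂ (λ a b → - a + b) (skip-coordinate Rγ γ≥0 uγ≥0 i) (skip-neighbours Rγ γ≥0 uγ≥0 i))
                 (sym (skip-coordinate Rγ γ≥0 uγ≥0 i))))
        λ r r≢x i → cong (λ f → f i) (act₁-other γ r≢x)

      -- By `skip-fixed` the reflection leaves γ as it is. The reflected β is still inverted:
      -- otherwise it too would be fixed by `x`, thus equal to β, which is inverted.
      Aligned-skip : Aligned (e' ∷ʳ x) u
      Aligned-skip K mod {β} {γ} Rβ Rγ β≥0 uβ≤0 γ≥0 uγ≥0 with Root-sign (Root-act (x ∷ []) Rβ)
      ... | inj₂ xβ≤0 = ω-last-≤0 K mod p β≥0 γ≥0 (concentrated β≥0 xβ≤0)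
      ... | inj₁ xβ≥0 with Root-sign (Root-act u (Root-act (x ∷ []) Rβ))
      ...   | inj₂ uxβ≤0 = subst (_≤ 0ℤ) (sym (ω-rotate K mod β γ p))
                (al K mod (Root-act (x ∷ []) Rβ) (Root-act (x ∷ []) Rγ) xβ≥0 uxβ≤0
                  (NonNeg-resp (≋-sym xγ) γ≥0) (NonNeg-resp (act-cong u (≋-sym xγ)) uγ≥0))
        where xγ = skip-fixed Rγ γ≥0 uγ≥0
      ...   | inj₁ uxβ≥0 = zeroˡ K (e' ∷ʳ x) γ (act-injective u (NonNeg-NonPos (NonNeg-resp (act-cong u xβ≋β) uxβ≥0) uβ≤0))
        where
        xβ≋β : act₁ x β ≋ β
        xβ≋β = ≋-trans (≋-sym (skip-fixed (Root-act (x ∷ []) Rβ) xβ≥0 uxβ≥0)) (act₁-square x β)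

      Commuting : Fin n → Set
      Commuting q = q ≢ x × m x q ≡ 2

      -- The root b₁ α_q is positive and not inverted by `u`, so its support avoids `x` and the
      -- neighbours of `x`. At the first occurrence of q its q-coordinate is still `one`; a repeated
      -- q has been checked within `b₁`.
      skip-commuting : ∀ b₁ b → All Commuting b₁ → Reduced (u ++ b₁ ++ b) → All Commuting b
      skip-commuting b₁ []      ok rb = []
      skip-commuting b₁ (q ∷ b) ok rb = cq ∷ skip-commuting (b₁ ∷ʳ q) b (All.++⁺ ok (cq ∷ []))
          (subst Reduced (cong (u ++_) (sym (++-assoc b₁ (q ∷ []) b))) rb)
        where
        γ = act b₁ (e q one)
        Rγ : Root γ
        Rγ = b₁ , q , one , one≥0 , λ _ _ → refl
        r₁ : Reduced (u ++ b₁ ∷ʳ q)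
        r₁ = Reduced-prefix (u ++ b₁ ∷ʳ q) {b} (subst Reduced (trans (cong (u ++_) (sym (++-assoc b₁ (q ∷ []) b))) (sym (++-assoc u (b₁ ∷ʳ q) b))) rb)
        γ≥0 : NonNeg γ
        γ≥0 = positive (Reduced-suffix u r₁) one≥0
        uγ≥0 : NonNeg (act u γ)
        uγ≥0 = subst NonNeg (act-++ u b₁ (e q one)) (positive (subst Reduced (sym (++-assoc u b₁ (q ∷ []))) r₁) one≥0)
        1≰0 : ¬ 1ℤ ≤ 0ℤ
        1≰0 (+≤+ ())
        cq : Commuting q
        cq with q ∈? b₁
        ... | yes q∈b₁ = All.lookup ok q∈b₁
        ... | no q∉b₁ = q≢x , by-m
          where
          γq : γ q ≡ one
          γq = trans (act-∉ b₁ (e q one) q∉b₁) (e-same q one)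
          q≢x : q ≢ x
          q≢x refl = 1≰0 (≤-reflexive (trans (sym (cong (λ f → f 0) γq)) (skip-coordinate Rγ γ≥0 uγ≥0 0)))
          by-m : m x q ≡ 2
          by-m with m x q ℕ.≟ 2
          ... | yes m≡2 = m≡2
          ... | no m≢2 = ⊥-elim (1≰0 (≤-trans (subst (λ f → 1ℤ ≤ path (width x q) f 0) (sym γq) (path-≥1 (width x q) wide (λ _ → ≤-refl) 0))
                  (sumOver-term (allFin n) (λ s → path-≥0 (width x s) (γ≥0 s) 0) (skip-neighbours Rγ γ≥0 uγ≥0 0) (∈-allFin q))))
            where
            wide : 1 ℕ.≤ width x q
            wide = ℕ.∸-monoˡ-≤ 2 (ℕ.≤∧≢⇒< (m-offdiag x q (q≢x ∘ sym)) (m≢2 ∘ sym))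

open Orientations

-- Isomorphisms from commutation and from rotation.

module Isomorphisms where
  open import Data.Nat as ℕ using (_+_; _≤_; z≤n)
  open import Data.Nat.Properties hiding (_≟_)
  import Data.Integer as ℤ
  open import Data.Integer using (0ℤ)
  import Data.Integer.Properties as ℤ

  ^^-suc : {A : Set} (c : List A) (L : ℕ) → c ^^ suc L ≡ c ^^ L ++ c
  ^^-suc c zero    = ++-identityʳ c
  ^^-suc c (suc L) = trans (cong (c ++_) (^^-suc c L)) (sym (++-assoc c (c ^^ L) c))

  ^^-rotate : {A : Set} (s : A) (d r : List A) (L : ℕ) → (s ∷ d) ^^ L ++ s ∷ r ≡ s ∷ (d ∷ʳ s) ^^ L ++ r
  ^^-rotate s d r zero    = refl
  ^^-rotate s d r (suc L) = cong (s ∷_) (begin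
    (d ++ (s ∷ d) ^^ L) ++ s ∷ r        ≡⟨ ++-assoc d _ _ ⟩
    d ++ (s ∷ d) ^^ L ++ s ∷ r          ≡⟨ cong (d ++_) (^^-rotate s d r L) ⟩
    d ++ s ∷ (d ∷ʳ s) ^^ L ++ r         ≡⟨ ++-assoc d (s ∷ []) _ ⟨
    (d ∷ʳ s) ++ (d ∷ʳ s) ^^ L ++ r      ≡⟨ ++-assoc (d ∷ʳ s) _ r ⟨
    ((d ∷ʳ s) ++ (d ∷ʳ s) ^^ L) ++ r    ∎)
    where open ≡-Reasoning

  -- D is an initial segment of ccc⋯.
  data Follows {A : Set} : List A → List A → Set where
    []  : ∀ {c} → Follows c []
    _∷_ : ∀ x {c D} → Follows (c ∷ʳ x) D → Follows (x ∷ c) (x ∷ D)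

  module _ {A : Set} where

    Follows-++ : ∀ (p q : List A) {D} → Follows (q ++ p) D → Follows (p ++ q) (p ++ D)
    Follows-++ []      q {D} F = subst (λ c → Follows c D) (++-identityʳ q) F
    Follows-++ (x ∷ p) q {D} F = x ∷ subst (λ c → Follows c (p ++ D)) (sym (++-assoc p q (x ∷ [])))
      (Follows-++ p (q ∷ʳ x) (subst (λ c → Follows c D) (sym (++-assoc q (x ∷ []) p)) F))

    Follows-^^ : ∀ (c : List A) L → Follows c (c ^^ L)
    Follows-^^ c zero    = []
    Follows-^^ c (suc L) = subst (λ c' → Follows c' (c ++ c ^^ L)) (++-identityʳ c) (Follows-++ c [] (Follows-^^ c L))

  module Commutation {n : ℕ} (M : CoxeterMatrix n) where
    open CoxeterMatrix M
    open Coxeter M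
    open Group M

    infix 4 _~_
    data _~_ : Word n → Word n → Set where
      ~refl  : ∀ {u} → u ~ u
      ~trans : ∀ {u v w} → u ~ v → v ~ w → u ~ w
      ~cons  : ∀ x {u v} → u ~ v → (x ∷ u) ~ (x ∷ v)
      ~swap  : ∀ {s t} q → m s t ≡ 2 → (s ∷ t ∷ q) ~ (t ∷ s ∷ q)

    ~sym : ∀ {u v} → u ~ v → v ~ u
    ~sym ~refl         = ~refl
    ~sym (~trans p q)  = ~trans (~sym q) (~sym p)
    ~sym (~cons x p)   = ~cons x (~sym p)
    ~sym (~swap {s} {t} q e) = ~swap q (trans (m-sym t s) e)

    ~reflexive : ∀ {u v} → u ≡ v → u ~ v
    ~reflexive refl = ~refl

    ~-++ˡ : ∀ p {u v} → u ~ v → (p ++ u) ~ (p ++ v)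
    ~-++ˡ []      e = e
    ~-++ˡ (x ∷ p) e = ~cons x (~-++ˡ p e)

    ~-++ʳ : ∀ q {u v} → u ~ v → (u ++ q) ~ (v ++ q)
    ~-++ʳ q ~refl         = ~refl
    ~-++ʳ q (~trans e f)  = ~trans (~-++ʳ q e) (~-++ʳ q f)
    ~-++ʳ q (~cons x e)   = ~cons x (~-++ʳ q e)
    ~-++ʳ q (~swap r e)   = ~swap (r ++ q) e

    ~-^^ : ∀ L {u v} → u ~ v → (u ^^ L) ~ (v ^^ L)
    ~-^^ zero    e = ~refl
    ~-^^ (suc L) {u} {v} e = ~trans (~-++ʳ (u ^^ L) e) (~-++ˡ v (~-^^ L e))

    ~-move : ∀ {y} b q → All (λ r → m y r ≡ 2) b → (y ∷ b ++ q) ~ (b ++ y ∷ q)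
    ~-move []      q []       = ~refl
    ~-move (x ∷ b) q (e ∷ es) = ~trans (~swap (b ++ q) e) (~cons x (~-move b q es))

    ~⇒≈ : ∀ {u v} → u ~ v → u ≈ v
    ~⇒≈ ~refl        = ≈refl
    ~⇒≈ (~trans e f) = ≈trans (~⇒≈ e) (~⇒≈ f)
    ~⇒≈ (~cons x e)  = ∷-cong x (~⇒≈ e)
    -- Inserting `s s` and then `t t` completes the relator (s t)² in front of `t s q`.
    ~⇒≈ (~swap {s} {t} q e) = begin
      s ∷ t ∷ q                        ≈⟨ ∷-cong s (∷-cong t (square-cancel s q)) ⟨
      s ∷ t ∷ s ∷ s ∷ q                ≈⟨ ∷-cong s (∷-cong t (∷-cong s (square-cancel t (s ∷ q)))) ⟨
      s ∷ t ∷ s ∷ t ∷ t ∷ s ∷ q        ≈⟨ subst (λ k → (concat (replicate k (s ∷ t ∷ [])) ++ t ∷ s ∷ q) ≈ (t ∷ s ∷ q)) e (rel [] (t ∷ s ∷ q) s t) ⟩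
      t ∷ s ∷ q                        ∎
      where open ≈-Reasoning

    ~-length : ∀ {u v} → u ~ v → length u ≡ length v
    ~-length ~refl        = refl
    ~-length (~trans e f) = trans (~-length e) (~-length f)
    ~-length (~cons x e)  = cong suc (~-length e)
    ~-length (~swap q e)  = refl

    IsLongest-resp-~ : ∀ {u v} → u ~ v → IsLongestWord u → IsLongestWord v
    IsLongest-resp-~ e (r , l) = Reduced-resp-≈ (~⇒≈ e) (≤-reflexive (sym (~-length e))) r ,
      λ u ru → subst (length u ≤_) (~-length e) (l u ru)

    -- Stronger than an isomorphism of complexes: all positions are matched, also those that are not
    -- vertices, and the subwords for the longest element correspond. In this form isomorphisms
    -- compose and invert without mention of faces.
    record PositionIso (Q Q' : Word n) : Set where
      field
        to        : Fin (length Q) → Fin (length Q')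
        from      : Fin (length Q') → Fin (length Q)
        from-to   : ∀ i → from (to i) ≡ i
        to-from   : ∀ j → to (from j) ≡ j
        longest   : ∀ T → IsLongestWord (select Q T) → IsLongestWord (select Q' (T ∘ from))
        longest⁻¹ : ∀ T → IsLongestWord (select Q' T) → IsLongestWord (select Q (T ∘ to))

    open PositionIso

    iso-sym : ∀ {Q Q'} → PositionIso Q Q' → PositionIso Q' Q
    iso-sym I = record { to = from I ; from = to I ; from-to = to-from I ; to-from = from-to I ; longest = longest⁻¹ I ; longest⁻¹ = longest I }

    iso-trans : ∀ {Q Q' Q''} → PositionIso Q Q' → PositionIso Q' Q'' → PositionIso Q Q''
    iso-trans I J = record
      { to = to J ∘ to I ; from = from I ∘ from J
      ; from-to = λ i → trans (cong (from I) (from-to J (to I i))) (from-to I i)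
      ; to-from = λ j → trans (cong (to J) (to-from I (from J j))) (to-from J j)
      ; longest = λ T l → longest J (T ∘ from I) (longest I T l)
      ; longest⁻¹ = λ T l → longest⁻¹ I (T ∘ to J) (longest⁻¹ J T l) }

    select-cong : ∀ Q {T T'} → (∀ i → T i ≡ T' i) → select Q T ≡ select Q T'
    select-cong []      e = refl
    select-cong (x ∷ Q) e rewrite e zero = cong (λ u → if _ then x ∷ u else u) (select-cong Q (e ∘ suc))

    record CommIso (Q Q' : Word n) : Set where
      field
        to      : Fin (length Q) → Fin (length Q')
        from    : Fin (length Q') → Fin (length Q)
        from-to : ∀ i → from (to i) ≡ i
        to-from : ∀ j → to (from j) ≡ j
        selects : ∀ T → select Q T ~ select Q' (T ∘ from)

    commIso : ∀ {Q Q'} → Q ~ Q' → CommIso Q Q'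
    commIso ~refl = record { to = λ i → i ; from = λ i → i ; from-to = λ _ → refl ; to-from = λ _ → refl ; selects = λ _ → ~refl }
    commIso (~trans p q) = record
      { to = J.to ∘ I.to ; from = I.from ∘ J.from
      ; from-to = λ i → trans (cong I.from (J.from-to (I.to i))) (I.from-to i)
      ; to-from = λ j → trans (cong J.to (I.to-from (J.from j))) (J.to-from j)
      ; selects = λ T → ~trans (I.selects T) (J.selects (T ∘ I.from)) }
      where
      module I = CommIso (commIso p)
      module J = CommIso (commIso q)
    commIso (~cons x {u} {v} p) = record
      { to = lift I.to ; from = lift I.from
      ; from-to = λ { zero → refl ; (suc i) → cong suc (I.from-to i) }
      ; to-from = λ { zero → refl ; (suc i) → cong suc (I.to-from i) }
      ; selects = sel }
      where
      module I = CommIso (commIso p)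
      lift : ∀ {a b} → (Fin a → Fin b) → Fin (suc a) → Fin (suc b)
      lift f zero    = zero
      lift f (suc i) = suc (f i)
      sel : ∀ T → select (x ∷ u) T ~ select (x ∷ v) (T ∘ lift I.from)
      sel T with T zero
      ... | true  = ~cons x (I.selects (T ∘ suc))
      ... | false = I.selects (T ∘ suc)
    commIso (~swap {s} {t} q e) = record
      { to = flip ; from = flip ; from-to = flip-flip ; to-from = flip-flip ; selects = sel }
      where
      flip : Fin (suc (suc (length q))) → Fin (suc (suc (length q)))
      flip zero          = suc zero
      flip (suc zero)    = zero
      flip (suc (suc i)) = suc (suc i)
      flip-flip : ∀ i → flip (flip i) ≡ i
      flip-flip zero          = refl
      flip-flip (suc zero)    = refl
      flip-flip (suc (suc i)) = refl
      sel : ∀ T → select (s ∷ t ∷ q) T ~ select (t ∷ s ∷ q) (T ∘ flip)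
      sel T with T zero | T (suc zero)
      ... | true  | true  = ~swap _ e
      ... | true  | false = ~refl
      ... | false | true  = ~refl
      ... | false | false = ~refl

    ~⇒iso : ∀ {Q Q'} → Q ~ Q' → PositionIso Q Q'
    ~⇒iso {Q} {Q'} p = record
      { to = I.to ; from = I.from ; from-to = I.from-to ; to-from = I.to-from
      ; longest = λ T → IsLongest-resp-~ (I.selects T)
      ; longest⁻¹ = λ T l → IsLongest-resp-~ (~sym (I.selects (T ∘ I.to)))
          (subst IsLongestWord (select-cong Q' λ j → cong T (sym (I.to-from j))) l) }
      where module I = CommIso (commIso p)

    module _ (y : Fin n) where

      inject : ∀ Q → Fin (length Q) → Fin (length (Q ∷ʳ y))
      inject (x ∷ Q) zero    = zero
      inject (x ∷ Q) (suc i) = suc (inject Q i)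

      final : ∀ Q → Fin (length (Q ∷ʳ y))
      final []      = zero
      final (x ∷ Q) = suc (final Q)

      rotate : ∀ Q → Fin (suc (length Q)) → Fin (length (Q ∷ʳ y))
      rotate Q zero    = final Q
      rotate Q (suc i) = inject Q i

      -- When a letter is put in front of `Q`, the rotated letter keeps index zero and all others
      -- move past the new letter at index one.
      bump : ∀ {k} → Fin (suc k) → Fin (suc (suc k))
      bump zero    = zero
      bump (suc i) = suc (suc i)

      unrotate : ∀ Q → Fin (length (Q ∷ʳ y)) → Fin (suc (length Q))
      unrotate []      i       = i
      unrotate (x ∷ Q) zero    = suc zero
      unrotate (x ∷ Q) (suc i) = bump (unrotate Q i)

      unrotate-final : ∀ Q → unrotate Q (final Q) ≡ zero
      unrotate-final []      = refl
      unrotate-final (x ∷ Q) = cong bump (unrotate-final Q)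

      unrotate-inject : ∀ Q i → unrotate Q (inject Q i) ≡ suc i
      unrotate-inject (x ∷ Q) zero    = refl
      unrotate-inject (x ∷ Q) (suc i) = cong bump (unrotate-inject Q i)

      unrotate-rotate : ∀ Q i → unrotate Q (rotate Q i) ≡ i
      unrotate-rotate Q zero    = unrotate-final Q
      unrotate-rotate Q (suc i) = unrotate-inject Q i

      rotate-bump : ∀ x Q i → rotate (x ∷ Q) (bump i) ≡ suc (rotate Q i)
      rotate-bump x Q zero    = refl
      rotate-bump x Q (suc i) = refl

      rotate-unrotate : ∀ Q j → rotate Q (unrotate Q j) ≡ j
      rotate-unrotate []      zero    = refl
      rotate-unrotate (x ∷ Q) zero    = refl
      rotate-unrotate (x ∷ Q) (suc j) = trans (rotate-bump x Q (unrotate Q j)) (cong suc (rotate-unrotate Q j))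

      select-∷ʳ : ∀ Q T → select (Q ∷ʳ y) T ≡ select Q (T ∘ inject Q) ++ (if T (final Q) then y ∷ [] else [])
      select-∷ʳ []      T = refl
      select-∷ʳ (x ∷ Q) T with T zero
      ... | true  = cong (x ∷_) (select-∷ʳ Q (T ∘ suc))
      ... | false = select-∷ʳ Q (T ∘ suc)

      rotation-iso : ∀ s Q → (∀ u → IsLongestWord (s ∷ u) → IsLongestWord (u ∷ʳ y))
                   → (∀ u → IsLongestWord (u ∷ʳ y) → IsLongestWord (s ∷ u)) → PositionIso (s ∷ Q) (Q ∷ʳ y)
      rotation-iso s Q there' back = record
        { to = rotate Q ; from = unrotate Q ; from-to = unrotate-rotate Q ; to-from = rotate-unrotate Q
        ; longest = λ T l → subst IsLongestWord (sym (trans (select-∷ʳ Q (T ∘ unrotate Q))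
            (cong₂ (λ u b → u ++ (if b then y ∷ [] else [])) (select-cong Q (cong T ∘ unrotate-inject Q)) (cong T (unrotate-final Q))))) (forward T l)
        ; longest⁻¹ = λ T l → backward (T ∘ rotate Q) (subst IsLongestWord (select-∷ʳ Q T) l) }
        where
        forward : ∀ T → IsLongestWord (select (s ∷ Q) T) → IsLongestWord (select Q (T ∘ suc) ++ (if T zero then y ∷ [] else []))
        forward T l with T zero
        ... | true  = there' _ l
        ... | false = subst IsLongestWord (sym (++-identityʳ _)) l
        backward : ∀ T → IsLongestWord (select Q (T ∘ suc) ++ (if T zero then y ∷ [] else [])) → IsLongestWord (select (s ∷ Q) T)
        backward T l with T zero
        ... | true  = back _ l
        ... | false = subst IsLongestWord (++-identityʳ _) l

    simplicial : ∀ {Q Q'} → PositionIso Q Q' → SimplicialIso (SubwordFace Q) (SubwordFace Q')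
    simplicial {Q} {Q'} I = to I , from I , vertex I , vertex (iso-sym I) , (λ i _ → from-to I i) , (λ j _ → to-from I j) ,
                            face I , face (iso-sym I)
      where
      ≡true : ∀ {b} → b ≡ false → b ≡ true → ⊥
      ≡true refl ()
      vertex : ∀ {Q Q'} (I : PositionIso Q Q') i → SubwordFace Q (singleton i) → SubwordFace Q' (singleton (to I i))
      vertex I i (T , h , l) = T ∘ from I , (λ j Tj → dec-no' j (h (from I j) Tj)) , longest I T l
        where
        dec-no' : ∀ j → does (i ≟ from I j) ≡ false → does (to I i ≟ j) ≡ false
        dec-no' j e with to I i ≟ j
        ... | no _     = refl
        ... | yes refl = ⊥-elim (≡true e (dec-true (i ≟ from I (to I i)) (sym (from-to I i))))
      face : ∀ {Q Q'} (I : PositionIso Q Q') P → SubwordFace Q P → SubwordFace Q' (image (to I) P)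
      face I P (T , h , l) = T ∘ from I , disjoint , longest I T l
        where
        disjoint : ∀ j → T (from I j) ≡ true → image (to I) P j ≡ false
        disjoint j Tj with any? (λ i → P i ∧ does (to I i ≟ j) Data.Bool.≟ true)
        ... | no _ = refl
        ... | yes (i , e) = ⊥-elim (hit e)
          where
          hit : (P i ∧ does (to I i ≟ j)) ≡ true → ⊥
          hit e with P i in Pi | to I i ≟ j
          hit () | false | _
          hit () | true  | no _
          hit e  | true  | yes refl = ≡true (trans (cong P (sym (from-to I i))) (h (from I (to I i)) Tj)) Pi

  module Rotation {n : ℕ} (M : CoxeterMatrix n) (_≈?_ : ∀ u v → Dec (Coxeter._≈_ M u v))
                  (w₀ : Word n) (long : Coxeter.IsLongestWord M w₀) where
    open CoxeterMatrix M
    open Coxeter M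
    open Group M
    open Decidable _≈?_
    open Exchange M _≈?_
    open Rep M
    open Positivity M _≈?_
    open Skip M _≈?_
    open Greedy M _≈?_
    open Longest w₀ long
    open Commutation M

    act-commuting : ∀ u {s t} → m s t ≡ 2 → act (u ∷ʳ s) (e t one) ≋ act u (e t one)
    act-commuting u {s} {t} mst = ≋-trans (λ r i → cong (λ v → v r i) (act-++ u (s ∷ []) (e t one)))
      (act-cong u (≋-trans (act₁-e-other one s≢t) λ r i → trans (cong (λ z → e t one r i ℤ.+ z) (vanish r i)) (ℤ.+-identityʳ _)))
      where
      s≢t : s ≢ t
      s≢t refl with trans (sym (m-diag s)) mst
      ... | ()
      vanish : ∀ r i → e s (path (width s t) one) r i ≡ 0ℤ
      vanish r i with r ≟ s
      ... | yes _ = trans (cong (λ k → path (k ℕ.∸ 2) one i) mst) (path-trivial one i)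
      ... | no _  = refl

    -- `s` fixes α_t, so taking `s` does not affect the sign that decides about `t`. Greedy runs
    -- thus decide on two commuting letters independently of their order.
    commuting-ascent : ∀ {u s t} → m s t ≡ 2 → Reduced (u ∷ʳ s) → Reduced (u ∷ʳ t) → Reduced ((u ∷ʳ s) ∷ʳ t)
    commuting-ascent {u} mst rs rt = ascent rs λ np → not-NonPos rt (λ _ → ℤ.≤-refl) (NonPos-resp (act-commuting u mst) np)

    commuting-ascent⁻¹ : ∀ {u s t} → m s t ≡ 2 → Reduced ((u ∷ʳ s) ∷ʳ t) → Reduced (u ∷ʳ t)
    commuting-ascent⁻¹ {u} {s} {t} mst rst = ascent (Reduced-prefix u (Reduced-prefix (u ∷ʳ s) rst))
      λ np → not-NonPos rst (λ _ → ℤ.≤-refl) (NonPos-resp (≋-sym (act-commuting u mst)) np)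

    greedy-~ : ∀ {D D'} u → D ~ D' → greedy u D ~ greedy u D'
    greedy-~ u ~refl        = ~refl
    greedy-~ u (~trans p q) = ~trans (greedy-~ u p) (greedy-~ u q)
    greedy-~ u (~cons x p) with Reduced? (u ∷ʳ x)
    ... | yes _ = ~cons x (greedy-~ (u ∷ʳ x) p)
    ... | no _  = greedy-~ u p
    greedy-~ u (~swap {s} {t} q e) with Reduced? (u ∷ʳ s) | Reduced? (u ∷ʳ t)
    ... | yes rs | yes rt = subst₂ _~_ (cong (s ∷_) (sym (greedy-take q (commuting-ascent e rs rt))))
            (cong (t ∷_) (sym (trans (greedy-take q (commuting-ascent (trans (m-sym t s) e) rt rs))
              (cong (s ∷_) (greedy-cong q swapped same-length))))) (~swap _ e)
      where
      swapped : ((u ∷ʳ t) ∷ʳ s) ≈ ((u ∷ʳ s) ∷ʳ t)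
      swapped = ≈trans (≈-reflexive (++-assoc u (t ∷ []) (s ∷ []))) (≈trans (++-congˡ u (~⇒≈ (~swap [] (trans (m-sym t s) e))))
                (≈-reflexive (sym (++-assoc u (s ∷ []) (t ∷ [])))))
      same-length : length ((u ∷ʳ t) ∷ʳ s) ≡ length ((u ∷ʳ s) ∷ʳ t)
      same-length = trans (length-∷ʳ (u ∷ʳ t) s) (trans (cong suc (trans (length-∷ʳ u t) (sym (length-∷ʳ u s)))) (sym (length-∷ʳ (u ∷ʳ s) t)))
    ... | yes rs | no ¬rt = ~reflexive (trans (cong (s ∷_) (greedy-skip q (¬rt ∘ commuting-ascent⁻¹ e))) (sym (greedy-take q rs)))
    ... | no ¬rs | yes rt = ~reflexive (trans (greedy-take q rt) (cong (t ∷_) (sym (greedy-skip q (¬rs ∘ commuting-ascent⁻¹ (trans (m-sym t s) e))))))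
    ... | no ¬rs | no ¬rt = ~reflexive (trans (greedy-skip q ¬rt) (sym (greedy-skip q ¬rs)))

    -- Greedy runs from h and from s h take the same letters until a letter y satisfies s h = h y: it is taken
    -- only by the run from h, and from then on the states agree.
    compare : ∀ {s c D u h} → Follows c D → c ↭ allFin n → Aligned c u → Reduced u → Reduced h
      → u ≈ (s ∷ h) → length u ≡ suc (length h)
      → length (u ++ greedy u D) ≡ N → length (h ++ greedy h D) ≡ N
      → ∃ λ a → ∃₂ λ y b → greedy u D ≡ a ++ b × greedy h D ≡ a ++ y ∷ b × All (λ q → m y q ≡ 2) b
    -- The word cannot end before `y` is met: both runs finish with `N` letters although their
    -- states differ by one.
    compare {u = u} {h} [] p al ru rh u≈ lu full fullh = ⊥-elim (1+n≢n (begin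
        suc (length h)        ≡⟨ lu ⟨
        length u              ≡⟨ cong length (++-identityʳ u) ⟨
        length (u ++ [])      ≡⟨ trans full (sym fullh) ⟩
        length (h ++ [])      ≡⟨ cong length (++-identityʳ h) ⟩
        length h              ∎))
      where open ≡-Reasoning
    compare {s} {u = u} {h} (_∷_ x {c} {D} F) p al ru rh u≈ lu full fullh with Reduced? (u ∷ʳ x) | Reduced? (h ∷ʳ x)
    -- If `x` shortens `h`, then `u x = s h x` has a word shorter than `u x`.
    ... | yes rux | no ¬rhx = ⊥-elim (shorter (descentʳ rh ¬rhx))
      where
      shorter : (Σ (Word n) λ v → (v ∷ʳ x) ≈ h × suc (length v) ≡ length h) → ⊥
      shorter (v , vx≈h , l) = 1+n≰n (≤-trans (n≤1+n _) (subst₂ _≤_ (trans (length-∷ʳ u x) (cong suc lu)) l (rux (s ∷ v) (≈sym ux≈sv))))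
        where
        ux≈sv : (u ∷ʳ x) ≈ (s ∷ v)
        ux≈sv = ≈trans (++-congʳ (x ∷ []) (≈trans u≈ (∷-cong s (≈sym vx≈h)))) (∷ʳ-square-cancel (s ∷ v) x)
    -- `s h` and `h x` are reduced but `s h x` is not, so the exchanged letter is `x` itself and
    -- `s h = h x`. Hence `x` is the letter y, and after taking it the second run is in state `u`.
    ... | no ¬rux | yes rhx with exchange-++ s h (x ∷ []) (Reduced-resp-≈ u≈ (≤-reflexive (sym lu)) ru) rhx
                                (λ r → ¬rux (Reduced-resp-≈ (≈sym (++-congʳ (x ∷ []) u≈)) (≤-reflexive (trans (length-∷ʳ u x) (trans (cong suc lu) (cong suc (sym (length-∷ʳ h x)))))) r))
    ...   | [] , _ , _ , refl , sh≈hx = [] , x , greedy u D , refl ,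
              cong (x ∷_) (greedy-cong D hx≈u (trans (length-∷ʳ h x) (sym lu))) ,
              All.map proj₂ (skip-commuting p ru ¬rux al [] (greedy u D) [] (greedy-reduced u D ru))
        where
        hx≈u : (h ∷ʳ x) ≈ u
        hx≈u = ≈sym (≈trans u≈ (≈trans (≈-reflexive (cong (s ∷_) (sym (++-identityʳ h)))) sh≈hx))
    ...   | _ ∷ []    , _ , _ , () , _
    ...   | _ ∷ _ ∷ _ , _ , _ , () , _
    compare {s} {u = u} {h} (_∷_ x {c} {D} F) p al ru rh u≈ lu full fullh | yes rux | yes rhx
      with compare F (↭-trans (++-comm c (x ∷ [])) p) (Aligned-take p rux al) rux rhx (++-congʳ (x ∷ []) u≈)
             (trans (length-∷ʳ u x) (trans (cong suc lu) (cong suc (sym (length-∷ʳ h x)))))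
             (trans (cong length (++-assoc u (x ∷ []) _)) full) (trans (cong length (++-assoc h (x ∷ []) _)) fullh)
    ... | a , y , b , e₁ , e₂ , com = x ∷ a , y , b , cong (x ∷_) e₁ , cong (x ∷_) e₂ , com
    compare {s} {u = u} {h} (_∷_ x {c} {D} F) p al ru rh u≈ lu full fullh | no ¬rux | no ¬rhx =
      compare F (↭-trans (++-comm c (x ∷ [])) p) (Aligned-skip p ru ¬rux al) ru rh u≈ lu full fullh

    sorting : Word n → Word n
    sorting c = greedy [] (c ^^ N)

    Reduced-[] : Reduced []
    Reduced-[] _ _ = z≤n

    Reduced-[x] : ∀ x → Reduced (x ∷ [])
    Reduced-[x] x = ascent Reduced-[] λ np → not-1≤0 (subst (λ f → f 0 ℤ.≤ 0ℤ) (e-same x one) (np x 0))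
      where
      not-1≤0 : ¬ ℤ.1ℤ ℤ.≤ 0ℤ
      not-1≤0 (ℤ.+≤+ ())

    Complete : Word n → Set
    Complete c = ∀ s → s ∈ c

    ↭-complete : ∀ {c} → c ↭ allFin n → Complete c
    ↭-complete p s = ∈-resp-↭ (↭-sym p) (∈-allFin s)

    sorting-length : ∀ {c} → Complete c → length (sorting c) ≡ N
    sorting-length all∈ = greedy-complete all∈ N [] Reduced-[] ≤-refl

    -- The spare copy makes room for a rotation: (s d)^(N+1) = s (d s)^N d still contains `N` full
    -- copies of the rotated word.
    sorting-stable : ∀ {c} → Complete c → greedy [] (c ^^ suc N) ≡ sorting c
    sorting-stable {c} all∈ = begin
      greedy [] (c ^^ suc N)                       ≡⟨ cong (greedy []) (^^-suc c N) ⟩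
      greedy [] (c ^^ N ++ c)                      ≡⟨ greedy-++ [] (c ^^ N) c ⟩
      sorting c ++ greedy (sorting c) c            ≡⟨ cong (sorting c ++_) (greedy-full c (sorting-length all∈)) ⟩
      sorting c ++ []                              ≡⟨ ++-identityʳ (sorting c) ⟩
      sorting c                                    ∎
      where open ≡-Reasoning

    -- After its first letter, the run for `s d` reads copies of `d s` from state `s`; the run for
    -- `d s` reads the same word from the empty state. This is `compare` with `h = []`.
    sorting-rotation : ∀ s d → s ∷ d ↭ allFin n
      → ∃ λ a → ∃₂ λ y b → sorting (s ∷ d) ≡ s ∷ a ++ b × sorting (d ∷ʳ s) ≡ a ++ y ∷ b × All (λ q → m y q ≡ 2) b
    sorting-rotation s d p with compare {s} {D = c' ^^ N} {u = s ∷ []} {h = []} (Follows-^^ c' N) p' (Aligned-take {u = []} p (Reduced-[x] s) (Aligned-[] (s ∷ d)))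
                                  (Reduced-[x] s) Reduced-[] ≈refl refl full-s (sorting-length (↭-complete p'))
      where
      c' = d ∷ʳ s
      p' : c' ↭ allFin n
      p' = ↭-trans (++-comm d (s ∷ [])) p
      full-s : length (s ∷ [] ++ greedy (s ∷ []) (c' ^^ N)) ≡ N
      full-s = greedy-complete (↭-complete p') N (s ∷ []) (Reduced-[x] s) (n≤1+n N)
    ... | a , y , b , e₁ , e₂ , com = a , y , b , trans peel (cong (s ∷_) e₁) , e₂ , com
      where
      c' = d ∷ʳ s
      p' : c' ↭ allFin n
      p' = ↭-trans (++-comm d (s ∷ [])) p
      v = greedy (s ∷ []) (c' ^^ N)
      full-s : length (s ∷ v) ≡ N
      full-s = greedy-complete (↭-complete p') N (s ∷ []) (Reduced-[x] s) (n≤1+n N)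
      open ≡-Reasoning
      peel : sorting (s ∷ d) ≡ s ∷ v
      peel = begin
        sorting (s ∷ d)                           ≡⟨ sorting-stable (↭-complete p) ⟨
        greedy [] ((s ∷ d) ^^ suc N)              ≡⟨ cong (greedy []) (trans (^^-suc (s ∷ d) N) (^^-rotate s d d N)) ⟩
        greedy [] (s ∷ c' ^^ N ++ d)              ≡⟨ greedy-take {[]} (c' ^^ N ++ d) (Reduced-[x] s) ⟩
        s ∷ greedy (s ∷ []) (c' ^^ N ++ d)        ≡⟨ cong (s ∷_) (greedy-++ (s ∷ []) (c' ^^ N) d) ⟩
        s ∷ v ++ greedy (s ∷ v) d                 ≡⟨ cong (λ t → s ∷ v ++ t) (greedy-full d full-s) ⟩
        s ∷ v ++ []                               ≡⟨ cong (s ∷_) (++-identityʳ v) ⟩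
        s ∷ v                                     ∎

    sorting-longest : ∀ {c} → Complete c → IsLongestWord (sorting c)
    sorting-longest {c} all∈ = Reduced⇒IsLongest (greedy-reduced [] (c ^^ N) Reduced-[]) (sorting-length all∈)

    multi-~ : ∀ k {c c'} → c ~ c' → PositionIso (multiWord k c (sorting c)) (multiWord k c' (sorting c'))
    multi-~ k {c} {c'} p = ~⇒iso (~trans (~-++ʳ (sorting c) (~-^^ k p)) (~-++ˡ (c' ^^ k) (greedy-~ [] (~-^^ N p))))

    multi-rotate : ∀ k s d → s ∷ d ↭ allFin n
                 → PositionIso (multiWord k (s ∷ d) (sorting (s ∷ d))) (multiWord k (d ∷ʳ s) (sorting (d ∷ʳ s)))
    multi-rotate k s d p with sorting-rotation s d p
    ... | a , y , b , e₁ , e₂ , com =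
      subst₂ PositionIso (sym left) refl (iso-trans (rotation-iso y s Q forward backward) (~⇒iso right))
      where
      c' = d ∷ʳ s
      p' : c' ↭ allFin n
      p' = ↭-trans (++-comm d (s ∷ [])) p
      Q = c' ^^ k ++ a ++ b
      left : multiWord k (s ∷ d) (sorting (s ∷ d)) ≡ s ∷ Q
      left = trans (cong ((s ∷ d) ^^ k ++_) e₁) (^^-rotate s d (a ++ b) k)
      aby~ : ((a ++ b) ∷ʳ y) ~ sorting c'
      aby~ = ~trans (~reflexive (++-assoc a b (y ∷ []))) (~trans (~-++ˡ a (~sym (~trans (~reflexive (cong (y ∷_) (sym (++-identityʳ b)))) (~-move b [] com)))) (~reflexive (sym e₂)))
      right : (Q ∷ʳ y) ~ multiWord k c' (sorting c')
      right = ~trans (~reflexive (++-assoc (c' ^^ k) (a ++ b) (y ∷ []))) (~-++ˡ (c' ^^ k) aby~)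
      sab≈ : (s ∷ a ++ b) ≈ w₀
      sab≈ = IsLongest-≈ (subst IsLongestWord e₁ (sorting-longest (↭-complete p)))
      aby≈ : ((a ++ b) ∷ʳ y) ≈ w₀
      aby≈ = ≈trans (~⇒≈ aby~) (IsLongest-≈ (sorting-longest (↭-complete p')))
      -- `a b y` and `s a b` both spell `w₀`, so s w₀ = s a b y = w₀ y.
      sw≈wy : (s ∷ w₀) ≈ (w₀ ∷ʳ y)
      sw≈wy = ≈trans (∷-cong s (≈sym aby≈)) (++-congʳ (y ∷ []) sab≈)
      forward : ∀ u → IsLongestWord (s ∷ u) → IsLongestWord (u ∷ʳ y)
      forward u l = ≈⇒IsLongest (begin
          u ∷ʳ y                   ≈⟨ square-cancel s _ ⟨
          s ∷ s ∷ u ∷ʳ y           ≈⟨ ∷-cong s (++-congʳ (y ∷ []) (IsLongest-≈ l)) ⟩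
          s ∷ w₀ ∷ʳ y              ≈⟨ ∷-cong s sw≈wy ⟨
          s ∷ s ∷ w₀               ≈⟨ square-cancel s w₀ ⟩
          w₀                       ∎) (trans (length-∷ʳ u y) (IsLongest-length l))
        where open ≈-Reasoning
      backward : ∀ u → IsLongestWord (u ∷ʳ y) → IsLongestWord (s ∷ u)
      backward u l = ≈⇒IsLongest (begin
          s ∷ u                    ≈⟨ ∷ʳ-square-cancel (s ∷ u) y ⟨
          (s ∷ u ∷ʳ y) ∷ʳ y        ≈⟨ ++-congʳ (y ∷ []) (∷-cong s (IsLongest-≈ l)) ⟩
          (s ∷ w₀) ∷ʳ y            ≈⟨ ++-congʳ (y ∷ []) sw≈wy ⟩
          (w₀ ∷ʳ y) ∷ʳ y           ≈⟨ ∷ʳ-square-cancel w₀ y ⟩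
          w₀                       ∎) (trans (sym (length-∷ʳ u y)) (IsLongest-length l))
        where open ≈-Reasoning

open Isomorphisms

-- The Coxeter graph is a forest, and rotations connect all Coxeter words.

module Forests where
  open import Data.Nat as ℕ using (_+_; _≤_; _<_; s≤s⁻¹)
  open import Data.Nat.Properties hiding (_≟_)
  import Data.Integer as ℤ
  open import Data.Integer using (0ℤ; 1ℤ)
  import Data.Integer.Properties as ℤ

  covering-↭ : {A : Set} (ys xs : List A) → Unique ys → (∀ y → y ∈ ys → y ∈ xs) → length xs ≤ length ys → xs ↭ ys
  covering-↭ []       []       _          _   _ = ↭-refl
  covering-↭ (y ∷ ys) xs (y≢ys ∷ uniq) sub l with ∈-∃++ (sub y (here refl))
  ... | a , b , refl = ↭-trans (shift y a b) (prep y (covering-↭ ys (a ++ b) uniq sub' (s≤s⁻¹ (subst (_≤ suc (length ys)) (↭-length (shift y a b)) l))))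
    where
    sub' : ∀ z → z ∈ ys → z ∈ a ++ b
    sub' z z∈ys with ∈-resp-↭ (shift y a b) (sub z (there z∈ys))
    ... | here refl = contradiction refl (All.lookup y≢ys z∈ys)
    ... | there z∈  = z∈

  Unique-++-disjoint : {A : Set} (xs : List A) {ys : List A} {p : A} → Unique (xs ++ ys) → p ∈ xs → p ∉ ys
  Unique-++-disjoint (x ∷ xs) (x≢ ∷ _) (here refl) p∈ys = All.lookup x≢ (∈-++⁺ʳ xs p∈ys) refl
  Unique-++-disjoint (x ∷ xs) (_ ∷ u)  (there p∈)  p∈ys = Unique-++-disjoint xs u p∈ p∈ys

  module Forest {n : ℕ} (M : CoxeterMatrix n) (_≈?_ : ∀ u v → Dec (Coxeter._≈_ M u v))
                (w₀ : Word n) (long : Coxeter.IsLongestWord M w₀) where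
    open CoxeterMatrix M
    open Coxeter M
    open Group M
    open Rep M
    open Positivity M _≈?_
    open Greedy M _≈?_
    open Longest w₀ long
    open Commutation M
    open Rotation M _≈?_ w₀ long
    open import Data.List.Membership.DecPropositional (_≟_ {n}) using (_∈?_)

    OnlyDescent : Word n → Fin n → Set
    OnlyDescent u x = Reduced u × (∀ z → z ≢ x → Reduced (u ∷ʳ z))

    wide : ∀ {x y} → 3 ≤ m x y → 1 ≤ width x y
    wide = ∸-monoˡ-≤ 2

    1≰0 : ¬ 1ℤ ℤ.≤ 0ℤ
    1≰0 (ℤ.+≤+ ())

    act-∷ʳ-e : ∀ u {x z} f → x ≢ z → act (u ∷ʳ x) (e z f) ≋ act u (e z f) ⊕ act u (e x (path (width x z) f))
    act-∷ʳ-e u {x} {z} f x≢z = ≋-trans (λ r i → cong (λ v → v r i) (act-++ u (x ∷ []) (e z f)))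
      (≋-trans (act-cong u (act₁-e-other f x≢z)) (act-⊕ u (e z f) (e x (path (width x z) f))))

    onlyDescent-start : ∀ y → OnlyDescent (y ∷ []) y
    onlyDescent-start y = Reduced-[x] y , λ z z≢y → ascent (Reduced-[x] y) λ np →
      1≰0 (subst (λ f → f 0 ℤ.≤ 0ℤ) (e-same z one)
        (⊕-NonPosˡ {e z one} (e-NonNeg y (path-≥0 (width y z) one≥0)) (NonPos-resp (act-∷ʳ-e [] one (z≢y ∘ sym)) np) z 0))

    -- For z other than y the image of α_z gains only a positive summand from `x`. For z = y the
    -- image is v (g α_x) + v ((h - 1) α_y). Here h ≥ 1, because across an edge with m ≥ 3 walking
    -- forth and back returns at least the original coefficient.
    onlyDescent-step : ∀ {v y x} → OnlyDescent (v ∷ʳ y) y → Reduced (v ∷ʳ x) → x ≢ y → 3 ≤ m y x → OnlyDescent ((v ∷ʳ y) ∷ʳ x) x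
    onlyDescent-step {v} {y} {x} (rvy , asc) rvx x≢y 3≤m = rvyx , extend'
      where
      rvyx : Reduced ((v ∷ʳ y) ∷ʳ x)
      rvyx = asc x x≢y
      g = path (width x y) one
      g≥1 : ∀ i → 1ℤ ℤ.≤ g i
      g≥1 = path-≥1 (width x y) (subst (1 ≤_) (width-sym y x) (wide 3≤m)) λ _ → ℤ.≤-refl
      h = path (width y x) g
      h≥1 : ∀ i → 1ℤ ℤ.≤ h i
      h≥1 = path-≥1 (width y x) (wide 3≤m) g≥1
      h-1 : Seq
      h-1 i = h i ℤ.- 1ℤ
      back-to-v : act (v ∷ʳ y) (e y one) ⊕ act (v ∷ʳ y) (e x g) ≋ act v (e x g) ⊕ act v (e y h-1)
      back-to-v r i = begin
        act (v ∷ʳ y) (e y one) r i ℤ.+ act (v ∷ʳ y) (e x g) r i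
          ≡⟨ cong₂ ℤ._+_ (trans (cong (λ w → w r i) (act-++ v (y ∷ []) (e y one))) (trans (act-cong v (act₁-e-same y one) r i) (act-⊖ v (e y one) r i)))
                         (act-∷ʳ-e v g (x≢y ∘ sym) r i) ⟩
        ℤ.- act v (e y one) r i ℤ.+ (act v (e x g) r i ℤ.+ act v (e y h) r i)
          ≡⟨ regroup (act v (e y one) r i) (act v (e x g) r i) (act v (e y h) r i) ⟩
        act v (e x g) r i ℤ.+ (act v (e y h) r i ℤ.+ ℤ.- act v (e y one) r i)
          ≡⟨ cong (λ t → act v (e x g) r i ℤ.+ t) (trans (sym (trans (act-⊕ v (e y h) (⊖ e y one) r i) (cong (λ t → act v (e y h) r i ℤ.+ t) (act-⊖ v (e y one) r i))))
               (act-cong v split r i)) ⟩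
        act v (e x g) r i ℤ.+ act v (e y h-1) r i ∎
        where
        open ≡-Reasoning
        open import Data.Integer.Tactic.RingSolver using (solve-∀)
        regroup : ∀ a b c → ℤ.- a ℤ.+ (b ℤ.+ c) ≡ b ℤ.+ (c ℤ.+ ℤ.- a)
        regroup = solve-∀
        split : e y h ⊕ (⊖ e y one) ≋ e y h-1
        split r i with r ≟ y
        ... | yes _ = refl
        ... | no _  = refl
      extend' : ∀ z → z ≢ x → Reduced (((v ∷ʳ y) ∷ʳ x) ∷ʳ z)
      extend' z z≢x = ascent rvyx λ np → impossible (NonPos-resp (act-∷ʳ-e (v ∷ʳ y) one (z≢x ∘ sym)) np)
        where
        impossible : ¬ NonPos (act (v ∷ʳ y) (e z one) ⊕ act (v ∷ʳ y) (e x (path (width x z) one)))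
        impossible np with z ≟ y
        ... | no z≢y = not-NonPos (asc z z≢y) (λ _ → ℤ.≤-refl)
                (⊕-NonPosˡ {act (v ∷ʳ y) (e z one)} (positive rvyx (path-≥0 (width x z) one≥0)) np)
        ... | yes refl = not-NonPos rvx g≥1
                (⊕-NonPosˡ {act v (e x g)} (positive rvy λ i → ℤ.i≤j⇒0≤j-i (h≥1 i)) (NonPos-resp back-to-v np))

    -- `p` is the one neighbour allowed; an isolated vertex may take any `p`.
    Leaf : Fin n → Word n → Set
    Leaf ℓ c = ∃ λ p → All (λ r → r ≡ ℓ ⊎ (r ≡ p ⊎ m ℓ r ≡ 2)) c

    leaf? : ∀ c ℓ → Dec (Leaf ℓ c)
    leaf? c ℓ = any? λ p → All.all? (λ r → (r ≟ ℓ) ⊎-dec ((r ≟ p) ⊎-dec (m ℓ r ℕ.≟ 2))) c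

    -- Without a leaf there is an infinite walk that never backtracks, and all its initial segments are reduced.
    leaf-exists : ∀ y c → y ∈ c → ∃ λ ℓ → ℓ ∈ c × Leaf ℓ c
    leaf-exists y₀ c y₀∈c with Any.any? (leaf? c) c
    ... | yes found = find found
    ... | no ¬leaf = ⊥-elim (too-long (walk N))
      where
      next : ∀ {y} → y ∈ c → ∀ p → ∃ λ x → x ∈ c × x ≢ y × x ≢ p × 3 ≤ m y x
      next {y} y∈c p with find (All.¬All⇒Any¬ (λ r → (r ≟ y) ⊎-dec ((r ≟ p) ⊎-dec (m y r ℕ.≟ 2))) c λ all → ¬leaf (Any.map (λ { refl → p , all }) y∈c))
      ... | x , x∈c , ¬x = x , x∈c , ¬x ∘ inj₁ , ¬x ∘ inj₂ ∘ inj₁ ,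
              ≤∧≢⇒< (m-offdiag y x λ { refl → ¬x (inj₁ refl) }) (¬x ∘ inj₂ ∘ inj₂ ∘ sym)
      -- `p` is the vertex visited before `y`. Not turning back to `p` is what makes `v x` reduced
      -- for the next vertex x, as `onlyDescent-step` requires; at the start `p` is a dummy.
      Walk : ℕ → Set
      Walk k = ∃ λ v → ∃₂ λ p y → y ∈ c × (∀ z → z ≢ p → Reduced (v ∷ʳ z)) × OnlyDescent (v ∷ʳ y) y × length v ≡ k
      walk : ∀ k → Walk k
      walk zero = [] , y₀ , y₀ , y₀∈c , (λ z _ → Reduced-[x] z) , onlyDescent-start y₀ , refl
      walk (suc k) with walk k
      ... | v , p , y , y∈c , asc , only , l with next y∈c p
      ...   | x , x∈c , x≢y , x≢p , 3≤m = v ∷ʳ y , y , x , x∈c , proj₂ only , onlyDescent-step only (asc x x≢p) x≢y 3≤m ,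
                trans (length-∷ʳ v y) (cong suc l)
      too-long : Walk N → ⊥
      too-long (v , _ , y , _ , _ , (r , _) , l) = 1+n≰n (subst (_≤ N) (trans (length-∷ʳ v y) (cong suc l)) (Reduced-length r))

    data Connected : Word n → Word n → Set where
      commute : ∀ {c c'} → c ~ c' → Connected c c'
      rotated : ∀ s d → Connected (s ∷ d) (d ∷ʳ s)
      csym    : ∀ {c c'} → Connected c c' → Connected c' c
      ctrans  : ∀ {c c' c''} → Connected c c' → Connected c' c'' → Connected c c''

    ~⇒↭ : ∀ {c c'} → c ~ c' → c ↭ c'
    ~⇒↭ ~refl                = ↭-refl
    ~⇒↭ (~trans p q)         = ↭-trans (~⇒↭ p) (~⇒↭ q)
    ~⇒↭ (~cons x p)          = prep x (~⇒↭ p)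
    ~⇒↭ (~swap {s} {t} q _)  = swap s t ↭-refl

    Connected⇒↭ : ∀ {c c'} → Connected c c' → c ↭ c'
    Connected⇒↭ (commute p)   = ~⇒↭ p
    Connected⇒↭ (rotated s d) = ++-comm (s ∷ []) d
    Connected⇒↭ (csym p)      = ↭-sym (Connected⇒↭ p)
    Connected⇒↭ (ctrans p q)  = ↭-trans (Connected⇒↭ p) (Connected⇒↭ q)

    module _ (ℓ p : Fin n) where

      Pendant : Word n → Set
      Pendant = All (λ r → r ≡ p ⊎ m ℓ r ≡ 2)

      commuting-part : ∀ {c} → Pendant c → p ∉ c → All (λ r → m ℓ r ≡ 2) c
      commuting-part []                  _   = []
      commuting-part (inj₁ refl ∷ _)     p∉c = contradiction (here refl) p∉c
      commuting-part (inj₂ e    ∷ rest)  p∉c = e ∷ commuting-part rest (p∉c ∘ there)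

      -- The only obstruction `p` lies on one side of `ℓ`. If it is not on the left, `ℓ` commutes to
      -- the front; otherwise `ℓ` commutes to the end and is rotated to the front.
      leaf-to-front : ∀ c₁ c₂ → Unique (c₁ ++ c₂) → Pendant (c₁ ++ c₂) → Connected (c₁ ++ ℓ ∷ c₂) (ℓ ∷ c₁ ++ c₂)
      leaf-to-front c₁ c₂ uniq pend with p ∈? c₁
      ... | no p∉c₁ = commute (~sym (~-move c₁ c₂ (commuting-part (All.++⁻ˡ c₁ pend) p∉c₁)))
      ... | yes p∈c₁ = ctrans (commute (~trans (~-++ˡ c₁ (~trans (~reflexive (cong (ℓ ∷_) (sym (++-identityʳ c₂))))
                          (~-move c₂ [] (commuting-part (All.++⁻ʳ c₁ pend) (Unique-++-disjoint c₁ uniq p∈c₁)))))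
                          (~reflexive (sym (++-assoc c₁ c₂ (ℓ ∷ []))))))
                        (csym (rotated ℓ (c₁ ++ c₂)))

      -- A rotation of `s d` lifts by moving `ℓ` to the end, then `s` behind it, and bringing `ℓ`
      -- back to the front.
      Connected-leaf : ∀ {d d'} → Connected d d' → Unique d → Pendant d → Connected (ℓ ∷ d) (ℓ ∷ d')
      Connected-leaf (commute q)   uniq pend = commute (~cons ℓ q)
      Connected-leaf (rotated s d) uniq pend = ctrans (rotated ℓ (s ∷ d)) (ctrans (rotated s (d ∷ʳ ℓ))
        (subst (λ c → Connected c (ℓ ∷ d ∷ʳ s)) (sym (++-assoc d (ℓ ∷ []) (s ∷ [])))
          (leaf-to-front d (s ∷ []) (Unique-resp-↭ σ uniq) (All-resp-↭ σ pend))))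
        where σ = ++-comm (s ∷ []) d
      Connected-leaf (csym q) uniq pend = csym (Connected-leaf q (Unique-resp-↭ σ uniq) (All-resp-↭ σ pend))
        where σ = ↭-sym (Connected⇒↭ q)
      Connected-leaf (ctrans q r) uniq pend = ctrans (Connected-leaf q uniq pend) (Connected-leaf r (Unique-resp-↭ σ uniq) (All-resp-↭ σ pend))
        where σ = Connected⇒↭ q

    connected : ∀ k {c c'} → length c ≡ k → Unique c → c ↭ c' → Connected c c'
    connected zero {[]} l uniq σ with ↭-empty-inv (↭-sym σ)
    ... | refl = commute ~refl
    connected (suc k) {c = y ∷ c} {c'} l uniq σ with leaf-exists y (y ∷ c) (here refl)
    ... | ℓ , ℓ∈c , p , leaf with ∈-∃++ ℓ∈c | ∈-∃++ (∈-resp-↭ σ ℓ∈c)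
    ...   | c₁ , c₂ , eq | c₁' , c₂' , refl = subst (λ d → Connected d (c₁' ++ ℓ ∷ c₂')) (sym eq)
        (ctrans (leaf-to-front ℓ p c₁ c₂ uniq' pend) (ctrans (Connected-leaf ℓ p (connected k l' uniq' σ') uniq' pend)
          (csym (leaf-to-front ℓ p c₁' c₂' (Unique-resp-↭ σ' uniq') (All-resp-↭ σ' pend)))))
      where
      to-front : (y ∷ c) ↭ ℓ ∷ c₁ ++ c₂
      to-front = ↭-trans (↭-reflexive eq) (shift ℓ c₁ c₂)
      σ' : c₁ ++ c₂ ↭ c₁' ++ c₂'
      σ' = drop-mid c₁ c₁' (↭-trans (↭-reflexive (sym eq)) σ)
      l' : length (c₁ ++ c₂) ≡ k
      l' = suc-injective (trans (sym (↭-length to-front)) l)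
      tail-unique : ∀ {z zs} → Unique (z ∷ zs) → Unique zs × All (z ≢_) zs
      tail-unique (z≢ ∷ u) = u , z≢
      uniq' : Unique (c₁ ++ c₂)
      uniq' = proj₁ (tail-unique (Unique-resp-↭ to-front uniq))
      weaken : ∀ {r} → ℓ ≢ r × (r ≡ ℓ ⊎ (r ≡ p ⊎ m ℓ r ≡ 2)) → r ≡ p ⊎ m ℓ r ≡ 2
      weaken (ℓ≢r , inj₁ refl) = contradiction refl ℓ≢r
      weaken (_   , inj₂ h)    = h
      pend : Pendant ℓ p (c₁ ++ c₂)
      pend = All.map weaken (All.zip (proj₂ (tail-unique (Unique-resp-↭ to-front uniq)) , All.tail (All-resp-↭ to-front leaf)))

    Connected-iso : ∀ k {c c'} → Connected c c' → c ↭ allFin n → PositionIso (multiWord k c (sorting c)) (multiWord k c' (sorting c'))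
    Connected-iso k (commute p)   σ = multi-~ k p
    Connected-iso k (rotated s d) σ = multi-rotate k s d σ
    Connected-iso k (csym p)      σ = iso-sym (Connected-iso k p (↭-trans (Connected⇒↭ p) σ))
    Connected-iso k (ctrans p q)  σ = iso-trans (Connected-iso k p σ) (Connected-iso k q (↭-trans (↭-sym (Connected⇒↭ p)) σ))

    -- Being reduced, `c` has at most n letters, so it remains to see that each letter s occurs. A
    -- word without s preserves all s-coordinates, whereas σ changes one.
    coxeterWord-↭ : ∀ {c} → IsCoxeterWord c → c ↭ allFin n
    coxeterWord-↭ {c} (σ , complete , len , c≈σ , r) = covering-↭ (allFin n) c (allFin⁺ n) (λ s _ → letters s)
        (≤-trans (r σ (≈sym c≈σ)) (≤-reflexive (trans len (sym (length-tabulate {n = n} (λ i → i))))))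
      where
      σ↭ : σ ↭ allFin n
      σ↭ = covering-↭ (allFin n) σ (allFin⁺ n) (λ s _ → subst (_∈ σ) (proj₂ (complete s)) (∈-lookup (proj₁ (complete s))))
             (≤-reflexive (trans len (sym (length-tabulate {n = n} (λ i → i)))))
      letters : ∀ s → s ∈ c
      letters s with s ∈? c
      ... | yes s∈c = s∈c
      ... | no s∉c with ∈-∃++ (∈-resp-↭ (↭-sym σ↭) (∈-allFin s))
      ...   | a , b , refl = ⊥-elim (1≢-1 (trans (sym lhs) (trans (act-resp-≈ c≈σ v s 0) rhs)))
        where
        1≢-1 : 1ℤ ≢ ℤ.- 1ℤ
        1≢-1 ()
        s∉ab : s ∉ a ++ b
        s∉ab = ∉-of-↭ (↭-trans (↭-sym (shift s a b)) σ↭)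
        -- Chosen so that `b` carries it to α_s: then s negates the s-coordinate, and neither `a`
        -- nor `b` touches that coordinate.
        v = act (reverse b) (e s one)
        s∉b⁻¹ : s ∉ reverse b
        s∉b⁻¹ s∈ = s∉ab (∈-++⁺ʳ a (Any.reverse⁻ s∈))
        lhs : act c v s 0 ≡ 1ℤ
        lhs = cong (λ f → f 0) (trans (act-∉ c v s∉c) (trans (act-∉ (reverse b) (e s one) s∉b⁻¹) (e-same s one)))
        bv : act b v ≋ e s one
        bv = ≋-trans (λ r i → cong (λ w → w r i) (sym (act-++ b (reverse b) (e s one))))
               (act-resp-≈ (≈trans (≈-reflexive (cong (b ++_) (sym (++-identityʳ (reverse b))))) (reverse-cancelʳ b [])) (e s one))
        rhs : act (a ++ s ∷ b) v s 0 ≡ ℤ.- 1ℤ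
        rhs = trans (cong (λ w → w s 0) (act-++ a (s ∷ b) v)) (trans (cong (λ f → f 0) (act-∉ a (act (s ∷ b) v) (s∉ab ∘ ∈-++⁺ˡ)))
              (trans (act₁-cong s bv s 0) (trans (act₁-e-same s one s 0) (cong (λ f → ℤ.- f 0) (e-same s one)))))

open Forests

-- The lexicographically first reduced subword is the greedy one.

module SortingWords where
  open import Data.Nat as ℕ using (_+_; _≤_; _<_; z≤n; s≤s)
  open import Data.Nat.Properties hiding (_≟_)

  module Sorting {n : ℕ} (M : CoxeterMatrix n) (_≈?_ : ∀ u v → Dec (Coxeter._≈_ M u v))
                 (w₀ : Word n) (long : Coxeter.IsLongestWord M w₀) (𝐜 : Word n) where
    open Coxeter M
    open Group M
    open Decidable _≈?_
    open Greedy M _≈?_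
    open Longest w₀ long
    open Rotation M _≈?_ w₀ long

    _≺_ : Pos 𝐜 → Pos 𝐜 → Set
    _≺_ = PosLt 𝐜

    ≺-trans : ∀ {p q r} → p ≺ q → q ≺ r → p ≺ r
    ≺-trans (<copy a)  (<copy b)  = <copy (<-trans a b)
    ≺-trans (<copy a)  (<inner b) = <copy a
    ≺-trans (<inner a) (<copy b)  = <copy b
    ≺-trans (<inner a) (<inner b) = <inner (<-trans a b)

    ≺-irrefl : ∀ {p} → ¬ p ≺ p
    ≺-irrefl (<copy a)  = <-irrefl refl a
    ≺-irrefl (<inner a) = <-irrefl refl a

    positions : ℕ → ℕ → List (Pos 𝐜)
    positions i zero    = []
    positions i (suc L) = map (i ,_) (allFin (length 𝐜)) ++ positions (suc i) L

    letters-positions : ∀ i L → map (letterAt 𝐜) (positions i L) ≡ 𝐜 ^^ L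
    letters-positions i zero    = refl
    letters-positions i (suc L) = trans (map-++ (letterAt 𝐜) (map (i ,_) (allFin (length 𝐜))) (positions (suc i) L))
      (cong₂ _++_ (trans (sym (map-∘ (allFin (length 𝐜)))) (trans (map-tabulate (λ j → j) (lookup 𝐜)) (tabulate-lookup 𝐜)))
                  (letters-positions (suc i) L))

    positions-≥ : ∀ i L → All (λ p → i ≤ proj₁ p) (positions i L)
    positions-≥ i zero    = []
    positions-≥ i (suc L) = All.++⁺ (All.map⁺ (All.universal (λ _ → ≤-refl) (allFin (length 𝐜))))
                                    (All.map (≤-trans (n≤1+n i)) (positions-≥ (suc i) L))

    positions-< : ∀ i L → All (λ p → proj₁ p < i + L) (positions i L)
    positions-< i zero    = []
    positions-< i (suc L) = All.++⁺ (All.map⁺ (All.universal (λ _ → subst (i <_) (sym (+-suc i L)) (s≤s (m≤m+n i L))) (allFin (length 𝐜))))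
                                    (All.map (λ {p} → subst (proj₁ p <_) (sym (+-suc i L))) (positions-< (suc i) L))

    positions-sorted : ∀ i L → AllPairs _≺_ (positions i L)
    positions-sorted i zero    = []
    positions-sorted i (suc L) = AllPairs.++⁺ (AllPairs.map⁺ (AllPairs.tabulate⁺-< {R = λ j k → (i , j) ≺ (i , k)} {f = λ j → j} <inner))
      (positions-sorted (suc i) L) (All.map⁺ (All.universal (λ j → All.map (<copy) (positions-≥ (suc i) L)) (allFin (length 𝐜))))

    positions-complete : ∀ i L {p} → i ≤ proj₁ p → proj₁ p < i + L → p ∈ positions i L
    positions-complete i zero    i≤p p<i = contradiction (subst (_ <_) (+-identityʳ i) p<i) (≤⇒≯ i≤p)
    positions-complete i (suc L) {p , j} i≤p p<i with m≤n⇒m<n∨m≡n i≤p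
    ... | inj₁ i<p  = ∈-++⁺ʳ (map (i ,_) (allFin (length 𝐜))) (positions-complete (suc i) L i<p (subst (p <_) (+-suc i L) p<i))
    ... | inj₂ refl = ∈-++⁺ˡ (∈-map⁺ (i ,_) (∈-allFin j))

    -- A competing subword may use copies of 𝐜 after the first `N`, so its positions need not be in
    -- the finite list; those outside it come after all of it.
    Beyond : List (Pos 𝐜) → Pos 𝐜 → Set
    Beyond D p = p ∈ D ⊎ All (_≺ p) D

    positions-beyond : ∀ L p → Beyond (positions 0 L) p
    positions-beyond L p with proj₁ p ℕ.<? L
    ... | yes p<L = inj₁ (positions-complete 0 L z≤n p<L)
    ... | no p≮L  = inj₂ (All.map (λ q<L → <copy (≤-trans q<L (≮⇒≥ p≮L))) (positions-< 0 L))

    Beyond-head : ∀ {d D p} → AllPairs _≺_ (d ∷ D) → Beyond (d ∷ D) p → p ≡ d ⊎ d ≺ p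
    Beyond-head _          (inj₁ (here e))    = inj₁ e
    Beyond-head (d≺ ∷ _)   (inj₁ (there p∈))  = inj₂ (All.lookup d≺ p∈)
    Beyond-head _          (inj₂ (d≺p ∷ _))   = inj₂ d≺p

    Beyond-tail : ∀ {d D p} → d ≺ p → Beyond (d ∷ D) p → Beyond D p
    Beyond-tail d≺p (inj₁ (here refl)) = contradiction d≺p ≺-irrefl
    Beyond-tail d≺p (inj₁ (there p∈))  = inj₁ p∈
    Beyond-tail d≺p (inj₂ (_ ∷ ≺p))    = inj₂ ≺p

    greedyPositions : Word n → List (Pos 𝐜) → List (Pos 𝐜)
    greedyPositions u []      = []
    greedyPositions u (d ∷ D) with Reduced? (u ∷ʳ letterAt 𝐜 d)
    ... | yes _ = d ∷ greedyPositions (u ∷ʳ letterAt 𝐜 d) D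
    ... | no  _ = greedyPositions u D

    greedyPositions-letters : ∀ u D → map (letterAt 𝐜) (greedyPositions u D) ≡ greedy u (map (letterAt 𝐜) D)
    greedyPositions-letters u []      = refl
    greedyPositions-letters u (d ∷ D) with Reduced? (u ∷ʳ letterAt 𝐜 d)
    ... | yes _ = cong (letterAt 𝐜 d ∷_) (greedyPositions-letters (u ∷ʳ letterAt 𝐜 d) D)
    ... | no  _ = greedyPositions-letters u D

    greedyPositions-All : ∀ {P : Pos 𝐜 → Set} u {D} → All P D → All P (greedyPositions u D)
    greedyPositions-All u []                = []
    greedyPositions-All u {d ∷ D} (h ∷ hs) with Reduced? (u ∷ʳ letterAt 𝐜 d)
    ... | yes _ = h ∷ greedyPositions-All (u ∷ʳ letterAt 𝐜 d) hs
    ... | no  _ = greedyPositions-All u hs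

    greedyPositions-sorted : ∀ u {D} → AllPairs _≺_ D → AllPairs _≺_ (greedyPositions u D)
    greedyPositions-sorted u []               = []
    greedyPositions-sorted u {d ∷ D} (h ∷ hs) with Reduced? (u ∷ʳ letterAt 𝐜 d)
    ... | yes _ = greedyPositions-All (u ∷ʳ letterAt 𝐜 d) h ∷ greedyPositions-sorted (u ∷ʳ letterAt 𝐜 d) hs
    ... | no  _ = greedyPositions-sorted u hs

    -- If greedy takes `d`, then `ps` cannot start before `d` and, being lexicographically at most
    -- the greedy choice, not after it. If greedy skips `d`, then `ps` cannot start with `d` either,
    -- since a prefix of a reduced word is reduced.
    greedy-first : ∀ D u ps → AllPairs _≺_ D → AllPairs _≺_ ps → All (Beyond D) ps
      → Reduced (u ++ map (letterAt 𝐜) ps) → length (u ++ map (letterAt 𝐜) ps) ≡ N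
      → LexLeq 𝐜 ps (greedyPositions u D) → ps ≡ greedyPositions u D
    greedy-first []      u []  _ _ _ _ _ lex-[] = refl
    greedy-first (d ∷ D) u ps (d≺ ∷ sD) sp bey r len lex with Reduced? (u ∷ʳ letterAt 𝐜 d)
    greedy-first (d ∷ D) u []        (d≺ ∷ sD) _ _ r len lex-[] | yes rd =
      contradiction rd (¬Reduced-longer (trans (cong length (sym (++-identityʳ u))) len))
    greedy-first (d ∷ D) u (p ∷ ps) sD _ (b ∷ _) r len (lex-< p≺d) | yes rd with Beyond-head sD b
    ... | inj₁ refl = contradiction p≺d ≺-irrefl
    ... | inj₂ d≺p  = contradiction (≺-trans d≺p p≺d) ≺-irrefl
    greedy-first (d ∷ D) u (_ ∷ ps) (d≺ ∷ sD) (d≺ps ∷ sp) (_ ∷ bey) r len (lex-≡ lex) | yes rd =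
      cong (d ∷_) (greedy-first D (u ∷ʳ letterAt 𝐜 d) ps sD sp (All.zipWith (λ (d≺p , b) → Beyond-tail d≺p b) (d≺ps , bey))
        (subst Reduced (sym (++-assoc u _ _)) r) (trans (cong length (++-assoc u _ _)) len) lex)
    greedy-first (d ∷ D) u ps sdD@(d≺ ∷ sD) sp bey r len lex | no ¬rd =
      greedy-first D u ps sD sp (All.zipWith (λ (d≺p , b) → Beyond-tail d≺p b) (after ps sp bey r , bey)) r len lex
      where
      after : ∀ ps → AllPairs _≺_ ps → All (Beyond (d ∷ D)) ps → Reduced (u ++ map (letterAt 𝐜) ps) → All (d ≺_) ps
      after []       _          _         _ = []
      after (p ∷ ps) (p≺ ∷ _) (b ∷ _)  r with Beyond-head sdD b
      ... | inj₁ refl = contradiction (Reduced-prefix (u ∷ʳ letterAt 𝐜 d) (subst Reduced (sym (++-assoc u _ _)) r)) ¬rd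
      ... | inj₂ d≺p  = d≺p ∷ All.map (≺-trans d≺p) p≺

    sorting-unique : ∀ {w} → Complete 𝐜 → IsSortingWord 𝐜 w → w ≡ sorting 𝐜
    sorting-unique {w} all∈ (ps , linked , refl , lw , first) = begin
      map (letterAt 𝐜) ps                                ≡⟨ cong (map (letterAt 𝐜)) ps≡ ⟩
      map (letterAt 𝐜) gs                                ≡⟨ letters-gs ⟩
      sorting 𝐜                                          ∎
      where
      open ≡-Reasoning
      D = positions 0 N
      gs = greedyPositions [] D
      letters-gs : map (letterAt 𝐜) gs ≡ sorting 𝐜
      letters-gs = trans (greedyPositions-letters [] D) (cong (greedy []) (letters-positions 0 N))
      ps≡ : ps ≡ gs
      ps≡ = greedy-first D [] ps (positions-sorted 0 N) (Linked⇒AllPairs ≺-trans linked) (All.universal (positions-beyond N) ps)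
        (proj₁ lw) (IsLongest-length lw)
        (first gs (AllPairs⇒Linked (greedyPositions-sorted [] (positions-sorted 0 N)))
                  (subst IsLongestWord (sym letters-gs) (sorting-longest all∈)))

open SortingWords

theorem2p6 : (n : ℕ) (M : CoxeterMatrix n) → Coxeter.Finite M → (k : ℕ)
    → (𝐜 𝐜' w w' : Word n)
    → Coxeter.IsCoxeterWord M 𝐜 → Coxeter.IsCoxeterWord M 𝐜'
    → Coxeter.IsSortingWord M 𝐜 w → Coxeter.IsSortingWord M 𝐜' w'
    → SimplicialIso (Coxeter.MultiClusterFace M k 𝐜 w) (Coxeter.MultiClusterFace M k 𝐜' w')
theorem2p6 n M fin k 𝐜 𝐜' w w' cox cox' sort@(_ , _ , _ , long , _) sort' =
  Commutation.simplicial M (subst₂ (λ v v' → Commutation.PositionIso M (Coxeter.multiWord M k 𝐜 v) (Coxeter.multiWord M k 𝐜' v'))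
    (sym (sorting-unique 𝐜 (↭-complete σ) sort)) (sym (sorting-unique 𝐜' (↭-complete σ') sort'))
    (Connected-iso k (connected (length 𝐜) refl (Unique-resp-↭ (↭-sym σ) (allFin⁺ n)) (↭-trans σ (↭-sym σ'))) σ))
  where
  _≈?_ = Group.≈-dec M fin
  -- The given sorting word `w` serves as the longest word `w₀` for both Coxeter words.
  open Rotation M _≈?_ w long
  open Forest M _≈?_ w long
  open Sorting M _≈?_ w long using (sorting-unique)
  σ  = coxeterWord-↭ cox
  σ' = coxeterWord-↭ cox'
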